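{- For every $\varepsilon>0$ there is a deterministic distributed algorithm in the LOCAL model that, on any $n$-node graph with maximum degree $\Delta$, computes an $\varepsilon$-maximal matching in $O\left(\log^2 \Delta \cdot \log \frac{1}{\varepsilon} + \log^* n\right)$ rounds.
   Context: LOCAL model: the network is an undirected simple graph $G=(V,E)$ with $n=|V|$, maximum degree $\Delta$; each node has a unique identifier; computation proceeds in synchronous rounds in which each node does arbitrary local computation and sends a message of arbitrary size to each neighbor. All nodes know $\log\Delta$ up to a constant factor. A matching is a set of pairwise disjoint edges. For $M\subseteq E$ let $\Gamma^+(M):=\{e\in E : \exists e'\in M,\ e\cap e'\neq\emptyset\}$. For $\varepsilon>0$, a matching $M$ is $\varepsilon$-maximal if $|\Gamma^+(M)|\ge (1-\varepsilon)|E|$, i.e., after removing the edges in and incident to $M$ at most $\varepsilon|E|$ edges remain. -}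

module Defs where

open import Data.Nat using (ℕ; zero; suc; _+_; _∸_; _≤_; _<_; _<?_; _≤ᵇ_; _⊔_)
open import Data.Nat.DivMod using (_/_)
open import Data.Nat.Logarithm using (⌈log₂_⌉)
open import Data.Integer using (∣_∣; +_)
open import Data.Fin using (Fin; toℕ)
open import Data.List using (List; []; _∷_; map; concatMap; filter; length; foldr; allFin)
open import Data.Maybe using (Maybe; just; nothing; is-just)
open import Data.Bool using (Bool; true; false; _∨_; T; T?)
open import Data.Product using (Σ; _,_; proj₁; proj₂)
open import Data.Rational using (ℚ; ↥_; ↧ₙ_; 1ℚ; _-_; _*_) renaming (_≤_ to _≤ℚ_; _/_ to _/ℚ_)
open import Relation.Binary.PropositionalEquality using (_≡_)
open import Relation.Nullary.Decidable using (Dec)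
open import Relation.Nullary using (¬_)
open import Function.Definitions using (Injective)

-- log* m : number of applications of ⌈log₂_⌉ needed to bring m down to ≤ 1.
-- (fuel m suffices, since ⌈log₂ m⌉ < m for m ≥ 2)
logStarAux : ℕ → ℕ → ℕ
logStarAux zero    m = 0
logStarAux (suc f) m with m ≤ᵇ 1
... | true  = 0
... | false = suc (logStarAux f ⌈log₂ m ⌉)

log* : ℕ → ℕ
log* m = logStarAux m m

ceilDivSuc : ℕ → ℕ → ℕ
ceilDivSuc a k = (a + k) / suc k

-- For ε = p/q > 0 (so p ≥ 1): ⌈1/ε⌉ = ⌈q/p⌉, and logInv ε = ⌈log₂ ⌈1/ε⌉⌉ = ⌈log₂(1/ε)⌉.
-- (For ε ≥ 1 this is 0.)
logInv : ℚ → ℕ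
logInv ε = ⌈log₂ ceilDivSuc (↧ₙ ε) (∣ ↥ ε ∣ ∸ 1) ⌉

-- Simple graphs on vertex set Fin n, with port numbering
-- (each node v has deg v neighbours, reached via ports Fin (deg v)).

record Graph (n : ℕ) : Set where
  field
    deg     : Fin n → ℕ
    nbr     : (v : Fin n) → Fin (deg v) → Fin n
    nbr-inj : (v : Fin n) → Injective _≡_ _≡_ (nbr v)
    loopless : (v : Fin n) (i : Fin (deg v)) → ¬ (nbr v i ≡ v)
    rev     : (v : Fin n) (i : Fin (deg v)) → Fin (deg (nbr v i))
    rev-ok  : (v : Fin n) (i : Fin (deg v)) → nbr (nbr v i) (rev v i) ≡ v

module _ {n : ℕ} (G : Graph n) where
  open Graph G

  maxDeg : ℕ
  maxDeg = foldr (λ v m → deg v ⊔ m) 0 (allFin n)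

  darts : List (Σ (Fin n) (λ v → Fin (deg v)))
  darts = concatMap (λ v → map (λ i → v , i) (allFin (deg v))) (allFin n)

  -- each undirected edge {v, nbr v i} listed once (as the dart with smaller endpoint first)
  edges : List (Σ (Fin n) (λ v → Fin (deg v)))
  edges = filter (λ d → toℕ (proj₁ d) <? toℕ (nbr (proj₁ d) (proj₂ d))) darts

-- Deterministic LOCAL algorithms (message passing with ports).
-- Every node initially knows n, the estimate L of log Δ, its own identifier
-- and its degree; in each round it sends an arbitrary message on each port,
-- receives one message on each port and updates its state arbitrarily.
-- After `rounds n L` rounds each node outputs the port of the edge it is
-- matched along (or nothing if unmatched).

record LocalAlg : Set₁ where
  field
    State  : ℕ → Set
    Msg    : Set
    rounds : ℕ → ℕ → ℕ
    init   : (n L id d : ℕ) → State d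
    send   : ∀ {d} → State d → Fin d → Msg
    recv   : ∀ {d} → State d → (Fin d → Msg) → State d
    out    : ∀ {d} → State d → Maybe (Fin d)

module _ (A : LocalAlg) {n : ℕ} (G : Graph n) (ident : Fin n → ℕ) (L : ℕ) where
  open LocalAlg A
  open Graph G

  stateAt : ℕ → (v : Fin n) → State (deg v)
  stateAt zero    v = init n L (ident v) (deg v)
  stateAt (suc t) v = recv (stateAt t v) (λ i → send (stateAt t (nbr v i)) (rev v i))

  output : (v : Fin n) → Maybe (Fin (deg v))
  output v = out (stateAt (rounds n L) v)

  -- The outputs form a (consistent) matching: if v says it is matched along
  -- port i, then its neighbour u = nbr v i says it is matched along the port back to v.
  -- Then M = { {v, nbr v i} : output v ≡ just i } is a set of pairwise disjoint edges.
  ConsistentMatching : Set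
  ConsistentMatching = (v : Fin n) (i : Fin (deg v)) → output v ≡ just i →
                       output (nbr v i) ≡ just (rev v i)

  matched : Fin n → Bool
  matched v = is-just (output v)

  coveredEdges : List (Σ (Fin n) (λ v → Fin (deg v)))
  coveredEdges = filter (λ e → T? (matched (proj₁ e) ∨ matched (nbr (proj₁ e) (proj₂ e)))) (edges G)

  εMaximal : ℚ → Set
  εMaximal ε = (1ℚ - ε) * (+ length (edges G) /ℚ 1) ≤ℚ (+ length coveredEdges /ℚ 1)

{-# OPTIONS --safe #-}
-- The matching is computed as an independent set of the line graph, whose
-- vertices are the edges of G.  If w e is the number of active edges meeting e
-- (including e), a matching M covers at least ½ ∑_{e ∈ M} w e active edges, so
-- it suffices to find M with ∑_{e ∈ M} w e = Ω(number of active edges); then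
-- O(log 1/ε) repetitions leave an ε-fraction.
--
-- Start with the fractional solution x e ≈ 1 / (8 w e), a power of two, whose
-- value Φ = ∑ w x − (cost of the conflicts) is Ω(number of active edges), and
-- round it in O(log Δ) levels: in each level the edges with the smallest
-- positive x move to 0 or 2x.  Φ is affine in every coordinate, so one edge at a
-- time could always choose without loss.  Instead the edges are split into
-- O(log Δ) classes such that conflicts inside the classes carry only an
-- O(1 / log Δ) fraction of the cost; the classes decide one after the other, and
-- the total loss over all levels is a constant factor.
--
-- The classes come from a proper edge colouring with poly(Δ) colours (Linial's
-- colour reduction in log* n rounds, from sums of identifiers) by four passes of
-- defective colour reduction with q ≈ (log Δ)^{1/4} classes each.  Colour
-- reduction uses a code with small pairwise agreement, found greedily by the
-- method of conditional expectations.
module Submission where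

open import Defs
open import Data.Nat
open import Data.Nat.Properties
open import Data.Nat.DivMod using (_/_; _%_; m≡m%n+[m/n]*n; m%n<n)
open import Data.Nat.Induction using (<-rec)
open import Data.Nat.Logarithm using (⌈log₂_⌉; ⌈log₂⌉-mono-≤; ⌈log₂⌈n/2⌉⌉≡⌈log₂n⌉∸1; ⌈log₂2^n⌉≡n)
open import Data.Nat.Tactic.RingSolver using (solve-∀)
open import Data.Bool using (true; false; T; _∨_; if_then_else_)
open import Data.Bool.Properties using (T-∨)
open import Data.Empty using (⊥-elim)
open import Data.Fin using (Fin; toℕ; zero; suc)
open import Data.Fin.Properties using (toℕ-injective; any?) renaming (_≟_ to _≟ᶠ_)
open import Data.List using (List; []; _∷_; _++_; map; concatMap; filter; allFin; tabulate; foldr; length; downFrom)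
open import Data.List.Properties using (length-++; length-map; length-tabulate)
open import Data.List.Membership.Propositional using (_∈_)
open import Data.List.Membership.Propositional.Properties using (∈-allFin)
open import Data.List.Relation.Unary.Any using (here; there)
open import Data.Maybe using (Maybe; just; nothing) renaming (map to mapMaybe)
open import Data.Product using (Σ; _×_; _,_; proj₁; proj₂)
open import Data.Rational using (ℚ; 0ℚ) renaming (_<_ to _<ℚ_)
open import Data.Sum using (_⊎_; inj₁; inj₂)
open import Function using (id)
open import Function.Bundles using (Equivalence)
open import Function.Definitions using (Injective)
open import Relation.Nullary using (¬_; yes; no)
open import Relation.Unary using (Decidable)
open import Relation.Binary.Definitions using (tri<; tri≈; tri>)
open import Relation.Binary.PropositionalEquality

-- The round budget dictates the shape. Classes are chosen colour by colour, one round per colour,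
-- and a level may cost only O(log Δ) rounds. A single pass with q ≈ log Δ would leave at least q²
-- colours to be processed one after the other. With q ≈ (log Δ)^{1/4} every pass leaves O(q⁴) =
-- O(log Δ) colours, and since each pass refines the previous classes and multiplies the inner
-- conflicts by at most 2/q, four passes reach the required 16/q⁴. The loss of a level is paid by
-- the multiplier of the cost in Φ. It falls from 2K to K, by one in each of the K levels, so a
-- level may lose as much as the whole current cost. The final multiplier K still charges both
-- weights of every conflicting pair, which is what it costs to discard both of its edges. All
-- decisions depend on sums over adjacent edges only and not on the orientation of an edge. Hence
-- both end points can simulate an edge with identical copies of its data.

private
  variable
    𝒜 ℬ : Set

-- Finite sums and indicators

∑ : List 𝒜 → (𝒜 → ℕ) → ℕ
∑ []       f = 0
∑ (x ∷ xs) f = f x + ∑ xs f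

∑-cong : (xs : List 𝒜) {f g : 𝒜 → ℕ} → (∀ x → f x ≡ g x) → ∑ xs f ≡ ∑ xs g
∑-cong []       p = refl
∑-cong (x ∷ xs) p = cong₂ _+_ (p x) (∑-cong xs p)

∑-mono : (xs : List 𝒜) {f g : 𝒜 → ℕ} → (∀ x → f x ≤ g x) → ∑ xs f ≤ ∑ xs g
∑-mono []       p = z≤n
∑-mono (x ∷ xs) p = +-mono-≤ (p x) (∑-mono xs p)

∑-+ : (xs : List 𝒜) (f g : 𝒜 → ℕ) → ∑ xs (λ x → f x + g x) ≡ ∑ xs f + ∑ xs g
∑-+ []       f g = refl
∑-+ (x ∷ xs) f g = trans (cong (f x + g x +_) (∑-+ xs f g)) (interchange (f x) (g x) (∑ xs f) (∑ xs g))
  where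
  interchange : ∀ a b c d → (a + b) + (c + d) ≡ (a + c) + (b + d)
  interchange = solve-∀

∑-*ˡ : (xs : List 𝒜) (c : ℕ) (f : 𝒜 → ℕ) → ∑ xs (λ x → c * f x) ≡ c * ∑ xs f
∑-*ˡ []       c f = sym (*-zeroʳ c)
∑-*ˡ (x ∷ xs) c f = trans (cong (c * f x +_) (∑-*ˡ xs c f)) (sym (*-distribˡ-+ c (f x) (∑ xs f)))

∑-0 : (xs : List 𝒜) {f : 𝒜 → ℕ} → (∀ x → f x ≡ 0) → ∑ xs f ≡ 0
∑-0 []       p = refl
∑-0 (x ∷ xs) p = cong₂ _+_ (p x) (∑-0 xs p)

∑-swap : (xs : List 𝒜) (ys : List ℬ) (F : 𝒜 → ℬ → ℕ) →
         ∑ xs (λ x → ∑ ys (F x)) ≡ ∑ ys (λ y → ∑ xs (λ x → F x y))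
∑-swap []       ys F = sym (∑-0 ys (λ _ → refl))
∑-swap (x ∷ xs) ys F = trans (cong (∑ ys (F x) +_) (∑-swap xs ys F))
                             (sym (∑-+ ys (F x) (λ y → ∑ xs (λ z → F z y))))

-- Equality, and below it order, as a number 0 or 1: restrictions to a class, a colour or a position
-- become factors inside a sum.
δ : ℕ → ℕ → ℕ
δ zero    zero    = 1
δ zero    (suc n) = 0
δ (suc m) zero    = 0
δ (suc m) (suc n) = δ m n

lt : ℕ → ℕ → ℕ
lt m       zero    = 0
lt zero    (suc n) = 1
lt (suc m) (suc n) = lt m n

δ-refl : ∀ n → δ n n ≡ 1
δ-refl zero    = refl
δ-refl (suc n) = δ-refl n

δ-sym : ∀ m n → δ m n ≡ δ n m
δ-sym zero    zero    = refl
δ-sym zero    (suc n) = refl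
δ-sym (suc m) zero    = refl
δ-sym (suc m) (suc n) = δ-sym m n

δ≤1 : ∀ m n → δ m n ≤ 1
δ≤1 zero    zero    = ≤-refl
δ≤1 zero    (suc n) = z≤n
δ≤1 (suc m) zero    = z≤n
δ≤1 (suc m) (suc n) = δ≤1 m n

δ-≢ : ∀ m n → m ≢ n → δ m n ≡ 0
δ-≢ zero    zero    p = ⊥-elim (p refl)
δ-≢ zero    (suc n) p = refl
δ-≢ (suc m) zero    p = refl
δ-≢ (suc m) (suc n) p = δ-≢ m n (λ q → p (cong suc q))

δ-cases : ∀ m n → (m ≡ n × δ m n ≡ 1) ⊎ (m ≢ n × δ m n ≡ 0)
δ-cases m n with m ≟ n
... | yes refl = inj₁ (refl , δ-refl m)
... | no  p    = inj₂ (p , δ-≢ m n p)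

δ-trichotomy : ∀ m n → δ m n + (lt m n + lt n m) ≡ 1
δ-trichotomy zero    zero    = refl
δ-trichotomy zero    (suc n) = refl
δ-trichotomy (suc m) zero    = refl
δ-trichotomy (suc m) (suc n) = δ-trichotomy m n

lt≤1 : ∀ m n → lt m n ≤ 1
lt≤1 m       zero    = z≤n
lt≤1 zero    (suc n) = ≤-refl
lt≤1 (suc m) (suc n) = lt≤1 m n

<⇒lt : ∀ {m n} → m < n → lt m n ≡ 1
<⇒lt {zero}  (s≤s p) = refl
<⇒lt {suc m} (s≤s p) = <⇒lt p

≤⇒lt : ∀ {m n} → n ≤ m → lt m n ≡ 0
≤⇒lt z≤n     = refl
≤⇒lt (s≤s p) = ≤⇒lt p

lt-suc : ∀ m n → lt m (suc n) ≡ lt m n + δ m n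
lt-suc zero    zero    = refl
lt-suc zero    (suc n) = refl
lt-suc (suc m) zero    = refl
lt-suc (suc m) (suc n) = lt-suc m n

∑-δ : ∀ k (F : ℕ → ℕ) y → ∑ (downFrom k) (λ x → δ x y * F x) ≡ lt y k * F y
∑-δ zero    F y = refl
∑-δ (suc k) F y with δ-cases k y
... | inj₁ (refl , e) rewrite e | ∑-δ k F k | ≤⇒lt (≤-refl {k}) | <⇒lt (n<1+n k) = trans (+-identityʳ _) refl
... | inj₂ (k≢y , e)  rewrite e | ∑-δ k F y | lt-suc y k | δ-≢ y k (≢-sym k≢y) | +-identityʳ (lt y k) = refl

∑-const≤ : ∀ k c (F : ℕ → ℕ) → (∀ t → t < k → c ≤ F t) → k * c ≤ ∑ (downFrom k) F
∑-const≤ zero    c F p = z≤n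
∑-const≤ (suc k) c F p = +-mono-≤ (p k (n<1+n k)) (∑-const≤ k c F (λ t t<k → p t (m<n⇒m<1+n t<k)))

term≤∑ : ∀ k (F : ℕ → ℕ) t → t < k → F t ≤ ∑ (downFrom k) F
term≤∑ (suc k) F t t<k with t ≟ k
... | yes refl = m≤m+n (F t) _
... | no  p    = ≤-trans (term≤∑ k F t (≤∧≢⇒< (≤-pred t<k) p)) (m≤n+m _ (F k))

argmin : ℕ → (ℕ → ℕ) → ℕ
argmin zero    F = 0
argmin (suc k) F = if F k ≤ᵇ F (argmin k F) then k else argmin k F

argmin-cong : ∀ k {F G : ℕ → ℕ} → (∀ t → F t ≡ G t) → argmin k F ≡ argmin k G
argmin-cong zero    p = refl
argmin-cong (suc k) {F} {G} p rewrite argmin-cong k p | p k | p (argmin k G) = refl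

argmin-< : ∀ k (F : ℕ → ℕ) → argmin (suc k) F < suc k
argmin-< zero    F with F 0 ≤ᵇ F 0
... | true  = s≤s z≤n
... | false = s≤s z≤n
argmin-< (suc k) F with F (suc k) ≤ᵇ F (argmin (suc k) F)
... | true  = n<1+n (suc k)
... | false = m<n⇒m<1+n (argmin-< k F)

argmin-≤ : ∀ k (F : ℕ → ℕ) t → t < k → F (argmin k F) ≤ F t
argmin-≤ (suc k) F t t<k with F k ≤ᵇ F (argmin k F) in eq
... | true  with t ≟ k
...   | yes refl = ≤-refl
...   | no  p    = ≤-trans (≤ᵇ⇒≤ _ _ (subst T (sym eq) _)) (argmin-≤ k F t (≤∧≢⇒< (≤-pred t<k) p))
argmin-≤ (suc k) F t t<k | false with t ≟ k
...   | yes refl = <⇒≤ (≰⇒> (λ q → subst T eq (≤⇒≤ᵇ q)))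
...   | no  p    = argmin-≤ k F t (≤∧≢⇒< (≤-pred t<k) p)

-- A minimum is at most the average. This one inequality derandomises the choice of code letters, of
-- code positions and of classes.
argmin-avg : ∀ k (F : ℕ → ℕ) → k * F (argmin k F) ≤ ∑ (downFrom k) F
argmin-avg k F = ∑-const≤ k _ F (argmin-≤ k F)

-- Codes with small pairwise agreement

agree : (ℕ → ℕ) → (ℕ → ℕ) → ℕ → ℕ
agree u w m = ∑ (downFrom m) (λ t → δ (u t) (w t))

-- The letters of a word are chosen one after the other so as to minimise the
-- potential ∑ᵢ 2 ^ agree (f i) w, which on average grows by 1 + 1/Q per letter.
module _ (Q : ℕ) (f : ℕ → ℕ → ℕ) (s : ℕ) where

  potential : ℕ → ℕ → ℕ
  word      : ℕ → ℕ
  potential zero    i = 1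
  potential (suc t) i = potential t i * (1 + δ (f i t) (word t))
  word t = argmin Q (λ v → ∑ (downFrom s) (λ i → potential t i * δ (f i t) v))

  potential≡ : ∀ t i → potential t i ≡ 2 ^ agree (f i) word t
  potential≡ zero    i = refl
  potential≡ (suc t) i with δ-cases (f i t) (word t)
  ... | inj₁ (_ , e) rewrite e | potential≡ t i = *-comm (2 ^ agree (f i) word t) 2
  ... | inj₂ (_ , e) rewrite e | potential≡ t i = *-identityʳ _

  potential-step : ∀ t → Q * ∑ (downFrom s) (potential (suc t)) ≤ suc Q * ∑ (downFrom s) (potential t)
  potential-step t = begin
    Q * ∑ S (potential (suc t))                     ≡⟨ cong (Q *_) (∑-cong S λ i → *-distribˡ-+ (potential t i) 1 _) ⟩
    Q * ∑ S (λ i → potential t i * 1 + F (word t) i) ≡⟨ cong (Q *_) (∑-+ S (λ i → potential t i * 1) (F (word t))) ⟩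
    Q * (∑ S (λ i → potential t i * 1) + ∑ S (F (word t))) ≡⟨ cong (λ z → Q * (z + ∑ S (F (word t)))) (∑-cong S (λ i → *-identityʳ _)) ⟩
    Q * (∑ S (potential t) + ∑ S (F (word t)))       ≡⟨ *-distribˡ-+ Q _ _ ⟩
    Q * ∑ S (potential t) + Q * ∑ S (F (word t))     ≤⟨ +-monoʳ-≤ _ (argmin-avg Q (λ v → ∑ S (F v))) ⟩
    Q * ∑ S (potential t) + ∑ (downFrom Q) (λ v → ∑ S (F v)) ≡⟨ cong (Q * ∑ S (potential t) +_) (∑-swap (downFrom Q) S F) ⟩
    Q * ∑ S (potential t) + ∑ S (λ i → ∑ (downFrom Q) (λ v → F v i)) ≤⟨ +-monoʳ-≤ (Q * ∑ S (potential t)) (∑-mono S once) ⟩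
    Q * ∑ S (potential t) + ∑ S (potential t)        ≡⟨ +-comm (Q * ∑ S (potential t)) _ ⟩
    suc Q * ∑ S (potential t)                        ∎
    where
    open ≤-Reasoning
    S = downFrom s
    F : ℕ → ℕ → ℕ
    F v i = potential t i * δ (f i t) v
    once : ∀ i → ∑ (downFrom Q) (λ v → F v i) ≤ potential t i
    once i = begin
      ∑ (downFrom Q) (λ v → potential t i * δ (f i t) v) ≡⟨ ∑-cong (downFrom Q) (λ v → trans (*-comm (potential t i) _) (cong (_* potential t i) (δ-sym (f i t) v))) ⟩
      ∑ (downFrom Q) (λ v → δ v (f i t) * potential t i) ≡⟨ ∑-δ Q (λ _ → potential t i) (f i t) ⟩
      lt (f i t) Q * potential t i                       ≤⟨ *-monoˡ-≤ (potential t i) (lt≤1 (f i t) Q) ⟩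
      1 * potential t i                                  ≡⟨ *-identityˡ _ ⟩
      potential t i                                      ∎

  potential-bound : ∀ t → Q ^ t * ∑ (downFrom s) (potential t) ≤ suc Q ^ t * s
  potential-bound zero    = ≤-reflexive (cong (_+ 0) (ones s))
    where
    ones : ∀ s → ∑ (downFrom s) (λ _ → 1) ≡ s
    ones zero    = refl
    ones (suc s) = cong suc (ones s)
  potential-bound (suc t) = begin
    Q * Q ^ t * ∑ S (potential (suc t))       ≡⟨ shuffle Q (Q ^ t) _ ⟩
    Q ^ t * (Q * ∑ S (potential (suc t)))     ≤⟨ *-monoʳ-≤ (Q ^ t) (potential-step t) ⟩
    Q ^ t * (suc Q * ∑ S (potential t))       ≡⟨ sym (shuffle (suc Q) (Q ^ t) _) ⟩
    suc Q * Q ^ t * ∑ S (potential t)         ≡⟨ *-assoc (suc Q) (Q ^ t) _ ⟩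
    suc Q * (Q ^ t * ∑ S (potential t))       ≤⟨ *-monoʳ-≤ (suc Q) (potential-bound t) ⟩
    suc Q * (suc Q ^ t * s)                   ≡⟨ sym (*-assoc (suc Q) (suc Q ^ t) s) ⟩
    suc Q * suc Q ^ t * s                     ∎
    where
    open ≤-Reasoning
    S = downFrom s
    shuffle : ∀ a b c → a * b * c ≡ b * (a * c)
    shuffle = solve-∀

-- Cross-multiplied form of (1 + 1/Q)^t ≤ Q / (Q - t), with `r` for Q - t. At t = Q/2 the growth
-- factor is at most 2.
bernoulli : ∀ Q t r → t + r ≡ Q → suc Q ^ t * r ≤ Q ^ t * Q
bernoulli Q zero    r p = ≤-reflexive (cong (_+ 0) p)
bernoulli Q (suc t) r p = begin
  suc Q * suc Q ^ t * r     ≡⟨ shuffle (suc Q) (suc Q ^ t) r ⟩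
  suc Q ^ t * (suc Q * r)   ≤⟨ *-monoʳ-≤ (suc Q ^ t) (+-monoˡ-≤ (Q * r) (≤-trans (m≤n+m r (suc t)) (≤-reflexive p))) ⟩
  suc Q ^ t * (Q + Q * r)   ≡⟨ cong (suc Q ^ t *_) (sym (*-suc Q r)) ⟩
  suc Q ^ t * (Q * suc r)   ≡⟨ shuffle′ (suc Q ^ t) Q (suc r) ⟩
  Q * (suc Q ^ t * suc r)   ≤⟨ *-monoʳ-≤ Q (bernoulli Q t (suc r) (trans (+-suc t r) p)) ⟩
  Q * (Q ^ t * Q)           ≡⟨ sym (*-assoc Q (Q ^ t) Q) ⟩
  Q * Q ^ t * Q             ∎
  where
  open ≤-Reasoning
  shuffle : ∀ a b c → a * b * c ≡ b * (a * c)
  shuffle = solve-∀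
  shuffle′ : ∀ a b c → a * (b * c) ≡ b * (a * c)
  shuffle′ = solve-∀

-- Greedy extension: word `s` is built against all earlier words, so the agreement of two words is
-- settled when the later one is chosen.
code : ℕ → ℕ → ℕ → ℕ → ℕ
code Q zero    i = λ _ → 0
code Q (suc s) i = if i ≡ᵇ s then word Q (code Q s) s else code Q s i

≡ᵇ-refl : ∀ n → (n ≡ᵇ n) ≡ true
≡ᵇ-refl zero    = refl
≡ᵇ-refl (suc n) = ≡ᵇ-refl n

≡ᵇ-≢ : ∀ m n → m ≢ n → (m ≡ᵇ n) ≡ false
≡ᵇ-≢ zero    zero    p = ⊥-elim (p refl)
≡ᵇ-≢ zero    (suc n) p = refl
≡ᵇ-≢ (suc m) zero    p = refl
≡ᵇ-≢ (suc m) (suc n) p = ≡ᵇ-≢ m n (λ q → p (cong suc q))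

code-< : ∀ q s i t → code (suc q) s i t < suc q
code-< q zero    i t = s≤s z≤n
code-< q (suc s) i t with i ≡ᵇ s
... | true  = argmin-< q _
... | false = code-< q s i t

-- The alphabet has twice as many letters as there are positions, so the total potential grows from
-- `s` to at most 2 s, and one summand cannot exceed the total.
word-agree : ∀ m-1 f s i → i < s → let m = suc m-1 in
             2 ^ agree (f i) (word (m + m) f s) m ≤ 2 * s
word-agree m-1 f s i i<s = *-cancelˡ-≤ (Q ^ m * m) {{m*n≢0 (Q ^ m) m {{m^n≢0 Q m}}}} (begin
  Q ^ m * m * 2 ^ agree (f i) (word Q f s) m ≡⟨ cong (Q ^ m * m *_) (sym (potential≡ Q f s m i)) ⟩
  Q ^ m * m * potential Q f s m i            ≤⟨ *-monoʳ-≤ (Q ^ m * m) (term≤∑ s (potential Q f s m) i i<s) ⟩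
  Q ^ m * m * P                              ≡⟨ shuffle (Q ^ m) m P ⟩
  m * (Q ^ m * P)                            ≤⟨ *-monoʳ-≤ m (potential-bound Q f s m) ⟩
  m * (suc Q ^ m * s)                        ≡⟨ shuffle′ m (suc Q ^ m) s ⟩
  suc Q ^ m * m * s                          ≤⟨ *-monoˡ-≤ s (bernoulli Q m m refl) ⟩
  Q ^ m * (m + m) * s                        ≡⟨ shuffle″ (Q ^ m) m s ⟩
  Q ^ m * m * (2 * s)                        ∎)
  where
  open ≤-Reasoning
  m = suc m-1
  Q = m + m
  P = ∑ (downFrom s) (potential Q f s m)
  shuffle : ∀ a b c → a * b * c ≡ b * (a * c)
  shuffle = solve-∀
  shuffle′ : ∀ a b c → a * (b * c) ≡ b * a * c
  shuffle′ = solve-∀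
  shuffle″ : ∀ a b c → a * (b + b) * c ≡ a * b * (2 * c)
  shuffle″ = solve-∀

code-agree-< : ∀ m-1 s i j → i < j → j < s → let m = suc m-1 in
               2 ^ agree (code (m + m) s i) (code (m + m) s j) m ≤ 2 * s
code-agree-< m-1 (suc s) i j i<j j<s with j ≟ s
... | yes refl rewrite ≡ᵇ-refl j | ≡ᵇ-≢ i j (<⇒≢ i<j) =
  ≤-trans (word-agree m-1 (code _ j) j i i<j) (*-monoʳ-≤ 2 (n≤1+n j))
... | no  j≢s  rewrite ≡ᵇ-≢ j s j≢s | ≡ᵇ-≢ i s (<⇒≢ (<-≤-trans i<j (≤-pred j<s))) =
  ≤-trans (code-agree-< m-1 s i j i<j (≤∧≢⇒< (≤-pred j<s) j≢s)) (*-monoʳ-≤ 2 (n≤1+n s))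

agree-sym : ∀ u w m → agree u w m ≡ agree w u m
agree-sym u w m = ∑-cong (downFrom m) (λ t → δ-sym (u t) (w t))

2^-cancel-≤ : ∀ {m n} → 2 ^ m ≤ 2 ^ n → m ≤ n
2^-cancel-≤ {m} {n} p = subst₂ _≤_ (⌈log₂2^n⌉≡n m) (⌈log₂2^n⌉≡n n) (⌈log₂⌉-mono-≤ p)

code-agree : ∀ m-1 b i j → i ≢ j → i < 2 ^ b → j < 2 ^ b → let m = suc m-1 in
             agree (code (m + m) (2 ^ b) i) (code (m + m) (2 ^ b) j) m ≤ suc b
code-agree m-1 b i j i≢j i<s j<s with <-cmp i j
... | tri< i<j _ _ = 2^-cancel-≤ (code-agree-< m-1 (2 ^ b) i j i<j j<s)
... | tri≈ _ i≡j _ = ⊥-elim (i≢j i≡j)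
... | tri> _ _ j<i =
  subst (_≤ suc b) (agree-sym (code _ (2 ^ b) j) (code _ (2 ^ b) i) (suc m-1))
    (2^-cancel-≤ (code-agree-< m-1 (2 ^ b) j i j<i i<s))

-- Logarithms

n≤2*⌈n/2⌉ : ∀ n → n ≤ 2 * ⌈ n /2⌉
n≤2*⌈n/2⌉ zero          = z≤n
n≤2*⌈n/2⌉ (suc zero)    = s≤s z≤n
n≤2*⌈n/2⌉ (suc (suc n)) = ≤-trans (+-monoʳ-≤ 2 (n≤2*⌈n/2⌉ n)) (≤-reflexive (sym (*-suc 2 ⌈ n /2⌉)))

n≤2^⌈log₂n⌉ : ∀ n → n ≤ 2 ^ ⌈log₂ n ⌉
n≤2^⌈log₂n⌉ = <-rec _ go
  where
  go : ∀ n → (∀ {m} → m < n → m ≤ 2 ^ ⌈log₂ m ⌉) → n ≤ 2 ^ ⌈log₂ n ⌉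
  go 0 ih = z≤n
  go 1 ih = s≤s z≤n
  go n@(suc (suc k)) ih = begin
    n                          ≤⟨ n≤2*⌈n/2⌉ n ⟩
    2 * ⌈ n /2⌉                ≤⟨ *-monoʳ-≤ 2 (ih (⌈n/2⌉<n k)) ⟩
    2 * 2 ^ ⌈log₂ ⌈ n /2⌉ ⌉    ≡⟨ cong (λ z → 2 * 2 ^ z) (⌈log₂⌈n/2⌉⌉≡⌈log₂n⌉∸1 n) ⟩
    2 ^ ⌈log₂ n ⌉              ∎
    where open ≤-Reasoning

⌈log₂⌉-≤ : ∀ {n j} → n ≤ 2 ^ j → ⌈log₂ n ⌉ ≤ j
⌈log₂⌉-≤ {n} {j} p = subst (⌈log₂ n ⌉ ≤_) (⌈log₂2^n⌉≡n j) (⌈log₂⌉-mono-≤ p)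

1+n≤2^n : ∀ n → suc n ≤ 2 ^ n
1+n≤2^n zero    = ≤-refl
1+n≤2^n (suc n) = begin
  1 + suc n         ≤⟨ +-mono-≤ (m^n>0 2 n) (1+n≤2^n n) ⟩
  2 ^ n + 2 ^ n     ≡⟨ cong (2 ^ n +_) (sym (+-identityʳ (2 ^ n))) ⟩
  2 * 2 ^ n         ∎
  where open ≤-Reasoning

pair-<-injective : ∀ {Q} t t′ {x y} → x < Q → y < Q → t * Q + x ≡ t′ * Q + y → t ≡ t′ × x ≡ y
pair-<-injective {Q} t t′ {x} {y} x<Q y<Q eq = t≡t′ , +-cancelˡ-≡ (t * Q) x y (trans eq (cong (λ z → z * Q + y) (sym t≡t′)))
  where
  below : ∀ a b {u v} → u < Q → b * Q + v ≡ a * Q + u → ¬ (a < b)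
  below a b {u} {v} u<Q e a<b = <⇒≱ (begin-strict
    a * Q + u     <⟨ +-monoʳ-< (a * Q) u<Q ⟩
    a * Q + Q     ≡⟨ +-comm (a * Q) Q ⟩
    suc a * Q     ≤⟨ *-monoˡ-≤ Q a<b ⟩
    b * Q         ∎) (≤-trans (m≤m+n (b * Q) v) (≤-reflexive e))
    where open ≤-Reasoning
  t≡t′ : t ≡ t′
  t≡t′ with <-cmp t t′
  ... | tri< p _ _ = ⊥-elim (below t t′ x<Q (sym eq) p)
  ... | tri≈ _ p _ = p
  ... | tri> _ _ p = ⊥-elim (below t′ t y<Q eq p)

pair-< : ∀ {m Q t x} → t < m → x < Q → t * Q + x < m * Q
pair-< {m} {Q} {t} {x} t<m x<Q = begin-strict
  t * Q + x  <⟨ +-monoʳ-< (t * Q) x<Q ⟩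
  t * Q + Q  ≡⟨ +-comm (t * Q) Q ⟩
  suc t * Q  ≤⟨ *-monoˡ-≤ Q t<m ⟩
  m * Q      ∎
  where open ≤-Reasoning

-- Code dimensions and dyadic scales

δ-mono : ∀ {m n m′ n′} → (m ≡ n → m′ ≡ n′) → δ m n ≤ δ m′ n′
δ-mono {m} {n} {m′} {n′} p with δ-cases m n
... | inj₁ (e , d) rewrite d | p e | δ-refl n′ = ≤-refl
... | inj₂ (_ , d) rewrite d = z≤n

-- Codewords for 2 ^ b colours, read at m = μ (b + 1) positions over 2 m letters. Different words
-- agree in at most b + 1 positions, a fraction 1/μ; `size` counts the pairs of position and letter.
letter : ℕ → ℕ → ℕ → ℕ → ℕ
letter μ b = code (μ * suc b + μ * suc b) (2 ^ b)

size : ℕ → ℕ → ℕ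
size μ b = (μ * suc b) * (μ * suc b + μ * suc b)

abstract
  bits : ℕ → ℕ → ℕ
  bits μ b = ⌈log₂ size μ b ⌉

  bits≡ : ∀ μ b → bits μ b ≡ ⌈log₂ size μ b ⌉
  bits≡ μ b = refl

size≤2^bits : ∀ μ b → size μ b ≤ 2 ^ bits μ b
size≤2^bits μ b rewrite bits≡ μ b = n≤2^⌈log₂n⌉ (size μ b)

le : ℕ → ℕ → ℕ
le m n = lt m (suc n)

scale : ℕ → ℕ → ℕ → ℕ
scale K u zero    = 1
scale K u (suc j) = if u * 2 ^ suc j ≤ᵇ 2 ^ K then 2 ^ suc j else scale K u j

-- The search runs downwards. When 2 ^ suc j does not fit, 2 ^ K is less than 2 (u · 2 ^ j), which
-- is the upper bound required for the remaining search.
scale-spec : ∀ K u j → u ≤ 2 ^ K → 2 ^ K ≤ 2 * (u * 2 ^ j) →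
  Σ ℕ λ i → i ≤ j × scale K u j ≡ 2 ^ i × u * 2 ^ i ≤ 2 ^ K × 2 ^ K ≤ 2 * (u * 2 ^ i)
scale-spec K u zero    lo hi = 0 , z≤n , refl , ≤-trans (≤-reflexive (*-identityʳ u)) lo , hi
scale-spec K u (suc j) lo hi with u * 2 ^ suc j ≤ᵇ 2 ^ K | ≤ᵇ⇒≤ (u * 2 ^ suc j) (2 ^ K) | ≤⇒≤ᵇ {u * 2 ^ suc j} {2 ^ K}
... | true  | fits | _    = suc j , ≤-refl , refl , fits _ , hi
... | false | _    | fits = i , m≤n⇒m≤1+n i≤j , rest
  where
  double : ∀ u p → u * (2 * p) ≡ 2 * (u * p)
  double = solve-∀
  smaller = scale-spec K u j lo (<⇒≤ (subst (2 ^ K <_) (double u (2 ^ j)) (≰⇒> fits)))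
  i = proj₁ smaller
  i≤j = proj₁ (proj₂ smaller)
  rest = proj₂ (proj₂ smaller)

-- Weighted conflicts between adjacent elements

module Conflicts (E : Set) (es : List E) (a : E → E → ℕ) (a-sym : ∀ e f → a e f ≡ a f e) where

  -- The only channel through which an element learns about the others; an update that uses such
  -- sums is one round of communication.
  nb : E → (E → ℕ) → ℕ
  nb e F = ∑ es (λ f → a e f * F f)

  -- Ordered pairs: a symmetric `F` counts every conflict twice, which is why the utility enters Φ
  -- with a factor 2.
  dbl : (E → E → ℕ) → ℕ
  dbl F = ∑ es (λ e → nb e (F e))

  nb-cong : ∀ e {F G} → (∀ f → F f ≡ G f) → nb e F ≡ nb e G
  nb-cong e p = ∑-cong es (λ f → cong (a e f *_) (p f))

  nb-mono : ∀ e {F G} → (∀ f → F f ≤ G f) → nb e F ≤ nb e G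
  nb-mono e p = ∑-mono es (λ f → *-monoʳ-≤ (a e f) (p f))

  nb-+ : ∀ e F G → nb e (λ f → F f + G f) ≡ nb e F + nb e G
  nb-+ e F G = trans (∑-cong es (λ f → *-distribˡ-+ (a e f) (F f) (G f))) (∑-+ es _ _)

  nb-*ˡ : ∀ e c F → nb e (λ f → c * F f) ≡ c * nb e F
  nb-*ˡ e c F = trans (∑-cong es (λ f → swap (a e f) c (F f))) (∑-*ˡ es c _)
    where
    swap : ∀ x y z → x * (y * z) ≡ y * (x * z)
    swap = solve-∀

  nb-∑ : ∀ {A : Set} e (xs : List A) (F : A → E → ℕ) →
         ∑ xs (λ t → nb e (F t)) ≡ nb e (λ f → ∑ xs (λ t → F t f))
  nb-∑ e xs F = trans (∑-swap xs es (λ t f → a e f * F t f)) (∑-cong es (λ f → ∑-*ˡ xs (a e f) (λ t → F t f)))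

  -- Carries properness of a colouring, expressed with unit weights, over to arbitrary conflict
  -- weights.
  nb-null : ∀ e {F} → nb e F ≡ 0 → ∀ (V : E → ℕ) → nb e (λ f → V f * F f) ≡ 0
  nb-null e {F} p V = go es p
    where
    go : ∀ xs → ∑ xs (λ f → a e f * F f) ≡ 0 → ∑ xs (λ f → a e f * (V f * F f)) ≡ 0
    go []       q = refl
    go (x ∷ xs) q = cong₂ _+_ (trans (swap (a e x) (V x) (F x)) (trans (cong (V x *_) (m+n≡0⇒m≡0 _ q)) (*-zeroʳ (V x))))
                              (go xs (m+n≡0⇒n≡0 (a e x * F x) q))
      where
      swap : ∀ x y z → x * (y * z) ≡ y * (x * z)
      swap = solve-∀

  dbl-cong : ∀ {F G} → (∀ e f → F e f ≡ G e f) → dbl F ≡ dbl G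
  dbl-cong p = ∑-cong es (λ e → nb-cong e (p e))

  dbl-mono : ∀ {F G} → (∀ e f → F e f ≤ G e f) → dbl F ≤ dbl G
  dbl-mono p = ∑-mono es (λ e → nb-mono e (p e))

  dbl-+ : ∀ F G → dbl (λ e f → F e f + G e f) ≡ dbl F + dbl G
  dbl-+ F G = trans (∑-cong es (λ e → nb-+ e (F e) (G e))) (∑-+ es _ _)

  dbl-*ˡ : ∀ c F → dbl (λ e f → c * F e f) ≡ c * dbl F
  dbl-*ˡ c F = trans (∑-cong es (λ e → nb-*ˡ e c (F e))) (∑-*ˡ es c _)

  dbl-sym : ∀ F → dbl F ≡ dbl (λ e f → F f e)
  dbl-sym F = trans (∑-swap es es _) (∑-cong es (λ f → ∑-cong es (λ e → cong (_* F e f) (a-sym e f))))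

  -- Colour reduction: every element picks the position t of its codeword that
  -- minimises the conflict weight and takes (t , letter at t) as its new colour.

  pick : ℕ → ℕ → (E → E → ℕ) → (E → ℕ) → E → ℕ
  pick μ b V p e = argmin (μ * suc b) (λ t → nb e (λ f →
    V e f * ((1 ∸ δ (p e) (p f)) * δ (letter μ b (p e) t) (letter μ b (p f) t))))

  reduce : ℕ → ℕ → (E → E → ℕ) → (E → ℕ) → E → ℕ
  reduce μ b V p e = pick μ b V p e * (μ * suc b + μ * suc b) + letter μ b (p e) (pick μ b V p e)

  reduce-< : ∀ μ .{{_ : NonZero μ}} b V p e → reduce μ b V p e < (μ * suc b) * (μ * suc b + μ * suc b)
  reduce-< (suc μ) b V p e = pair-< {t = pick (suc μ) b V p e} (argmin-< (b + μ * suc b) _) (code-< _ (2 ^ b) (p e) _)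

  -- Neighbours of equal old colour are charged to the first term. Any other neighbour agrees with
  -- `e` in at most b + 1 of the μ (b + 1) positions, so the best position carries at most a
  -- fraction 1/μ of the total weight.
  reduce-conflict : ∀ μ .{{_ : NonZero μ}} b V p → (∀ e → p e < 2 ^ b) → let p′ = reduce μ b V p in ∀ e →
    μ * nb e (λ f → V e f * δ (p′ e) (p′ f)) ≤ μ * nb e (λ f → V e f * δ (p e) (p f)) + nb e (V e)
  reduce-conflict (suc μ) b V p p< e = begin
    suc μ * nb e (λ f → V e f * δ (p′ e) (p′ f))
      ≤⟨ *-monoʳ-≤ (suc μ) (nb-mono e (λ f → *-monoʳ-≤ (V e f) (split f))) ⟩
    suc μ * nb e (λ f → V e f * (δ (p e) (p f) + fresh f t))
      ≡⟨ cong (suc μ *_) (trans (nb-cong e (λ f → *-distribˡ-+ (V e f) _ _)) (nb-+ e _ _)) ⟩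
    suc μ * (old + new)       ≡⟨ *-distribˡ-+ (suc μ) old new ⟩
    suc μ * old + suc μ * new ≤⟨ +-monoʳ-≤ (suc μ * old) few ⟩
    suc μ * old + nb e (V e)  ∎
    where
    open ≤-Reasoning
    m = suc μ * suc b
    p′ = reduce (suc μ) b V p
    fresh : E → ℕ → ℕ
    fresh f t = (1 ∸ δ (p e) (p f)) * δ (letter (suc μ) b (p e) t) (letter (suc μ) b (p f) t)
    t = pick (suc μ) b V p e
    old = nb e (λ f → V e f * δ (p e) (p f))
    new = nb e (λ f → V e f * fresh f t)
    -- The position is part of the new colour, so a clash forces agreement at the position picked by
    -- `e`, whatever `f` minimised for itself.
    same : ∀ f → p′ e ≡ p′ f → letter (suc μ) b (p e) t ≡ letter (suc μ) b (p f) t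
    same f eq with pair-<-injective (pick (suc μ) b V p e) (pick (suc μ) b V p f) (code-< _ (2 ^ b) (p e) _) (code-< _ (2 ^ b) (p f) _) eq
    ... | q , r = trans r (cong (letter (suc μ) b (p f)) (sym q))
    split : ∀ f → δ (p′ e) (p′ f) ≤ δ (p e) (p f) + fresh f t
    split f with δ-cases (p e) (p f)
    ... | inj₁ (_ , d) rewrite d = ≤-trans (δ≤1 (p′ e) (p′ f)) (s≤s z≤n)
    ... | inj₂ (_ , d) rewrite d = ≤-trans (δ-mono (same f)) (≤-reflexive (sym (*-identityˡ _)))
    agreeing : ∀ f → ∑ (downFrom m) (fresh f) ≤ suc b
    agreeing f with δ-cases (p e) (p f)
    ... | inj₁ (_ , d) rewrite d | ∑-0 (downFrom m) {λ t → 0 * δ (letter (suc μ) b (p e) t) (letter (suc μ) b (p f) t)} (λ _ → refl) = z≤n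
    ... | inj₂ (pe≢pf , d) rewrite d = ≤-trans (≤-reflexive (∑-cong (downFrom m) (λ t → *-identityˡ _)))
            (code-agree (b + μ * suc b) b (p e) (p f) pe≢pf (p< e) (p< f))
    few : suc μ * new ≤ nb e (V e)
    few = *-cancelˡ-≤ (suc b) (begin
      suc b * (suc μ * new)  ≡⟨ trans (sym (*-assoc (suc b) (suc μ) new)) (cong (_* new) (*-comm (suc b) (suc μ))) ⟩
      m * new                ≤⟨ argmin-avg m _ ⟩
      ∑ (downFrom m) (λ t → nb e (λ f → V e f * fresh f t)) ≡⟨ nb-∑ e (downFrom m) _ ⟩
      nb e (λ f → ∑ (downFrom m) (λ t → V e f * fresh f t)) ≡⟨ nb-cong e (λ f → ∑-*ˡ (downFrom m) (V e f) (fresh f)) ⟩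
      nb e (λ f → V e f * ∑ (downFrom m) (fresh f)) ≤⟨ nb-mono e (λ f → *-monoʳ-≤ (V e f) (agreeing f)) ⟩
      nb e (λ f → V e f * suc b) ≡⟨ trans (nb-cong e (λ f → *-comm (V e f) (suc b))) (nb-*ˡ e (suc b) (V e)) ⟩
      suc b * nb e (V e)     ∎)

  -- Choosing classes in the order of the colours

  choose : ℕ → (E → E → ℕ) → (E → ℕ) → ℕ → (E → ℕ) → E → ℕ
  choose k V p γ h e =
    if p e ≡ᵇ γ then argmin k (λ v → nb e (λ f → V e f * (lt (p f) γ * δ (h f) v))) else h e

  choose* : ℕ → (E → E → ℕ) → (E → ℕ) → ℕ → (E → ℕ) → E → ℕ
  choose* k V p zero    h = h
  choose* k V p (suc γ) h = choose k V p γ (choose* k V p γ h)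

  choose-other : ∀ k V p γ h e → p e ≢ γ → choose k V p γ h e ≡ h e
  choose-other k V p γ h e q rewrite ≡ᵇ-≢ (p e) γ q = refl

  choose*-< : ∀ k .{{_ : NonZero k}} V p γ h e → p e < γ → choose* k V p γ h e < k
  choose*-< (suc k) V p (suc γ) h e q with p e ≟ γ
  ... | yes refl rewrite ≡ᵇ-refl (p e) = argmin-< k _
  ... | no  r    rewrite ≡ᵇ-≢ (p e) γ r = choose*-< (suc k) V p γ h e (≤∧≢⇒< (≤-pred q) r)

  -- When the colour of `e` decides, all smaller colours are fixed, and no later step touches either
  -- choice. The `k` classes share the weight towards smaller colours, so the least loaded one
  -- receives at most a `k`-th of it.
  choose*-conflict : ∀ k V p γ h → let h′ = choose* k V p γ h in ∀ e → p e < γ →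
    k * nb e (λ f → V e f * (lt (p f) (p e) * δ (h′ f) (h′ e))) ≤ nb e (λ f → V e f * lt (p f) (p e))
  choose*-conflict k V p (suc γ) h e q with p e ≟ γ
  ... | no  r rewrite ≡ᵇ-≢ (p e) γ r =
        ≤-trans (≤-reflexive (cong (k *_) (nb-cong e (λ f → cong (V e f *_) (keep f)))))
          (choose*-conflict k V p γ h e (≤∧≢⇒< (≤-pred q) r))
    where
    h₀ = choose* k V p γ h
    keep : ∀ f → lt (p f) (p e) * δ (choose k V p γ h₀ f) (h₀ e) ≡ lt (p f) (p e) * δ (h₀ f) (h₀ e)
    keep f with p f ≟ γ
    ... | no  s    = cong (λ z → lt (p f) (p e) * δ z (h₀ e)) (choose-other k V p γ h₀ f s)
    ... | yes refl rewrite ≤⇒lt (≤-pred q) = refl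
  ... | yes refl rewrite ≡ᵇ-refl (p e) = begin
    k * nb e (λ f → V e f * (lt (p f) γ′ * δ (choose k V p γ′ h₀ f) v))
      ≡⟨ cong (k *_) (nb-cong e (λ f → cong (V e f *_) (keep f))) ⟩
    k * nb e (λ f → V e f * (lt (p f) γ′ * δ (h₀ f) v))
      ≤⟨ argmin-avg k _ ⟩
    ∑ (downFrom k) (λ v → nb e (λ f → V e f * (lt (p f) γ′ * δ (h₀ f) v)))
      ≡⟨ nb-∑ e (downFrom k) _ ⟩
    nb e (λ f → ∑ (downFrom k) (λ v → V e f * (lt (p f) γ′ * δ (h₀ f) v)))
      ≡⟨ nb-cong e (λ f → trans (∑-*ˡ (downFrom k) (V e f) _) (cong (V e f *_) (∑-*ˡ (downFrom k) (lt (p f) γ′) _))) ⟩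
    nb e (λ f → V e f * (lt (p f) γ′ * ∑ (downFrom k) (δ (h₀ f))))
      ≤⟨ nb-mono e (λ f → *-monoʳ-≤ (V e f) (≤-trans (*-monoʳ-≤ (lt (p f) γ′) (once (h₀ f))) (≤-reflexive (*-identityʳ _)))) ⟩
    nb e (λ f → V e f * lt (p f) γ′) ∎
    where
    open ≤-Reasoning
    γ′ = p e
    h₀ = choose* k V p γ′ h
    v = argmin k (λ v → nb e (λ f → V e f * (lt (p f) γ′ * δ (h₀ f) v)))
    keep : ∀ f → lt (p f) γ′ * δ (choose k V p γ′ h₀ f) v ≡ lt (p f) γ′ * δ (h₀ f) v
    keep f with p f ≟ γ′
    ... | no  s = cong (λ z → lt (p f) γ′ * δ z v) (choose-other k V p γ′ h₀ f s)
    ... | yes s rewrite ≤⇒lt (≤-reflexive (sym s)) = refl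
    once : ∀ x → ∑ (downFrom k) (δ x) ≤ 1
    once x = begin
      ∑ (downFrom k) (δ x)              ≡⟨ ∑-cong (downFrom k) (λ v → trans (δ-sym x v) (sym (*-identityʳ _))) ⟩
      ∑ (downFrom k) (λ v → δ v x * 1)  ≡⟨ ∑-δ k (λ _ → 1) x ⟩
      lt x k * 1                        ≡⟨ *-identityʳ _ ⟩
      lt x k                            ≤⟨ lt≤1 x k ⟩
      1                                 ∎

  -- Elements of equal colour decide simultaneously and unaware of each other, which the first term
  -- covers. Every other pair is charged to its element of larger colour; both orders of these pairs
  -- together weigh at most `dbl V`.
  choose*-total : ∀ k V p γ h → (∀ e f → V e f ≡ V f e) → (∀ e → p e < γ) → let h′ = choose* k V p γ h in
    k * dbl (λ e f → V e f * δ (h′ e) (h′ f)) ≤ k * dbl (λ e f → V e f * δ (p e) (p f)) + dbl V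
  choose*-total k V p γ h V-sym p< = begin
    k * dbl (λ e f → V e f * δ (h′ e) (h′ f))
      ≤⟨ *-monoʳ-≤ k (dbl-mono (λ e f → ≤-trans (*-monoʳ-≤ (V e f) (split e f)) (≤-reflexive (distrib (V e f) _ _ _)))) ⟩
    k * dbl (λ e f → V e f * δ (p e) (p f) + (D e f + D′ e f))
      ≡⟨ cong (k *_) (trans (dbl-+ _ _) (cong (P +_) (dbl-+ D _))) ⟩
    k * (P + (dbl D + dbl D′))
      ≡⟨ cong (λ z → k * (P + (dbl D + z))) (trans (dbl-sym D′) (dbl-cong (λ e f → cong (_* (lt (p f) (p e) * δ (h′ f) (h′ e))) (V-sym f e)))) ⟩
    k * (P + (dbl D + dbl D))
      ≡⟨ arith k P (dbl D) ⟩
    k * P + (k * dbl D + k * dbl D)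
      ≤⟨ +-monoʳ-≤ (k * P) (+-mono-≤ half half) ⟩
    k * P + (dbl L + dbl L)
      ≡⟨ cong (λ z → k * P + (dbl L + z)) (trans (dbl-sym L) (dbl-cong (λ e f → cong (_* lt (p e) (p f)) (V-sym f e)))) ⟩
    k * P + (dbl L + dbl (λ e f → V e f * lt (p e) (p f)))
      ≡⟨ cong (k * P +_) (sym (dbl-+ _ _)) ⟩
    k * P + dbl (λ e f → L e f + V e f * lt (p e) (p f))
      ≤⟨ +-monoʳ-≤ (k * P) (dbl-mono (λ e f → ≤-trans (≤-reflexive (sym (*-distribˡ-+ (V e f) _ _)))
            (≤-trans (*-monoʳ-≤ (V e f) (excl (p f) (p e))) (≤-reflexive (*-identityʳ _))))) ⟩
    k * P + dbl V ∎
    where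
    open ≤-Reasoning
    h′ = choose* k V p γ h
    P = dbl (λ e f → V e f * δ (p e) (p f))
    D D′ L : E → E → ℕ
    D′ e f = V e f * (lt (p e) (p f) * δ (h′ e) (h′ f))
    D e f = V e f * (lt (p f) (p e) * δ (h′ f) (h′ e))
    L e f = V e f * lt (p f) (p e)
    arith : ∀ k p d → k * (p + (d + d)) ≡ k * p + (k * d + k * d)
    arith = solve-∀
    distrib : ∀ v x y z → v * (x + (y + z)) ≡ v * x + (v * y + v * z)
    distrib = solve-∀
    excl : ∀ x y → lt x y + lt y x ≤ 1
    excl x y = ≤-trans (m≤n+m _ (δ x y)) (≤-reflexive (δ-trichotomy x y))
    split : ∀ e f → δ (h′ e) (h′ f) ≤ δ (p e) (p f) + (lt (p f) (p e) * δ (h′ f) (h′ e) + lt (p e) (p f) * δ (h′ e) (h′ f))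
    split e f with <-cmp (p e) (p f)
    ... | tri< q _ _ rewrite <⇒lt q = ≤-trans (≤-reflexive (sym (+-identityʳ _))) (≤-trans (m≤n+m _ (lt (p f) (p e) * δ (h′ f) (h′ e))) (m≤n+m _ (δ (p e) (p f))))
    ... | tri≈ _ q _ rewrite q | δ-refl (p f) = ≤-trans (δ≤1 (h′ e) (h′ f)) (s≤s z≤n)
    ... | tri> _ _ q rewrite <⇒lt q | δ-sym (h′ e) (h′ f) = ≤-trans (≤-reflexive (sym (+-identityʳ _))) (≤-trans (m≤m+n _ _) (m≤n+m _ (δ (p e) (p f))))
    half : k * dbl D ≤ dbl L
    half = ≤-trans (≤-reflexive (sym (∑-*ˡ es k _))) (∑-mono es (λ e → choose*-conflict k V p γ h e (p< e)))

  Proper : (E → ℕ) → Set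
  Proper p = ∀ e → nb e (λ f → δ (p e) (p f)) ≡ 0

  -- Refining the classes in passes

  module _ (k B : ℕ) (V₀ : E → E → ℕ) (col : E → ℕ) where

    classWeight : (E → ℕ) → E → E → ℕ
    classWeight g e f = V₀ e f * δ (g e) (g f)

    -- Two reductions that lose 1/(2k) each, 1/k in all. After the first, the number of colours is
    -- still quadratic in `B`; the second replaces `B` by the logarithm of that number.
    passColour : (E → ℕ) → E → ℕ
    passColour g = reduce (2 * k) (bits (2 * k) B) (classWeight g) (reduce (2 * k) B (classWeight g) col)

    passChoice : (E → ℕ) → E → ℕ
    passChoice g = choose* k (classWeight g) (passColour g) (size (2 * k) (bits (2 * k) B)) (λ _ → 0)

    -- The choice is appended as a base-`k` digit, so classes are only split and conflicts already
    -- separated stay separated.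
    pass : (E → ℕ) → E → ℕ
    pass g e = g e * k + passChoice g e

    pass* : ℕ → E → ℕ
    pass* zero    = λ _ → 0
    pass* (suc r) = pass (pass* r)

  module _ (k : ℕ) .{{_ : NonZero k}} (B : ℕ) (V₀ : E → E → ℕ) (V₀-sym : ∀ e f → V₀ e f ≡ V₀ f e)
           (col : E → ℕ) (col< : ∀ e → col e < 2 ^ B) (proper : Proper col) where
    private
      instance
        2k≢0 : NonZero (2 * k)
        2k≢0 = m*n≢0 2 k

    passColour-< : ∀ g e → passColour k B V₀ col g e < size (2 * k) (bits (2 * k) B)
    passColour-< g e = reduce-< (2 * k) (bits (2 * k) B) (classWeight k B V₀ col g) (reduce (2 * k) B (classWeight k B V₀ col g) col) e

    passChoice-< : ∀ g e → passChoice k B V₀ col g e < k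
    passChoice-< g e = choose*-< k _ _ _ _ e (passColour-< g e)

    -- One share of the factor 2 comes from pairs with equal pass colour, the other from the greedy
    -- choice among different pass colours.
    pass-conflict : ∀ g → k * dbl (λ e f → V₀ e f * δ (pass k B V₀ col g e) (pass k B V₀ col g f))
                        ≤ 2 * dbl (λ e f → V₀ e f * δ (g e) (g f))
    pass-conflict g = begin
      k * dbl (λ e f → V₀ e f * δ (g′ e) (g′ f)) ≤⟨ *-monoʳ-≤ k (dbl-mono (λ e f →
            ≤-trans (*-monoʳ-≤ (V₀ e f) (decode e f)) (≤-reflexive (sym (*-assoc (V₀ e f) _ _))))) ⟩
      k * dbl (λ e f → V e f * δ (h e) (h f))    ≤⟨ choose*-total k V p₂ _ _ V-sym (passColour-< g) ⟩
      k * dbl (λ e f → V e f * δ (p₂ e) (p₂ f)) + dbl V ≤⟨ +-monoˡ-≤ (dbl V) defect ⟩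
      dbl V + dbl V                              ≡⟨ cong (dbl V +_) (sym (+-identityʳ (dbl V))) ⟩
      2 * dbl V ∎
      where
      open ≤-Reasoning
      V = classWeight k B V₀ col g
      p₁ = reduce (2 * k) B V col
      p₂ = passColour k B V₀ col g
      h  = passChoice k B V₀ col g
      g′ = pass k B V₀ col g
      V-sym : ∀ e f → V e f ≡ V f e
      V-sym e f = cong₂ _*_ (V₀-sym e f) (δ-sym (g e) (g f))
      decode : ∀ e f → δ (g′ e) (g′ f) ≤ δ (g e) (g f) * δ (h e) (h f)
      decode e f with δ-cases (g′ e) (g′ f)
      ... | inj₂ (_ , d) rewrite d = z≤n
      ... | inj₁ (q , d) with pair-<-injective (g e) (g f) (passChoice-< g e) (passChoice-< g f) q
      ...   | r , s rewrite d | r | s | δ-refl (g f) | δ-refl (h f) = ≤-refl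
      p₁< : ∀ e → p₁ e < 2 ^ bits (2 * k) B
      p₁< e = <-≤-trans (reduce-< (2 * k) B V col e) (size≤2^bits (2 * k) B)
      local : ∀ e → k * nb e (λ f → V e f * δ (p₂ e) (p₂ f)) ≤ nb e (V e)
      local e = *-cancelˡ-≤ 2 (begin
        2 * (k * nb e (λ f → V e f * δ (p₂ e) (p₂ f)))  ≡⟨ sym (*-assoc 2 k _) ⟩
        2 * k * nb e (λ f → V e f * δ (p₂ e) (p₂ f))    ≤⟨ reduce-conflict (2 * k) (bits (2 * k) B) V p₁ p₁< e ⟩
        2 * k * nb e (λ f → V e f * δ (p₁ e) (p₁ f)) + N ≤⟨ +-monoˡ-≤ N (reduce-conflict (2 * k) B V col col< e) ⟩
        -- The starting colouring is proper, so only the two reductions contribute, `N` each.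
        2 * k * nb e (λ f → V e f * δ (col e) (col f)) + N + N
          ≡⟨ cong (λ z → 2 * k * z + N + N) (nb-null e (proper e) (V e)) ⟩
        2 * k * 0 + N + N                               ≡⟨ cong (λ z → z + N + N) (*-zeroʳ (2 * k)) ⟩
        N + N                                           ≡⟨ cong (N +_) (sym (+-identityʳ N)) ⟩
        2 * N                                           ∎)
        where N = nb e (V e)
      defect : k * dbl (λ e f → V e f * δ (p₂ e) (p₂ f)) ≤ dbl V
      defect = ≤-trans (≤-reflexive (sym (∑-*ˡ es k _))) (∑-mono es local)

    pass*-< : ∀ r e → pass* k B V₀ col r e < k ^ r
    pass*-< zero    e = s≤s z≤n
    pass*-< (suc r) e = subst (pass* k B V₀ col (suc r) e <_) (*-comm (k ^ r) k)
      (pair-< {t = pass* k B V₀ col r e} (pass*-< r e) (passChoice-< (pass* k B V₀ col r) e))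

    pass*-conflict : ∀ r → k ^ r * dbl (λ e f → V₀ e f * δ (pass* k B V₀ col r e) (pass* k B V₀ col r f))
                         ≤ 2 ^ r * dbl V₀
    pass*-conflict zero    = ≤-reflexive (cong (_+ 0) (dbl-cong (λ e f → *-identityʳ _)))
    pass*-conflict (suc r) = begin
      k * k ^ r * X′      ≡⟨ shuffle k (k ^ r) X′ ⟩
      k ^ r * (k * X′)    ≤⟨ *-monoʳ-≤ (k ^ r) (pass-conflict (pass* k B V₀ col r)) ⟩
      k ^ r * (2 * X)     ≡⟨ shuffle′ (k ^ r) 2 X ⟩
      2 * (k ^ r * X)     ≤⟨ *-monoʳ-≤ 2 (pass*-conflict r) ⟩
      2 * (2 ^ r * dbl V₀) ≡⟨ sym (*-assoc 2 (2 ^ r) (dbl V₀)) ⟩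
      2 * 2 ^ r * dbl V₀  ∎
      where
      open ≤-Reasoning
      X  = dbl (λ e f → V₀ e f * δ (pass* k B V₀ col r e) (pass* k B V₀ col r f))
      X′ = dbl (λ e f → V₀ e f * δ (pass* k B V₀ col (suc r) e) (pass* k B V₀ col (suc r) f))
      shuffle : ∀ a b c → a * b * c ≡ b * (a * c)
      shuffle = solve-∀
      shuffle′ : ∀ a b c → a * (b * c) ≡ b * (a * c)
      shuffle′ = solve-∀

  -- Rounding

  utility : (E → ℕ) → (E → ℕ) → ℕ
  utility w x = ∑ es (λ e → w e * x e)

  -- A conflict is charged both weights because both of its elements will be discarded.
  cost : (E → ℕ) → (E → ℕ) → ℕ
  cost w x = dbl (λ e f → (w e + w f) * (x e * x f))

  -- Half the partial derivative of the cost at `y`: comparing Λ times it with `T * w e` tells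
  -- whether raising the value of `e` raises Φ.
  pressure : (E → ℕ) → (E → ℕ) → E → ℕ
  pressure w y e = nb e (λ f → (w e + w f) * y f)

  cost-expand : ∀ w x y z c → (∀ e → x e ≡ y e + c * z e) →
    cost w x ≡ cost w y + 2 * c * ∑ es (λ e → z e * pressure w y e) + c * c * cost w z
  cost-expand w x y z c x≡ = begin
    cost w x
      ≡⟨ dbl-cong (λ e f → trans (cong₂ (λ u v → (w e + w f) * (u * v)) (x≡ e) (x≡ f)) (expand (w e + w f) (y e) (z e) (y f) (z f) c)) ⟩
    dbl (λ e f → Y e f + (c * M e f + c * M′ e f) + c * c * Z e f)
      ≡⟨ trans (dbl-+ _ _) (cong₂ _+_ (trans (dbl-+ Y _) (cong (dbl Y +_) (trans (dbl-+ _ _) (cong₂ _+_ (dbl-*ˡ c M) (dbl-*ˡ c M′))))) (dbl-*ˡ (c * c) Z)) ⟩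
    dbl Y + (c * dbl M + c * dbl M′) + c * c * dbl Z
      ≡⟨ cong (λ u → dbl Y + (c * dbl M + c * u) + c * c * dbl Z) (trans (dbl-sym M′) (dbl-cong (λ e f → swap (w f) (w e) (y f) (z e)))) ⟩
    dbl Y + (c * dbl M + c * dbl M) + c * c * dbl Z
      ≡⟨ cong (λ u → dbl Y + u + c * c * dbl Z) (twice c (dbl M)) ⟩
    dbl Y + 2 * c * dbl M + c * c * dbl Z
      ≡⟨ cong (λ u → dbl Y + 2 * c * u + c * c * dbl Z) (∑-cong es (λ e → trans (nb-cong e (λ f → pull (w e + w f) (z e) (y f))) (nb-*ˡ e (z e) _))) ⟩
    cost w y + 2 * c * ∑ es (λ e → z e * pressure w y e) + c * c * cost w z ∎
    where
    open ≡-Reasoning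
    Y Z M M′ : E → E → ℕ
    Y e f = (w e + w f) * (y e * y f)
    Z e f = (w e + w f) * (z e * z f)
    M e f = (w e + w f) * (z e * y f)
    M′ e f = (w e + w f) * (y e * z f)
    expand : ∀ b y z y′ z′ c → b * ((y + c * z) * (y′ + c * z′)) ≡ b * (y * y′) + (c * (b * (z * y′)) + c * (b * (y * z′))) + c * c * (b * (z * z′))
    expand = solve-∀
    swap : ∀ p q r s → (p + q) * (r * s) ≡ (q + p) * (s * r)
    swap = solve-∀
    twice : ∀ c m → c * m + c * m ≡ 2 * c * m
    twice = solve-∀
    pull : ∀ b z y → b * (z * y) ≡ z * (b * y)
    pull = solve-∀

  -- Φ(x) = 2 T U(x) − Λ C(x) is affine in every single coordinate, so moving the
  -- mass z to the better of 0 and 2 z only loses the interaction of z with itself.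
  round-gain : ∀ T Λ w x x′ y z (u : E → ℕ) →
    (∀ e → u e ≡ le (Λ * pressure w y e) (T * w e)) →
    (∀ e → x e ≡ y e + 1 * z e) → (∀ e → x′ e ≡ y e + 2 * (u e * z e)) →
    2 * T * utility w x + Λ * cost w x′ ≤ 2 * T * utility w x′ + Λ * (cost w x + 3 * cost w z)
  round-gain T Λ w x x′ y z u u≡ x≡ x′≡ = begin
    2 * T * utility w x + Λ * cost w x′
      ≡⟨ cong₂ (λ p q → 2 * T * p + Λ * q) (util x 1 z x≡) (cost-expand w x′ y v 2 x′≡) ⟩
    2 * T * (Uy + 1 * Uz) + Λ * (Cy + 4 * Mv + 4 * Cv)
      ≡⟨ arith₁ T Λ Uy Uz Cy Mv Cv ⟩
    2 * T * Uy + Λ * Cy + 2 * (T * Uz + 2 * (Λ * Mv)) + Λ * (4 * Cv)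
      ≤⟨ +-mono-≤ (+-monoʳ-≤ (2 * T * Uy + Λ * Cy) (*-monoʳ-≤ 2 linear)) (*-monoʳ-≤ Λ (*-monoʳ-≤ 4 Cv≤Cz)) ⟩
    2 * T * Uy + Λ * Cy + 2 * (2 * (T * Uv) + Λ * Mz) + Λ * (4 * Cz)
      ≡⟨ arith₂ T Λ Uy Uv Cy Mz Cz ⟩
    2 * T * (Uy + 2 * Uv) + Λ * (Cy + 2 * 1 * Mz + 1 * 1 * Cz + 3 * Cz)
      ≡⟨ cong₂ (λ p q → 2 * T * p + Λ * (q + 3 * Cz)) (sym (util x′ 2 v x′≡)) (sym (cost-expand w x y z 1 x≡)) ⟩
    2 * T * utility w x′ + Λ * (cost w x + 3 * cost w z) ∎
    where
    open ≤-Reasoning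
    v : E → ℕ
    v e = u e * z e
    Uy = utility w y
    Uz = utility w z
    Uv = utility w v
    Cy = cost w y
    Cz = cost w z
    Cv = cost w v
    Mz = ∑ es (λ e → z e * pressure w y e)
    Mv = ∑ es (λ e → v e * pressure w y e)
    arith₁ : ∀ T Λ Uy Uz Cy Mv Cv → 2 * T * (Uy + 1 * Uz) + Λ * (Cy + 4 * Mv + 4 * Cv) ≡ 2 * T * Uy + Λ * Cy + 2 * (T * Uz + 2 * (Λ * Mv)) + Λ * (4 * Cv)
    arith₁ = solve-∀
    arith₂ : ∀ T Λ Uy Uv Cy Mz Cz → 2 * T * Uy + Λ * Cy + 2 * (2 * (T * Uv) + Λ * Mz) + Λ * (4 * Cz) ≡ 2 * T * (Uy + 2 * Uv) + Λ * (Cy + 2 * 1 * Mz + 1 * 1 * Cz + 3 * Cz)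
    arith₂ = solve-∀
    util : ∀ x c z → (∀ e → x e ≡ y e + c * z e) → utility w x ≡ Uy + c * utility w z
    util x c z q = trans (∑-cong es (λ e → trans (cong (w e *_) (q e)) (dist (w e) (y e) c (z e))))
                     (trans (∑-+ es _ _) (cong (Uy +_) (∑-*ˡ es c _)))
      where
      dist : ∀ w y c z → w * (y + c * z) ≡ w * y + c * (w * z)
      dist = solve-∀
    v≤z : ∀ e → v e ≤ z e
    v≤z e = ≤-trans (*-monoˡ-≤ (z e) (subst (_≤ 1) (sym (u≡ e)) (lt≤1 (Λ * pressure w y e) (suc (T * w e))))) (≤-reflexive (*-identityˡ (z e)))
    Cv≤Cz : Cv ≤ Cz
    Cv≤Cz = dbl-mono (λ e f → *-monoʳ-≤ (w e + w f) (*-mono-≤ (v≤z e) (v≤z f)))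
    -- Subtraction-free form of (A - B) z ≤ 2 (A - B) u z, which holds as `u` is 1 exactly when A -
    -- B is nonnegative.
    better : ∀ A B u z → u ≡ le B A → A * z + 2 * (B * (u * z)) ≤ 2 * (A * (u * z)) + B * z
    better A B u z q with B ≤? A
    ... | yes B≤A rewrite q | <⇒lt (s≤s B≤A) = begin
      A * z + 2 * (B * (1 * z))       ≡⟨ e₁ A B z ⟩
      (A * z + B * z) + B * z         ≤⟨ +-monoʳ-≤ (A * z + B * z) (*-monoˡ-≤ z B≤A) ⟩
      (A * z + B * z) + A * z         ≡⟨ e₂ A B z ⟩
      2 * (A * (1 * z)) + B * z       ∎
      where
      e₁ : ∀ A B z → A * z + 2 * (B * (1 * z)) ≡ (A * z + B * z) + B * z
      e₁ = solve-∀
      e₂ : ∀ A B z → (A * z + B * z) + A * z ≡ 2 * (A * (1 * z)) + B * z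
      e₂ = solve-∀
    ... | no  B≰A rewrite q | ≤⇒lt (≰⇒> B≰A) | *-zeroʳ A | *-zeroʳ B | +-identityʳ (A * z) =
      *-monoˡ-≤ z (<⇒≤ (≰⇒> B≰A))
    linear : T * Uz + 2 * (Λ * Mv) ≤ 2 * (T * Uv) + Λ * Mz
    linear = begin
      T * Uz + 2 * (Λ * Mv)
        ≡⟨ cong₂ _+_ (sym (∑-*ˡ es T _)) (trans (cong (2 *_) (sym (∑-*ˡ es Λ _))) (sym (∑-*ˡ es 2 _))) ⟩
      ∑ es (λ e → T * (w e * z e)) + ∑ es (λ e → 2 * (Λ * (v e * D e)))
        ≡⟨ sym (∑-+ es _ _) ⟩
      ∑ es (λ e → T * (w e * z e) + 2 * (Λ * (v e * D e)))
        ≤⟨ ∑-mono es (λ e → subst₂ _≤_ (l₁ T Λ (w e) (z e) (u e) (D e)) (l₂ T Λ (w e) (z e) (u e) (D e)) (better (T * w e) (Λ * D e) (u e) (z e) (u≡ e))) ⟩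
      ∑ es (λ e → 2 * (T * (w e * v e)) + Λ * (z e * D e))
        ≡⟨ ∑-+ es _ _ ⟩
      ∑ es (λ e → 2 * (T * (w e * v e))) + ∑ es (λ e → Λ * (z e * D e))
        ≡⟨ cong₂ _+_ (trans (∑-*ˡ es 2 _) (cong (2 *_) (∑-*ˡ es T _))) (∑-*ˡ es Λ _) ⟩
      2 * (T * Uv) + Λ * Mz ∎
      where
      D = pressure w y
      l₁ : ∀ T Λ w z u D → T * w * z + 2 * (Λ * D * (u * z)) ≡ T * (w * z) + 2 * (Λ * (u * z * D))
      l₁ = solve-∀
      l₂ : ∀ T Λ w z u D → 2 * (T * w * (u * z)) + Λ * D * z ≡ 2 * (T * (w * (u * z))) + Λ * (z * D)
      l₂ = solve-∀

  moving : ℕ → (E → ℕ) → E → ℕ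
  moving j x e = δ (x e) (2 ^ j) * x e

  module _ (T Λ j : ℕ) (w g : E → ℕ) where

    turn : ℕ → (E → ℕ) → E → ℕ
    turn γ x e = δ (x e) (2 ^ j) * δ (g e) γ

    -- The factor `1 ∸ turn` removes the elements in turn from the pressure: they decide
    -- simultaneously, as if the others of their class had value 0.
    round : ℕ → (E → ℕ) → E → ℕ
    round γ x e = (1 ∸ turn γ x e) * x e
      + 2 * (le (Λ * nb e (λ f → (w e + w f) * ((1 ∸ turn γ x f) * x f))) (T * w e) * (turn γ x e * x e))

    round* : ℕ → (E → ℕ) → E → ℕ
    round* zero    x = x
    round* (suc γ) x = round γ (round* γ x)

    turn-other : ∀ γ x e → g e ≢ γ → turn γ x e ≡ 0
    turn-other γ x e q rewrite δ-≢ (g e) γ q = *-zeroʳ (δ (x e) (2 ^ j))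

    turn-cases : ∀ γ x e → (x e ≡ 2 ^ j × g e ≡ γ × turn γ x e ≡ 1) ⊎ (turn γ x e ≡ 0 × (g e ≡ γ → x e ≢ 2 ^ j))
    turn-cases γ x e with δ-cases (x e) (2 ^ j) | δ-cases (g e) γ
    ... | inj₁ (p , d) | inj₁ (q , d′) rewrite d | d′ = inj₁ (p , q , refl)
    ... | inj₁ (p , d) | inj₂ (q , d′) rewrite d | d′ = inj₂ (refl , λ r → ⊥-elim (q r))
    ... | inj₂ (p , d) | _ rewrite d = inj₂ (refl , λ _ → p)

    round-stay : ∀ γ x e → turn γ x e ≡ 0 → round γ x e ≡ x e
    round-stay γ x e q = trans (cong (λ t → (1 ∸ t) * x e + 2 * (L * (t * x e))) q) (drop L (x e))
      where
      L = le (Λ * nb e (λ f → (w e + w f) * ((1 ∸ turn γ x f) * x f))) (T * w e)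
      drop : ∀ l x → 1 * x + 2 * (l * (0 * x)) ≡ x
      drop = solve-∀

    round*-later : ∀ γ x e → γ ≤ g e → round* γ x e ≡ x e
    round*-later zero    x e q = refl
    round*-later (suc γ) x e q =
      trans (round-stay γ (round* γ x) e (turn-other γ (round* γ x) e (>⇒≢ q))) (round*-later γ x e (<⇒≤ q))

    turn-moving : ∀ γ x e → turn γ (round* γ x) e * round* γ x e ≡ δ (g e) γ * moving j x e
    turn-moving γ x e with δ-cases (g e) γ
    ... | inj₂ (q , d) rewrite d = cong (_* round* γ x e) (*-zeroʳ (δ (round* γ x e) (2 ^ j)))
    ... | inj₁ (q , d) rewrite d | round*-later γ x e (≤-reflexive (sym q)) =
      trans (cong (_* x e) (*-identityʳ (δ (x e) (2 ^ j)))) (sym (*-identityˡ (moving j x e)))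

    -- The values in turn at most double, so their mutual cost grows to at most four times itself.
    -- The increase explains the 3.
    round-step : ∀ γ x → 2 * T * utility w x + Λ * cost w (round γ x)
                       ≤ 2 * T * utility w (round γ x) + Λ * (cost w x + 3 * cost w (λ e → turn γ x e * x e))
    round-step γ x = round-gain T Λ w x (round γ x) (λ e → (1 ∸ turn γ x e) * x e) (λ e → turn γ x e * x e) _
      (λ _ → refl) split (λ _ → refl)
      where
      split : ∀ e → x e ≡ (1 ∸ turn γ x e) * x e + 1 * (turn γ x e * x e)
      split e with turn-cases γ x e
      ... | inj₁ (_ , _ , q) rewrite q = sym (trans (+-identityʳ _) (+-identityʳ _))
      ... | inj₂ (q , _) rewrite q = sym (trans (+-identityʳ _) (+-identityʳ _))

    -- The conflicts inside classes below `γ`, measured at the values before the level: this is all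
    -- that the simultaneous decisions can lose.
    mono : ℕ → (E → ℕ) → ℕ
    mono γ x = dbl (λ e f → (w e + w f) * (lt (g e) γ * δ (g e) (g f) * (moving j x e * moving j x f)))

    -- Class `γ` still has its initial values when its turn comes (`turn-moving`), so its mutual
    -- cost is the new diagonal block of `mono`.
    mono-suc : ∀ γ x → mono (suc γ) x ≡ mono γ x + cost w (λ e → turn γ (round* γ x) e * round* γ x e)
    mono-suc γ x = trans (dbl-cong point) (dbl-+ _ _)
      where
      dist : ∀ b l d s m → b * ((l + d) * s * m) ≡ b * (l * s * m) + b * (d * s * m)
      dist = solve-∀
      same : ∀ e f → δ (g e) γ * δ (g e) (g f) ≡ δ (g e) γ * δ (g f) γ
      same e f with δ-cases (g e) γ
      ... | inj₁ (q , d) rewrite q = cong (δ γ γ *_) (δ-sym γ (g f))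
      ... | inj₂ (_ , d) rewrite d = refl
      regroup : ∀ p q m n → p * q * (m * n) ≡ p * m * (q * n)
      regroup = solve-∀
      point : ∀ e f → (w e + w f) * (lt (g e) (suc γ) * δ (g e) (g f) * (moving j x e * moving j x f))
            ≡ (w e + w f) * (lt (g e) γ * δ (g e) (g f) * (moving j x e * moving j x f))
              + (w e + w f) * ((turn γ (round* γ x) e * round* γ x e) * (turn γ (round* γ x) f * round* γ x f))
      point e f rewrite turn-moving γ x e | turn-moving γ x f | lt-suc (g e) γ =
        trans (dist (w e + w f) (lt (g e) γ) (δ (g e) γ) (δ (g e) (g f)) (moving j x e * moving j x f))
          (cong (λ z → (w e + w f) * (lt (g e) γ * δ (g e) (g f) * (moving j x e * moving j x f)) + (w e + w f) * z)
            (trans (cong (_* (moving j x e * moving j x f)) (same e f)) (regroup (δ (g e) γ) (δ (g f) γ) (moving j x e) (moving j x f))))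

    round*-gain : ∀ γ x → 2 * T * utility w x + Λ * cost w (round* γ x)
                        ≤ 2 * T * utility w (round* γ x) + Λ * (cost w x + 3 * mono γ x)
    round*-gain zero    x = +-monoʳ-≤ _ (*-monoʳ-≤ Λ (m≤m+n _ _))
    round*-gain (suc γ) x = +-cancelˡ-≤ (Λ * C) _ _ (begin
      Λ * C + (U₀ + Λ * C′)              ≡⟨ e₁ (Λ * C) U₀ (Λ * C′) ⟩
      (U₀ + Λ * C) + Λ * C′              ≤⟨ +-monoˡ-≤ (Λ * C′) (round*-gain γ x) ⟩
      (U + Λ * (C₀ + 3 * M)) + Λ * C′    ≡⟨ e₂ U (Λ * (C₀ + 3 * M)) (Λ * C′) ⟩
      (U + Λ * C′) + Λ * (C₀ + 3 * M)    ≤⟨ +-monoˡ-≤ (Λ * (C₀ + 3 * M)) (round-step γ (round* γ x)) ⟩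
      (U′ + Λ * (C + 3 * Z)) + Λ * (C₀ + 3 * M) ≡⟨ e₃ Λ U′ C Z C₀ M ⟩
      Λ * C + (U′ + Λ * (C₀ + 3 * (M + Z))) ≡⟨ cong (λ z → Λ * C + (U′ + Λ * (C₀ + 3 * z))) (sym (mono-suc γ x)) ⟩
      Λ * C + (U′ + Λ * (C₀ + 3 * mono (suc γ) x)) ∎)
      where
      open ≤-Reasoning
      U₀ = 2 * T * utility w x
      U  = 2 * T * utility w (round* γ x)
      U′ = 2 * T * utility w (round* (suc γ) x)
      C₀ = cost w x
      C  = cost w (round* γ x)
      C′ = cost w (round* (suc γ) x)
      M  = mono γ x
      Z  = cost w (λ e → turn γ (round* γ x) e * round* γ x e)
      e₁ : ∀ p q r → p + (q + r) ≡ (q + p) + r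
      e₁ = solve-∀
      e₂ : ∀ p q r → (p + q) + r ≡ (p + r) + q
      e₂ = solve-∀
      e₃ : ∀ Λ U C Z C₀ M → (U + Λ * (C + 3 * Z)) + Λ * (C₀ + 3 * M) ≡ Λ * C + (U + Λ * (C₀ + 3 * (M + Z)))
      e₃ = solve-∀

  -- Invariant of the rounding: before level `j` a value is 0 or a power of two from 2 ^ j to 2 ^ K.
  -- After K levels only 0 and 2 ^ K remain.
  DyadicFrom : ℕ → ℕ → ℕ → Set
  DyadicFrom j K n = n ≡ 0 ⊎ Σ ℕ (λ i → j ≤ i × i ≤ K × n ≡ 2 ^ i)

  round-dyadic : ∀ T Λ j w g K → j < K → ∀ γ x e → g e ≡ γ → DyadicFrom j K (x e) →
    DyadicFrom (suc j) K (round T Λ j w g γ x e)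
  round-dyadic T Λ j w g K j<K γ x e g≡γ d with turn-cases T Λ j w g γ x e
  ... | inj₂ (t≡0 , x≢) rewrite round-stay T Λ j w g γ x e t≡0 with d
  ...   | inj₁ z = inj₁ z
  ...   | inj₂ (i , j≤i , i≤K , x≡) with j ≟ i
  ...     | yes refl = ⊥-elim (x≢ g≡γ x≡)
  ...     | no  j≢i  = inj₂ (i , ≤∧≢⇒< j≤i j≢i , i≤K , x≡)
  round-dyadic T Λ j w g K j<K γ x e g≡γ d | inj₁ (x≡ , _ , t≡1)
    with Λ * nb e (λ f → (w e + w f) * ((1 ∸ turn T Λ j w g γ x f) * x f)) ≤? T * w e
  ...   | yes q rewrite t≡1 | <⇒lt (s≤s q) | x≡ =
          inj₂ (suc j , ≤-refl , j<K , cong (2 *_) (trans (*-identityˡ (1 * 2 ^ j)) (*-identityˡ (2 ^ j))))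
  ...   | no  q rewrite t≡1 | ≤⇒lt (≰⇒> q) = inj₁ refl

  round*-dyadic : ∀ T Λ j w g K → j < K → ∀ γ x e → g e < γ → DyadicFrom j K (x e) →
    DyadicFrom (suc j) K (round* T Λ j w g γ x e)
  round*-dyadic T Λ j w g K j<K (suc γ) x e g< d with g e ≟ γ
  ... | yes q = round-dyadic T Λ j w g K j<K γ (round* T Λ j w g γ x) e q
                  (subst (DyadicFrom j K) (sym (round*-later T Λ j w g γ x e (≤-reflexive (sym q)))) d)
  ... | no  q = subst (DyadicFrom (suc j) K)
                  (sym (round-stay T Λ j w g γ (round* T Λ j w g γ x) e (turn-other T Λ j w g γ (round* T Λ j w g γ x) e q)))
                  (round*-dyadic T Λ j w g K j<K γ x e (≤∧≢⇒< (≤-pred g<) q) d)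

  round*-null : ∀ T Λ j w g γ x e → x e ≡ 0 → round* T Λ j w g γ x e ≡ 0
  round*-null T Λ j w g zero    x e z = z
  round*-null T Λ j w g (suc γ) x e z =
    trans (cong (λ y → (1 ∸ t) * y + 2 * (L * (t * y))) (round*-null T Λ j w g γ x e z)) (null (1 ∸ t) L t)
    where
    x′ = round* T Λ j w g γ x
    t = turn T Λ j w g γ x′ e
    L = le (Λ * nb e (λ f → (w e + w f) * ((1 ∸ turn T Λ j w g γ x′ f) * x′ f))) (T * w e)
    null : ∀ p q r → p * 0 + 2 * (q * (r * 0)) ≡ 0
    null = solve-∀

  -- Levels and phases

  module _ (K k r B : ℕ) (col : E → ℕ) where

    classes : ℕ → (E → ℕ) → (E → ℕ) → E → ℕ
    classes j w x = pass* k B (λ e f → (w e + w f) * (moving j x e * moving j x f)) col r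

    -- Level `j` optimises with multiplier 2K - (j + 1), one less than the multiplier it inherits.
    -- The scale `K * 2 ^ K` of the utility matches the final multiplier K when 2 ^ K stands for the
    -- value 1.
    level : ℕ → (E → ℕ) → (E → ℕ) → E → ℕ
    level j w x = round* (K * 2 ^ K) (2 * K ∸ suc j) j w (classes j w x) (k ^ r) x

    levels : ℕ → (E → ℕ) → (E → ℕ) → E → ℕ
    levels zero    w x = x
    levels (suc j) w x = level j w (levels j w x)

    weight : (E → ℕ) → E → ℕ
    weight act e = suc (nb e act)

    start : (E → ℕ) → E → ℕ
    start act e = act e * scale K (8 * weight act e) K

    selected : (E → ℕ) → E → ℕ
    selected act e = δ (levels K (weight act) (start act) e) (2 ^ K)

    -- Dropping every selected element with a selected neighbour needs no symmetry breaking, and the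
    -- cost has already paid for it.
    added : (E → ℕ) → E → ℕ
    added act e = selected act e * δ (nb e (selected act)) 0

    survivors : (E → ℕ) → E → ℕ
    survivors act e = act e * (δ (added act e) 0 * δ (nb e (added act)) 0)

  module Phase (K k r : ℕ) .{{_ : NonZero K}} .{{_ : NonZero k}} (B : ℕ) (col : E → ℕ)
               (col< : ∀ e → col e < 2 ^ B) (proper : Proper col) (k-large : 6 * 2 ^ r * K ≤ k ^ r) where

    -- The loss is 3 Λ times the conflicts inside classes, which are at most a fraction 2 ^ r / k ^
    -- r of the cost. As Λ ≤ 2K, `k-large` turns this into one copy of the cost, just what lowering
    -- the multiplier by one releases.
    level-gain : ∀ j w x → let x′ = level K k r B col j w x; τ = K * 2 ^ K; Λ = 2 * K ∸ suc j in
      2 * τ * utility w x + Λ * cost w x′ ≤ 2 * τ * utility w x′ + suc Λ * cost w x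
    level-gain j w x = ≤-trans (round*-gain τ Λ j w g (k ^ r) x)
      (+-monoʳ-≤ (2 * τ * utility w x′) (begin
        Λ * (C + 3 * M)      ≡⟨ *-distribˡ-+ Λ C (3 * M) ⟩
        Λ * C + Λ * (3 * M)  ≤⟨ +-monoʳ-≤ (Λ * C) loss ⟩
        Λ * C + C            ≡⟨ +-comm (Λ * C) C ⟩
        suc Λ * C            ∎))
      where
      open ≤-Reasoning
      τ = K * 2 ^ K
      Λ = 2 * K ∸ suc j
      g = classes K k r B col j w x
      x′ = level K k r B col j w x
      C = cost w x
      M = mono τ Λ j w g (k ^ r) x
      V₀ : E → E → ℕ
      V₀ e f = (w e + w f) * (moving j x e * moving j x f)
      V₀-sym : ∀ e f → V₀ e f ≡ V₀ f e
      V₀-sym e f = cong₂ _*_ (+-comm (w e) (w f)) (*-comm (moving j x e) (moving j x f))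
      moving≤ : ∀ e → moving j x e ≤ x e
      moving≤ e = ≤-trans (*-monoˡ-≤ (x e) (δ≤1 (x e) (2 ^ j))) (≤-reflexive (*-identityˡ _))
      M≤ : M ≤ dbl (λ e f → V₀ e f * δ (g e) (g f))
      M≤ = dbl-mono (λ e f → begin
        (w e + w f) * (lt (g e) (k ^ r) * δ (g e) (g f) * (moving j x e * moving j x f))
          ≤⟨ *-monoʳ-≤ (w e + w f) (*-monoˡ-≤ (moving j x e * moving j x f) (*-monoˡ-≤ (δ (g e) (g f)) (lt≤1 (g e) (k ^ r)))) ⟩
        (w e + w f) * (1 * δ (g e) (g f) * (moving j x e * moving j x f))
          ≡⟨ shuffle (w e + w f) (δ (g e) (g f)) (moving j x e * moving j x f) ⟩
        V₀ e f * δ (g e) (g f) ∎)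
        where
        shuffle : ∀ b d m → b * (1 * d * m) ≡ b * m * d
        shuffle = solve-∀
      kM≤ : k ^ r * M ≤ 2 ^ r * C
      kM≤ = begin
        k ^ r * M                                       ≤⟨ *-monoʳ-≤ (k ^ r) M≤ ⟩
        k ^ r * dbl (λ e f → V₀ e f * δ (g e) (g f))    ≤⟨ pass*-conflict k B V₀ V₀-sym col col< proper r ⟩
        2 ^ r * dbl V₀                                  ≤⟨ *-monoʳ-≤ (2 ^ r) (dbl-mono (λ e f → *-monoʳ-≤ (w e + w f) (*-mono-≤ (moving≤ e) (moving≤ f)))) ⟩
        2 ^ r * C                                          ∎
      loss : Λ * (3 * M) ≤ C
      loss = *-cancelˡ-≤ (k ^ r) {{m^n≢0 k r}} (begin
        k ^ r * (Λ * (3 * M))     ≡⟨ s₁ (k ^ r) Λ M ⟩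
        Λ * 3 * (k ^ r * M)       ≤⟨ *-mono-≤ (*-monoˡ-≤ 3 (m∸n≤m (2 * K) (suc j))) kM≤ ⟩
        2 * K * 3 * (2 ^ r * C)   ≡⟨ s₂ K (2 ^ r) C ⟩
        6 * 2 ^ r * K * C                ≤⟨ *-monoˡ-≤ C k-large ⟩
        k ^ r * C                 ∎)
        where
        s₁ : ∀ p l m → p * (l * (3 * m)) ≡ l * 3 * (p * m)
        s₁ = solve-∀
        s₂ : ∀ K p C → 2 * K * 3 * (p * C) ≡ 6 * p * K * C
        s₂ = solve-∀

    levels-gain : ∀ j → j ≤ K → ∀ w x → let x′ = levels K k r B col j w x; τ = K * 2 ^ K in
      2 * τ * utility w x + (2 * K ∸ j) * cost w x′ ≤ 2 * τ * utility w x′ + 2 * K * cost w x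
    levels-gain zero    _   w x = ≤-refl
    levels-gain (suc j) j<K w x = +-cancelˡ-≤ ((2 * K ∸ j) * C) _ _ (begin
      (2 * K ∸ j) * C + (U₀ + Λ * C′)          ≡⟨ e₁ ((2 * K ∸ j) * C) U₀ (Λ * C′) ⟩
      (U₀ + (2 * K ∸ j) * C) + Λ * C′          ≤⟨ +-monoˡ-≤ (Λ * C′) (levels-gain j (<⇒≤ j<K) w x) ⟩
      (U + 2 * K * C₀) + Λ * C′                ≡⟨ e₂ U (2 * K * C₀) (Λ * C′) ⟩
      (U + Λ * C′) + 2 * K * C₀                ≤⟨ +-monoˡ-≤ (2 * K * C₀) (level-gain j w (levels K k r B col j w x)) ⟩
      (U′ + suc Λ * C) + 2 * K * C₀            ≡⟨ cong (λ z → (U′ + z * C) + 2 * K * C₀) (sym (+-∸-assoc 1 j<2K)) ⟩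
      (U′ + (2 * K ∸ j) * C) + 2 * K * C₀      ≡⟨ e₃ U′ ((2 * K ∸ j) * C) (2 * K * C₀) ⟩
      (2 * K ∸ j) * C + (U′ + 2 * K * C₀)      ∎)
      where
      open ≤-Reasoning
      τ = K * 2 ^ K
      Λ = 2 * K ∸ suc j
      U₀ = 2 * τ * utility w x
      U  = 2 * τ * utility w (levels K k r B col j w x)
      U′ = 2 * τ * utility w (levels K k r B col (suc j) w x)
      C₀ = cost w x
      C  = cost w (levels K k r B col j w x)
      C′ = cost w (levels K k r B col (suc j) w x)
      j<2K : suc j ≤ 2 * K
      j<2K = ≤-trans j<K (m≤m+n K (1 * K))
      e₁ : ∀ p q r → p + (q + r) ≡ (q + p) + r
      e₁ = solve-∀
      e₂ : ∀ p q r → (p + q) + r ≡ (p + r) + q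
      e₂ = solve-∀
      e₃ : ∀ p q r → (p + q) + r ≡ q + (p + r)
      e₃ = solve-∀

    levels-dyadic : ∀ j → j ≤ K → ∀ w x → (∀ e → DyadicFrom 0 K (x e)) → ∀ e → DyadicFrom j K (levels K k r B col j w x e)
    levels-dyadic zero    _   w x d e = d e
    levels-dyadic (suc j) j<K w x d e = round*-dyadic _ _ j w _ K j<K (k ^ r) x′ e
      (pass*-< k B (λ e f → (w e + w f) * (moving j x′ e * moving j x′ f))
        (λ e f → cong₂ _*_ (+-comm (w e) (w f)) (*-comm (moving j x′ e) (moving j x′ f))) col col< proper r e)
      (levels-dyadic j (<⇒≤ j<K) w x d e)
      where x′ = levels K k r B col j w x

    levels-null : ∀ j w x e → x e ≡ 0 → levels K k r B col j w x e ≡ 0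
    levels-null zero    w x e z = z
    levels-null (suc j) w x e z = round*-null _ _ j w _ (k ^ r) (levels K k r B col j w x) e (levels-null j w x e z)

    module _ (act : E → ℕ) (act≤1 : ∀ e → act e ≤ 1) (deg< : ∀ e → 8 * suc (nb e (λ _ → 1)) ≤ 2 ^ K) where
      private
        w   = weight K k r B col act
        x₀  = start K k r B col act
        xₖ  = levels K k r B col K w x₀
        sel = selected K k r B col act
        new = added K k r B col act
        left = survivors K k r B col act

      w≤ : ∀ e → 8 * w e ≤ 2 ^ K
      w≤ e = ≤-trans (*-monoʳ-≤ 8 (s≤s (nb-mono e act≤1))) (deg< e)

      scaled : ∀ e → Σ ℕ λ i → i ≤ K × scale K (8 * w e) K ≡ 2 ^ i × 8 * w e * 2 ^ i ≤ 2 ^ K × 2 ^ K ≤ 2 * (8 * w e * 2 ^ i)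
      scaled e = scale-spec K (8 * w e) K (w≤ e) (≤-trans (m≤n*m (2 ^ K) (8 * w e)) (m≤m+n _ _))

      x₀-dyadic : ∀ e → DyadicFrom 0 K (x₀ e)
      x₀-dyadic e with act e | act≤1 e
      ... | 0 | _ = inj₁ refl
      ... | 1 | _ = let i , i≤K , s≡ , _ = scaled e in inj₂ (i , z≤n , i≤K , trans (*-identityˡ _) s≡)
      ... | suc (suc _) | s≤s ()

      x₀-upper : ∀ e → 8 * (w e * x₀ e) ≤ 2 ^ K * act e
      x₀-upper e = let i , _ , s≡ , lo , _ = scaled e in begin
        8 * (w e * (act e * scale K (8 * w e) K)) ≡⟨ cong (λ z → 8 * (w e * (act e * z))) s≡ ⟩
        8 * (w e * (act e * 2 ^ i))           ≡⟨ shuffle (w e) (act e) (2 ^ i) ⟩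
        8 * w e * 2 ^ i * act e               ≤⟨ *-monoˡ-≤ (act e) lo ⟩
        2 ^ K * act e                         ∎
        where
        open ≤-Reasoning
        shuffle : ∀ w a p → 8 * (w * (a * p)) ≡ 8 * w * p * a
        shuffle = solve-∀

      x₀-lower : ∀ e → 2 ^ K * act e ≤ 16 * (w e * x₀ e)
      x₀-lower e = let i , _ , s≡ , _ , hi = scaled e in begin
        2 ^ K * act e                          ≤⟨ *-monoˡ-≤ (act e) hi ⟩
        2 * (8 * w e * 2 ^ i) * act e               ≡⟨ shuffle (w e) (act e) (2 ^ i) ⟩
        16 * (w e * (act e * 2 ^ i))           ≡⟨ cong (λ z → 16 * (w e * (act e * z))) (sym s≡) ⟩
        16 * (w e * (act e * scale K (8 * w e) K)) ∎
        where
        open ≤-Reasoning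
        shuffle : ∀ w a p → 2 * (8 * w * p) * a ≡ 16 * (w * (a * p))
        shuffle = solve-∀

      -- Each active neighbour `f` of `e` has w f · x₀ f ≤ 2 ^ K / 8, and there are fewer than `w e`
      -- of them. The two summands of w e + w f give twice this, a quarter in total: the purpose of
      -- the 8 in `start`.
      start-cost : 4 * cost w x₀ ≤ 2 ^ K * utility w x₀
      start-cost = *-cancelˡ-≤ 2 (begin
        2 * (4 * cost w x₀)          ≡⟨ cong (λ z → 2 * (4 * z)) halves ⟩
        2 * (4 * (2 * X))            ≡⟨ s₁ X ⟩
        2 * (8 * X)                  ≡⟨ cong (2 *_) (sym (dbl-*ˡ 8 _)) ⟩
        2 * dbl (λ e f → 8 * (x₀ e * (w f * x₀ f))) ≤⟨ *-monoʳ-≤ 2 (dbl-mono (λ e f → ≤-trans (≤-reflexive (s₂ (x₀ e) (w f * x₀ f)))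
                                                           (≤-trans (*-monoʳ-≤ (x₀ e) (x₀-upper f)) (≤-reflexive (s₃ (x₀ e) (2 ^ K) (act f)))))) ⟩
        2 * dbl (λ e f → 2 ^ K * (x₀ e * act f))    ≡⟨ cong (2 *_) (dbl-*ˡ (2 ^ K) _) ⟩
        2 * (2 ^ K * dbl (λ e f → x₀ e * act f))    ≤⟨ *-monoʳ-≤ 2 (*-monoʳ-≤ (2 ^ K) (∑-mono es (λ e → begin
                nb e (λ f → x₀ e * act f)  ≡⟨ nb-*ˡ e (x₀ e) act ⟩
                x₀ e * nb e act            ≤⟨ *-monoʳ-≤ (x₀ e) (n≤1+n _) ⟩
                x₀ e * w e                 ≡⟨ *-comm (x₀ e) (w e) ⟩
                w e * x₀ e                 ∎))) ⟩
        2 * (2 ^ K * utility w x₀)   ∎)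
        where
        open ≤-Reasoning
        X = dbl (λ e f → x₀ e * (w f * x₀ f))
        s₁ : ∀ X → 2 * (4 * (2 * X)) ≡ 2 * (8 * X)
        s₁ = solve-∀
        s₂ : ∀ x y → 8 * (x * y) ≡ x * (8 * y)
        s₂ = solve-∀
        s₃ : ∀ x p a → x * (p * a) ≡ p * (x * a)
        s₃ = solve-∀
        s₄ : ∀ p q x y → (p + q) * (x * y) ≡ y * (p * x) + x * (q * y)
        s₄ = solve-∀
        halves : cost w x₀ ≡ 2 * X
        halves = trans (dbl-cong (λ e f → s₄ (w e) (w f) (x₀ e) (x₀ f))) (trans (dbl-+ _ _)
                   (trans (cong (_+ X) (dbl-sym _)) (cong (X +_) (sym (+-identityʳ X)))))

      xₖ≡ : ∀ e → xₖ e ≡ 2 ^ K * sel e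
      xₖ≡ e with levels-dyadic K ≤-refl w x₀ x₀-dyadic e
      ... | inj₁ z rewrite z | δ-≢ 0 (2 ^ K) (<⇒≢ (m^n>0 2 K)) = sym (*-zeroʳ (2 ^ K))
      ... | inj₂ (i , K≤i , i≤K , q) rewrite q | ≤-antisym i≤K K≤i | δ-refl (2 ^ K) = sym (*-identityʳ _)

      -- A selected element that is not added has a selected neighbour, so a term of the cost pays
      -- for its weight.
      final-utility : 2 ^ K * utility w xₖ * 2 ≤ 2 * (2 ^ K * 2 ^ K * ∑ es (λ e → w e * new e)) + cost w xₖ
      final-utility = begin
        2 ^ K * utility w xₖ * 2       ≡⟨ cong (λ z → 2 ^ K * z * 2) (trans (∑-cong es (λ e → trans (cong (w e *_) (xₖ≡ e)) (s₁ (w e) (2 ^ K) (sel e)))) (∑-*ˡ es (2 ^ K) _)) ⟩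
        2 ^ K * (2 ^ K * ∑ es (λ e → w e * sel e)) * 2 ≤⟨ *-monoˡ-≤ 2 (*-monoʳ-≤ (2 ^ K) (*-monoʳ-≤ (2 ^ K) split)) ⟩
        2 ^ K * (2 ^ K * (W + Y)) * 2  ≡⟨ s₂ (2 ^ K) W Y ⟩
        2 * (2 ^ K * 2 ^ K * W) + 2 ^ K * 2 ^ K * (Y + Y) ≡⟨ cong (2 * (2 ^ K * 2 ^ K * W) +_) (sym cost≡) ⟩
        2 * (2 ^ K * 2 ^ K * W) + cost w xₖ ∎
        where
        open ≤-Reasoning
        W = ∑ es (λ e → w e * new e)
        Y = dbl (λ e f → w e * (sel e * sel f))
        s₁ : ∀ w p s → w * (p * s) ≡ p * (w * s)
        s₁ = solve-∀
        s₂ : ∀ p W Y → p * (p * (W + Y)) * 2 ≡ 2 * (p * p * W) + p * p * (Y + Y)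
        s₂ = solve-∀
        s₃ : ∀ w v p s t → (w + v) * (p * s * (p * t)) ≡ p * p * (w * (s * t) + v * (t * s))
        s₃ = solve-∀
        s₄ : ∀ w s n d → w * (s * d) + w * s * n ≡ w * s * (d + n)
        s₄ = solve-∀
        s₅ : ∀ w s t → w * (s * t) ≡ w * s * t
        s₅ = solve-∀
        nonconflict : ∀ n → 1 ≤ δ n 0 + n
        nonconflict zero    = ≤-refl
        nonconflict (suc n) = s≤s z≤n
        cost≡ : cost w xₖ ≡ 2 ^ K * 2 ^ K * (Y + Y)
        cost≡ = trans (dbl-cong (λ e f → trans (cong₂ (λ u v → (w e + w f) * (u * v)) (xₖ≡ e) (xₖ≡ f)) (s₃ (w e) (w f) (2 ^ K) (sel e) (sel f))))
                  (trans (dbl-*ˡ (2 ^ K * 2 ^ K) _) (cong (2 ^ K * 2 ^ K *_) (trans (dbl-+ _ _) (cong (Y +_) (dbl-sym _)))))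
        split : ∑ es (λ e → w e * sel e) ≤ W + Y
        split = ≤-trans (∑-mono es (λ e → begin
            w e * sel e                                          ≡⟨ sym (*-identityʳ _) ⟩
            w e * sel e * 1                                      ≤⟨ *-monoʳ-≤ (w e * sel e) (nonconflict (nb e sel)) ⟩
            w e * sel e * (δ (nb e sel) 0 + nb e sel)            ≡⟨ sym (s₄ (w e) (sel e) (nb e sel) (δ (nb e sel) 0)) ⟩
            w e * new e + w e * sel e * nb e sel                 ≡⟨ cong (w e * new e +_) (sym (trans (nb-cong e (λ f → s₅ (w e) (sel e) (sel f))) (nb-*ˡ e (w e * sel e) sel))) ⟩
            w e * new e + nb e (λ f → w e * (sel e * sel f))     ∎)) (≤-reflexive (∑-+ es _ _))

      -- The start values lose a factor 16 and their own cost a further 4/3; the resulting 64/3 is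
      -- rounded up to 32.
      phase-weight : ∑ es act ≤ 32 * ∑ es (λ e → w e * new e)
      phase-weight = *-cancelˡ-≤ (3 * (2 ^ K * 2 ^ K)) {{m*n≢0 3 (2 ^ K * 2 ^ K) {{_}} {{m*n≢0 (2 ^ K) (2 ^ K) {{m^n≢0 2 K}} {{m^n≢0 2 K}}}}}} (begin
        3 * (P * P) * A            ≡⟨ s₁ P A ⟩
        3 * P * (P * A)            ≤⟨ *-monoʳ-≤ (3 * P) A≤ ⟩
        3 * P * (16 * U₀)          ≡⟨ s₂ P U₀ ⟩
        16 * (3 * (P * U₀))        ≤⟨ *-monoʳ-≤ 16 U₀≤ ⟩
        16 * (4 * (P * P * W))     ≤⟨ m≤m+n _ (32 * (P * P * W)) ⟩
        16 * (4 * (P * P * W)) + 32 * (P * P * W) ≡⟨ s₃ P W ⟩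
        3 * (P * P) * (32 * W)     ∎)
        where
        open ≤-Reasoning
        P = 2 ^ K
        A = ∑ es act
        W = ∑ es (λ e → w e * new e)
        U₀ = utility w x₀
        s₁ : ∀ P A → 3 * (P * P) * A ≡ 3 * P * (P * A)
        s₁ = solve-∀
        s₂ : ∀ P U → 3 * P * (16 * U) ≡ 16 * (3 * (P * U))
        s₂ = solve-∀
        s₃ : ∀ P W → 16 * (4 * (P * P * W)) + 32 * (P * P * W) ≡ 3 * (P * P) * (32 * W)
        s₃ = solve-∀
        A≤ : P * A ≤ 16 * U₀
        A≤ = ≤-trans (≤-reflexive (sym (∑-*ˡ es P act))) (≤-trans (∑-mono es x₀-lower) (≤-reflexive (∑-*ˡ es 16 _)))
        -- After K levels the multiplier is 2K ∸ K = K, and K cancels throughout.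
        final-gain : 2 * P * U₀ + cost w xₖ ≤ 2 * P * utility w xₖ + 2 * cost w x₀
        final-gain = *-cancelˡ-≤ K (subst₂ _≤_
          (trans (cong (λ z → 2 * (K * P) * U₀ + z * cost w xₖ) (trans (cong (_∸ K) (cong (K +_) (+-identityʳ K))) (m+n∸m≡n K K))) (t₁ K P U₀ (cost w xₖ)))
          (t₂ K P (utility w xₖ) (cost w x₀)) (levels-gain K ≤-refl w x₀))
          where
          t₁ : ∀ K P U C → 2 * (K * P) * U + K * C ≡ K * (2 * P * U + C)
          t₁ = solve-∀
          t₂ : ∀ K P U C → 2 * (K * P) * U + 2 * K * C ≡ K * (2 * P * U + 2 * C)
          t₂ = solve-∀
        U₀≤ : 3 * (P * U₀) ≤ 4 * (P * P * W)
        U₀≤ = +-cancelˡ-≤ (P * U₀ + 2 * cost w xₖ) _ _ (begin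
          P * U₀ + 2 * cost w xₖ + 3 * (P * U₀)  ≡⟨ t₁ P U₀ (cost w xₖ) ⟩
          2 * (2 * P * U₀ + cost w xₖ)           ≤⟨ *-monoʳ-≤ 2 final-gain ⟩
          2 * (2 * P * utility w xₖ + 2 * cost w x₀) ≡⟨ t₂ P (utility w xₖ) (cost w x₀) ⟩
          2 * (P * utility w xₖ * 2) + 4 * cost w x₀ ≤⟨ +-mono-≤ (*-monoʳ-≤ 2 final-utility) start-cost ⟩
          2 * (2 * (P * P * W) + cost w xₖ) + P * U₀ ≡⟨ t₃ P W (cost w xₖ) U₀ ⟩
          P * U₀ + 2 * cost w xₖ + 4 * (P * P * W) ∎)
          where
          t₁ : ∀ P U C → P * U + 2 * C + 3 * (P * U) ≡ 2 * (2 * P * U + C)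
          t₁ = solve-∀
          t₂ : ∀ P U C → 2 * (2 * P * U + 2 * C) ≡ 2 * (P * U * 2) + 4 * C
          t₂ = solve-∀
          t₃ : ∀ P W C U → 2 * (2 * (P * P * W) + C) + P * U ≡ P * U + 2 * C + 4 * (P * P * W)
          t₃ = solve-∀

      sel≤act : ∀ e → sel e ≤ act e
      sel≤act e with act e in eq | act≤1 e
      ... | suc _ | _ = ≤-trans (δ≤1 (xₖ e) (2 ^ K)) (s≤s z≤n)
      ... | zero | _ rewrite levels-null K w x₀ e (cong (_* scale K (8 * w e) K) eq) | δ-≢ 0 (2 ^ K) (<⇒≢ (m^n>0 2 K)) = z≤n

      added≤act : ∀ e → new e ≤ act e
      added≤act e = ≤-trans (*-monoʳ-≤ (sel e) (δ≤1 (nb e sel) 0)) (≤-trans (≤-reflexive (*-identityʳ _)) (sel≤act e))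

      added-independent : ∀ e → new e * nb e new ≡ 0
      added-independent e with δ-cases (nb e sel) 0
      ... | inj₂ (_ , d) rewrite d | *-zeroʳ (sel e) = refl
      ... | inj₁ (q , _) = trans (cong (new e *_) (n≤0⇒n≡0 (≤-trans (nb-mono e (λ f →
              ≤-trans (*-monoʳ-≤ (sel f) (δ≤1 (nb f sel) 0)) (≤-reflexive (*-identityʳ _)))) (≤-reflexive q)))) (*-zeroʳ (new e))

      -- Double counting: `W` counts an active element once for every added element that meets it,
      -- hence at most twice, and not at all if it survives. So A ≤ 32 W ≤ 64 (A - survivors).
      phase-progress : (∀ e → new e + nb e new ≤ 2) → 64 * ∑ es left ≤ 63 * ∑ es act
      phase-progress claw = +-cancelˡ-≤ A _ _ (begin
        A + 64 * ∑ es left             ≤⟨ +-monoˡ-≤ (64 * ∑ es left) phase-weight ⟩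
        32 * W + 64 * ∑ es left        ≡⟨ t₁ W (∑ es left) ⟩
        32 * (W + 2 * ∑ es left)       ≤⟨ *-monoʳ-≤ 32 covered ⟩
        32 * (2 * A)                   ≡⟨ t₂ A ⟩
        A + 63 * A                     ∎)
        where
        open ≤-Reasoning
        A = ∑ es act
        W = ∑ es (λ e → w e * new e)
        t₁ : ∀ W L → 32 * W + 64 * L ≡ 32 * (W + 2 * L)
        t₁ = solve-∀
        t₂ : ∀ A → 32 * (2 * A) ≡ A + 63 * A
        t₂ = solve-∀
        t₃ : ∀ n m → (1 + n) * m ≡ m + m * n
        t₃ = solve-∀
        W≡ : W ≡ ∑ es (λ e → new e + act e * nb e new)
        W≡ = trans (∑-cong es (λ e → trans (t₃ (nb e act) (new e)) (cong (new e +_) (sym (nb-*ˡ e (new e) act)))))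
               (trans (∑-+ es _ _) (trans (cong (∑ es new +_) (trans (dbl-sym _)
                 (∑-cong es (λ e → trans (nb-cong e (λ f → *-comm (new f) (act e))) (nb-*ˡ e (act e) new))))) (sym (∑-+ es _ _))))
        point : ∀ e → new e + act e * nb e new + 2 * left e ≤ 2 * act e
        point e with act e in eq | act≤1 e
        ... | zero | _ rewrite n≤0⇒n≡0 (subst (new e ≤_) eq (added≤act e)) = z≤n
        ... | suc (suc _) | s≤s ()
        ... | 1 | _ with δ-cases (new e) 0 | δ-cases (nb e new) 0
        ...   | inj₁ (p , d) | inj₁ (q , d′) rewrite d | d′ | p | q = ≤-refl
        ...   | inj₁ (p , d) | inj₂ (q , d′) rewrite d | d′ | +-identityʳ (nb e new) | +-identityʳ (new e + nb e new) = claw e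
        ...   | inj₂ (p , d) | _ rewrite d | +-identityʳ (nb e new) | +-identityʳ (new e + nb e new) = claw e
        covered : W + 2 * ∑ es left ≤ 2 * A
        covered = begin
          W + 2 * ∑ es left   ≡⟨ cong₂ _+_ W≡ (sym (∑-*ˡ es 2 left)) ⟩
          ∑ es (λ e → new e + act e * nb e new) + ∑ es (λ e → 2 * left e) ≡⟨ sym (∑-+ es _ _) ⟩
          ∑ es (λ e → new e + act e * nb e new + 2 * left e) ≤⟨ ∑-mono es point ⟩
          ∑ es (λ e → 2 * act e) ≡⟨ ∑-*ˡ es 2 act ⟩
          2 * A ∎

-- Local programs

-- x is the fractional value scaled by 2 ^ K; p and h are scratch registers.
record Reg : Set where
  constructor reg
  field
    col act mat w x g p h : ℕ
open Reg

-- The second argument of update sums a function over the adjacent edges; ext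
-- makes up for the lack of function extensionality.
record Step : Set where
  constructor _by_
  field
    update : Reg → ((Reg → ℕ) → ℕ) → Reg
    ext    : ∀ d {s s′ : (Reg → ℕ) → ℕ} → (∀ q → s q ≡ s′ q) → update d s ≡ update d s′
open Step

-- The last block goes to the end, matching the recursion of `choose*`, `round*`, `pass*` and
-- `levels`.
loop : ℕ → (ℕ → List Step) → List Step
loop zero    f = []
loop (suc n) f = loop n f ++ f n

reduceL : ℕ → ℕ → (Reg → ℕ) → (Reg → ℕ) → ℕ → ((Reg → ℕ) → ℕ) → ℕ
reduceL μ b V q c s = t * (μ * suc b + μ * suc b) + letter μ b c t
  where
  t = argmin (μ * suc b) (λ t → s (λ d → V d * ((1 ∸ δ c (q d)) * δ (letter μ b c t) (letter μ b (q d) t))))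

reduceL-ext : ∀ μ b V q c {s s′ : (Reg → ℕ) → ℕ} → (∀ q → s q ≡ s′ q) → reduceL μ b V q c s ≡ reduceL μ b V q c s′
reduceL-ext μ b V q c p = cong (λ t → t * (μ * suc b + μ * suc b) + letter μ b c t) (argmin-cong (μ * suc b) (λ t → p _))

linialS : ℕ → ℕ → Step
linialS μ b = (λ d s → record d { col = reduceL μ b (λ _ → 1) col (col d) s })
  by (λ d p → cong (λ z → record d { col = z }) (reduceL-ext μ b (λ _ → 1) col (col d) p))

linialP : ℕ → ℕ → ℕ → List Step
linialP μ zero    b = []
linialP μ (suc r) b = linialS μ b ∷ linialP μ r (bits μ b)

linialBits : ℕ → ℕ → ℕ → ℕ
linialBits μ zero    b = b
linialBits μ (suc r) b = linialBits μ r (bits μ b)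

module _ (K k r B : ℕ) where

  module _ (j : ℕ) where

    pairWeight : Reg → Reg → ℕ
    pairWeight d d′ = (w d + w d′) * ((δ (x d) (2 ^ j) * x d) * (δ (x d′) (2 ^ j) * x d′)) * δ (g d) (g d′)

    reduce₁S reduce₂S endPassS : Step
    reduce₁S = (λ d s → record d { p = reduceL (2 * k) B (pairWeight d) col (col d) s })
      by (λ d q → cong (λ z → record d { p = z }) (reduceL-ext (2 * k) B (pairWeight d) col (col d) q))
    reduce₂S = (λ d s → record d { p = reduceL (2 * k) (bits (2 * k) B) (pairWeight d) p (p d) s })
      by (λ d q → cong (λ z → record d { p = z }) (reduceL-ext (2 * k) (bits (2 * k) B) (pairWeight d) p (p d) q))
    endPassS = (λ d s → record d { g = g d * k + h d ; p = 0 ; h = 0 }) by (λ d q → refl)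

    chooseS : ℕ → Step
    chooseS γ =
      (λ d s → record d { h = if p d ≡ᵇ γ then argmin k (λ v → s (λ d′ → pairWeight d d′ * (lt (p d′) γ * δ (h d′) v))) else h d })
      by (λ d q → cong (λ z → record d { h = if p d ≡ᵇ γ then z else h d }) (argmin-cong k (λ v → q _)))

    passP : List Step
    passP = reduce₁S ∷ reduce₂S ∷ loop (size (2 * k) (bits (2 * k) B)) (λ γ → chooseS γ ∷ []) ++ endPassS ∷ []

    resetS : Step
    resetS = (λ d s → record d { g = 0 }) by (λ d q → refl)

    turnL : ℕ → Reg → ℕ
    turnL γ d = δ (x d) (2 ^ j) * δ (g d) γ

    roundS : ℕ → Step
    roundS γ =
      (λ d s → record d { x = (1 ∸ turnL γ d) * x d
        + 2 * (le ((2 * K ∸ suc j) * s (λ d′ → (w d + w d′) * ((1 ∸ turnL γ d′) * x d′))) (K * 2 ^ K * w d) * (turnL γ d * x d)) })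
      by (λ d q → cong (λ z → record d { x = (1 ∸ turnL γ d) * x d
        + 2 * (le ((2 * K ∸ suc j) * z) (K * 2 ^ K * w d) * (turnL γ d * x d)) }) (q _))

    levelP : List Step
    levelP = resetS ∷ loop r (λ _ → passP) ++ loop (k ^ r) (λ γ → roundS γ ∷ [])

  startS selectS addS coverS : Step
  startS = (λ d s → record d { w = suc (s act) ; x = act d * scale K (8 * suc (s act)) K })
    by (λ d q → cong (λ z → record d { w = suc z ; x = act d * scale K (8 * suc z) K }) (q _))
  selectS = (λ d s → record d { p = δ (x d) (2 ^ K) }) by (λ d q → refl)
  addS = (λ d s → record d { h = p d * δ (s p) 0 }) by (λ d q → cong (λ z → record d { h = p d * δ z 0 }) (q _))
  -- The scratch registers are cleared, so every phase starts from a state of the same form.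
  coverS = (λ d s → reg (col d) (act d * (δ (h d) 0 * δ (s h) 0)) (mat d + h d) 0 0 0 0 0)
    by (λ d q → cong (λ z → reg (col d) (act d * (δ (h d) 0 * δ z 0)) (mat d + h d) 0 0 0 0 0) (q _))

  phaseP : List Step
  phaseP = startS ∷ loop K levelP ++ selectS ∷ addS ∷ coverS ∷ []

-- Global semantics of the programs

module Semantics (E : Set) (es : List E) (a : E → E → ℕ) (a-sym : ∀ e f → a e f ≡ a f e) where
  open Conflicts E es a a-sym

  exec : Step → (E → Reg) → E → Reg
  exec s X e = update s (X e) (λ q → nb e (λ f → q (X f)))

  runs : List Step → (E → Reg) → E → Reg
  runs []       X = X
  runs (s ∷ ss) X = runs ss (exec s X)

  runs-++ : ∀ ss ts X → runs (ss ++ ts) X ≡ runs ts (runs ss X)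
  runs-++ []       ts X = refl
  runs-++ (s ∷ ss) ts X = runs-++ ss ts (exec s X)

  state : (c a m w x g p h : E → ℕ) → E → Reg
  state c a m w x g p h e = reg (c e) (a e) (m e) (w e) (x e) (g e) (p e) (h e)

  private
    O : E → ℕ
    O _ = 0

  linialCol : ℕ → ℕ → ℕ → (E → ℕ) → E → ℕ
  linialCol μ zero    b c = c
  linialCol μ (suc r) b c = linialCol μ r (bits μ b) (reduce μ b (λ _ _ → 1) c)

  linialP-runs : ∀ μ r b c a m → runs (linialP μ r b) (state c a m O O O O O) ≡ state (linialCol μ r b c) a m O O O O O
  linialP-runs μ zero    b c a m = refl
  linialP-runs μ (suc r) b c a m = linialP-runs μ r (bits μ b) (reduce μ b (λ _ _ → 1) c) a m

  module _ (K k r B : ℕ) (c A m : E → ℕ) where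

    module _ (j : ℕ) (W : E → ℕ) where

      V₀ : (E → ℕ) → E → E → ℕ
      V₀ X e f = (W e + W f) * (moving j X e * moving j X f)

      choose-runs : ∀ X G q γ H →
        runs (loop γ (λ γ → chooseS K k r B j γ ∷ [])) (state c A m W X G q H)
          ≡ state c A m W X G q (choose* k (classWeight k B (V₀ X) c G) q γ H)
      choose-runs X G q zero    H = refl
      choose-runs X G q (suc γ) H =
        trans (runs-++ (loop γ _) (chooseS K k r B j γ ∷ []) (state c A m W X G q H))
              (cong (exec (chooseS K k r B j γ)) (choose-runs X G q γ H))

      passP-runs : ∀ X G → runs (passP K k r B j) (state c A m W X G O O) ≡ state c A m W X (pass k B (V₀ X) c G) O O
      passP-runs X G =
        trans (runs-++ (loop P _) (endPassS K k r B j ∷ []) (state c A m W X G (passColour k B (V₀ X) c G) O))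
              (cong (exec (endPassS K k r B j)) (choose-runs X G (passColour k B (V₀ X) c G) P O))
        where P = size (2 * k) (bits (2 * k) B)

      passes-runs : ∀ X i → runs (loop i (λ _ → passP K k r B j)) (state c A m W X O O O)
                            ≡ state c A m W X (pass* k B (V₀ X) c i) O O
      passes-runs X zero    = refl
      passes-runs X (suc i) =
        trans (runs-++ (loop i _) (passP K k r B j) (state c A m W X O O O))
          (trans (cong (runs (passP K k r B j)) (passes-runs X i)) (passP-runs X (pass* k B (V₀ X) c i)))

      rounds-runs : ∀ X G γ → runs (loop γ (λ γ → roundS K k r B j γ ∷ [])) (state c A m W X G O O)
                            ≡ state c A m W (round* (K * 2 ^ K) (2 * K ∸ suc j) j W G γ X) G O O
      rounds-runs X G zero    = refl
      rounds-runs X G (suc γ) =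
        trans (runs-++ (loop γ _) (roundS K k r B j γ ∷ []) (state c A m W X G O O))
              (cong (exec (roundS K k r B j γ)) (rounds-runs X G γ))

      levelP-runs : ∀ X G → runs (levelP K k r B j) (state c A m W X G O O)
                          ≡ state c A m W (level K k r B c j W X) (classes K k r B c j W X) O O
      levelP-runs X G =
        trans (runs-++ (loop r _) (loop (k ^ r) _) (state c A m W X O O O))
          (trans (cong (runs (loop (k ^ r) _)) (passes-runs X r)) (rounds-runs X (classes K k r B c j W X) (k ^ r)))

    -- What register `g` still holds between levels: the classes of the previous level, until the
    -- next `resetS`.
    levelClasses : (E → ℕ) → (E → ℕ) → ℕ → E → ℕ
    levelClasses W X zero    = O
    levelClasses W X (suc j) = classes K k r B c j W (levels K k r B c j W X)

    levels-runs : ∀ W X j → runs (loop j (levelP K k r B)) (state c A m W X O O O)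
                          ≡ state c A m W (levels K k r B c j W X) (levelClasses W X j) O O
    levels-runs W X zero    = refl
    levels-runs W X (suc j) =
      trans (runs-++ (loop j _) (levelP K k r B j) (state c A m W X O O O))
        (trans (cong (runs (levelP K k r B j)) (levels-runs W X j)) (levelP-runs j W (levels K k r B c j W X) (levelClasses W X j)))

    phaseP-runs : runs (phaseP K k r B) (state c A m O O O O O)
                ≡ state c (survivors K k r B c A) (λ e → m e + added K k r B c A e) O O O O O
    phaseP-runs =
      trans (runs-++ (loop K _) (selectS K k r B ∷ addS K k r B ∷ coverS K k r B ∷ [])
              (state c A m (weight K k r B c A) (start K k r B c A) O O O))
        (cong (runs (selectS K k r B ∷ addS K k r B ∷ coverS K k r B ∷ []))
          (levels-runs (weight K k r B c A) (start K k r B c A) K))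

-- Geometric decay

power-doubling : ∀ n t → (n + t) * n ^ t ≤ n * suc n ^ t
power-doubling n zero    = ≤-reflexive (cong (_* 1) (+-identityʳ n))
power-doubling n (suc t) = begin
  (n + suc t) * (n * n ^ t)        ≤⟨ m≤m+n _ (t * n ^ t) ⟩
  (n + suc t) * (n * n ^ t) + t * n ^ t ≡⟨ e₁ n t (n ^ t) ⟩
  suc n * ((n + t) * n ^ t)        ≤⟨ *-monoʳ-≤ (suc n) (power-doubling n t) ⟩
  suc n * (n * suc n ^ t)          ≡⟨ e₂ (suc n) n (suc n ^ t) ⟩
  n * (suc n * suc n ^ t)          ∎
  where
  open ≤-Reasoning
  e₁ : ∀ n t p → (n + suc t) * (n * p) + t * p ≡ suc n * ((n + t) * p)
  e₁ = solve-∀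
  e₂ : ∀ a b c → a * (b * c) ≡ b * (a * c)
  e₂ = solve-∀

-- Since (1 + 1/n)^n ≥ 2 by Bernoulli's inequality, `n` steps with factor n / (n + 1) halve the
-- quantity.
decay : ∀ n .{{_ : NonZero n}} (A : ℕ → ℕ) → (∀ i → suc n * A (suc i) ≤ n * A i) → ∀ q → 2 ^ q * A (q * n) ≤ A 0
decay n A step zero    = ≤-reflexive (+-identityʳ (A 0))
decay n A step (suc q) = begin
  2 * 2 ^ q * A (n + q * n)      ≡⟨ shuffle 2 (2 ^ q) (A (n + q * n)) ⟩
  2 ^ q * (2 * A (n + q * n))    ≤⟨ *-monoʳ-≤ (2 ^ q) (halve (q * n)) ⟩
  2 ^ q * A (q * n)              ≤⟨ decay n A step q ⟩
  A 0                            ∎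
  where
  open ≤-Reasoning
  shuffle : ∀ a b c → a * b * c ≡ b * (a * c)
  shuffle = solve-∀
  shuffle′ : ∀ a b c → a * (b * c) ≡ b * (a * c)
  shuffle′ = solve-∀
  many : ∀ i t → suc n ^ t * A (t + i) ≤ n ^ t * A i
  many i zero    = ≤-refl
  many i (suc t) = begin
    suc n * suc n ^ t * A (suc t + i)   ≡⟨ shuffle (suc n) (suc n ^ t) _ ⟩
    suc n ^ t * (suc n * A (suc t + i)) ≤⟨ *-monoʳ-≤ (suc n ^ t) (step (t + i)) ⟩
    suc n ^ t * (n * A (t + i))         ≡⟨ shuffle′ (suc n ^ t) n _ ⟩
    n * (suc n ^ t * A (t + i))         ≤⟨ *-monoʳ-≤ n (many i t) ⟩
    n * (n ^ t * A i)                   ≡⟨ sym (*-assoc n (n ^ t) (A i)) ⟩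
    n * n ^ t * A i                     ∎
  halve : ∀ i → 2 * A (n + i) ≤ A i
  halve i = *-cancelˡ-≤ (n * n ^ n) {{m*n≢0 n (n ^ n)}} (begin
    n * n ^ n * (2 * A (n + i))      ≡⟨ e₁ n (n ^ n) (A (n + i)) ⟩
    (n + n) * n ^ n * A (n + i)      ≤⟨ *-monoˡ-≤ (A (n + i)) (power-doubling n n) ⟩
    n * suc n ^ n * A (n + i)        ≡⟨ *-assoc n (suc n ^ n) _ ⟩
    n * (suc n ^ n * A (n + i))      ≤⟨ *-monoʳ-≤ n (many i n) ⟩
    n * (n ^ n * A i)                ≡⟨ sym (*-assoc n (n ^ n) (A i)) ⟩
    n * n ^ n * A i                  ∎)
    where
    instance
      n^n≢0 : NonZero (n ^ n)
      n^n≢0 = m^n≢0 n n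
    e₁ : ∀ n p a → n * p * (2 * a) ≡ (n + n) * p * a
    e₁ = solve-∀

zero-or-one : ∀ {n} → n ≤ 1 → n ≡ 0 ⊎ n ≡ 1
zero-or-one {0} _ = inj₁ refl
zero-or-one {1} _ = inj₂ refl
zero-or-one {suc (suc _)} (s≤s ())

-- Orientation invariance and the matching invariant

module Algorithm (E : Set) (es : List E) (a : E → E → ℕ) (a-sym : ∀ e f → a e f ≡ a f e)
                 (rev : E → E) (a-rev : ∀ e f → a (rev e) f ≡ a e f) where
  open Conflicts E es a a-sym
  open Semantics E es a a-sym

  exec-rev : ∀ s X → (∀ e → X (rev e) ≡ X e) → ∀ e → exec s X (rev e) ≡ exec s X e
  exec-rev s X inv e rewrite inv e =
    ext s (X e) (λ q → ∑-cong es (λ f → cong (_* q (X f)) (a-rev e f)))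

  -- An update sees its own register and sums over adjacent elements, and reversal changes neither.
  -- Whatever a program computes is therefore independent of orientation.
  runs-rev : ∀ ss X → (∀ e → X (rev e) ≡ X e) → ∀ e → runs ss X (rev e) ≡ runs ss X e
  runs-rev []       X inv e = inv e
  runs-rev (s ∷ ss) X inv e = runs-rev ss (exec s X) (exec-rev s X inv) e

  -- With unit weights and μ above the degree, μ times the number of conflicts is at most the
  -- degree, hence below μ. So the number is 0 and the defective reduction is an exact one.
  linial-proper : ∀ Λ → (∀ e → suc (nb e (λ _ → 1)) ≤ 2 ^ Λ) → ∀ r b c → (∀ e → c e < 2 ^ b) → Proper c →
    (∀ e → linialCol (2 ^ Λ) r b c e < 2 ^ linialBits (2 ^ Λ) r b) × Proper (linialCol (2 ^ Λ) r b c)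
  linial-proper Λ deg zero    b c c< proper = c< , proper
  linial-proper Λ deg (suc r) b c c< proper = linial-proper Λ deg r (bits μ b) c′
    (λ e → <-≤-trans (reduce-< μ b (λ _ _ → 1) c e) (size≤2^bits μ b)) proper′
    where
    μ = 2 ^ Λ
    instance
      μ≢0 : NonZero μ
      μ≢0 = m^n≢0 2 Λ
    c′ = reduce μ b (λ _ _ → 1) c
    proper′ : Proper c′
    proper′ e with nb e (λ f → δ (c′ e) (c′ f)) in eq
    ... | zero  = refl
    ... | suc z = ⊥-elim (<⇒≱ (deg e) (begin
      μ                                      ≤⟨ m≤m*n μ (suc z) ⟩
      μ * suc z                              ≡⟨ cong (μ *_) (sym eq) ⟩
      μ * nb e (λ f → δ (c′ e) (c′ f))       ≡⟨ cong (μ *_) (nb-cong e (λ f → sym (*-identityˡ _))) ⟩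
      μ * nb e (λ f → 1 * δ (c′ e) (c′ f))   ≤⟨ reduce-conflict μ b (λ _ _ → 1) c c< e ⟩
      μ * nb e (λ f → 1 * δ (c e) (c f)) + nb e (λ _ → 1) ≡⟨ cong (λ y → μ * y + nb e (λ _ → 1)) (trans (nb-cong e (λ f → *-identityˡ _)) (proper e)) ⟩
      μ * 0 + nb e (λ _ → 1)                 ≡⟨ cong (_+ nb e (λ _ → 1)) (*-zeroʳ μ) ⟩
      nb e (λ _ → 1)                         ∎))
      where open ≤-Reasoning

  -- The invariant between phases. `isolated` makes later additions compatible with earlier ones;
  -- `covered` accounts for every deactivated edge.
  record Matching (act mat : E → ℕ) : Set where
    field
      act≤1   : ∀ e → act e ≤ 1
      mat≤1   : ∀ e → mat e ≤ 1
      apart   : ∀ e → act e * mat e ≡ 0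
      isolated : ∀ e f → a e f * (act e * mat f) ≡ 0
      independent : ∀ e f → a e f * (mat e * mat f) ≡ 0
      covered : ∀ e → act e ≡ 0 → 1 ≤ mat e + nb e mat

  -- Two properties of line graphs are assumed here: `vanish` passes from a sum over one orientation
  -- per edge to every dart, and `claw` says that an edge meets at most two members of an
  -- independent set.
  module Phases
    (vanish : ∀ s → (∀ e → s (rev e) ≡ s e) → ∀ e → nb e s ≡ 0 → ∀ f → a e f * s f ≡ 0)
    (claw : ∀ s → (∀ e → s (rev e) ≡ s e) → (∀ e → s e ≤ 1) → (∀ e → s e * nb e s ≡ 0) → ∀ e → s e + nb e s ≤ 2)
    (K k r : ℕ) .{{_ : NonZero K}} .{{_ : NonZero k}} (B : ℕ) (col : E → ℕ)
    (col-rev : ∀ e → col (rev e) ≡ col e)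
    (col< : ∀ e → col e < 2 ^ B) (proper : Proper col) (k-large : 6 * 2 ^ r * K ≤ k ^ r)
    (deg< : ∀ e → 8 * suc (nb e (λ _ → 1)) ≤ 2 ^ K) where
    open Phase K k r B col col< proper k-large

    module _ (A m : E → ℕ) (A-rev : ∀ e → A (rev e) ≡ A e) (m-rev : ∀ e → m (rev e) ≡ m e) (M : Matching A m) where
      open Matching M
      private
        new  = added K k r B col A
        left = survivors K k r B col A

      -- The survivors and additions are the outcome of a program run on invariant registers, so
      -- `runs-rev` applies and their definitions need not be unfolded.
      after-rev : ∀ e → state col left (λ e → m e + new e) _ _ _ _ _ (rev e) ≡ state col left (λ e → m e + new e) _ _ _ _ _ e
      after-rev e = subst (λ X → X (rev e) ≡ X e) (phaseP-runs K k r B col A m)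
        (runs-rev (phaseP K k r B) (state col A m _ _ _ _ _)
          (λ e → cong₂ (λ z y → reg z (proj₁ y) (proj₂ y) 0 0 0 0 0) (col-rev e) (cong₂ _,_ (A-rev e) (m-rev e))) e)

      left-rev : ∀ e → left (rev e) ≡ left e
      left-rev e = cong act (after-rev e)

      mat-rev : ∀ e → m (rev e) + new (rev e) ≡ m e + new e
      mat-rev e = cong mat (after-rev e)

      new-rev : ∀ e → new (rev e) ≡ new e
      new-rev e = +-cancelˡ-≡ (m e) _ _ (trans (cong (_+ new (rev e)) (sym (m-rev e))) (mat-rev e))

      new≤act : ∀ e → new e ≤ A e
      new≤act = added≤act A act≤1 deg<

      left≤act : ∀ e → left e ≤ A e
      left≤act e = ≤-trans (*-monoʳ-≤ (A e) (*-mono-≤ (δ≤1 (new e) 0) (δ≤1 (nb e new) 0))) (≤-reflexive (*-identityʳ (A e)))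

      survive : ∀ e → left e ≡ 0 ⊎ (new e ≡ 0 × nb e new ≡ 0)
      survive e with δ-cases (new e) 0 | δ-cases (nb e new) 0
      ... | inj₁ (q , _) | inj₁ (q′ , _) = inj₂ (q , q′)
      ... | inj₁ (q , d) | inj₂ (_ , d′) rewrite d | d′ = inj₁ (*-zeroʳ (A e))
      ... | inj₂ (_ , d) | _ rewrite d = inj₁ (*-zeroʳ (A e))

      new-apart : ∀ e f → a e f * (new e * new f) ≡ 0
      new-apart e f with zero-or-one (≤-trans (new≤act e) (act≤1 e))
      ... | inj₁ z rewrite z = *-zeroʳ (a e f)
      ... | inj₂ o rewrite o = trans (cong (a e f *_) (*-identityˡ (new f))) (vanish new new-rev e isolated′ f)
        where
        isolated′ : nb e new ≡ 0
        isolated′ = trans (sym (*-identityˡ _)) (trans (cong (_* nb e new) (sym o)) (added-independent A act≤1 deg< e))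

      null-below : ∀ {x y} c z → x ≤ y → c * (y * z) ≡ 0 → c * (x * z) ≡ 0
      null-below c z x≤y q = n≤0⇒n≡0 (≤-trans (*-monoʳ-≤ c (*-monoˡ-≤ z x≤y)) (≤-reflexive q))

      phase-matching : Matching left (λ e → m e + new e)
      phase-matching = record
        { act≤1 = λ e → ≤-trans (left≤act e) (act≤1 e)
        ; mat≤1 = mat≤
        ; apart = apart′
        ; isolated = isolated′
        ; independent = λ e f → trans (expand (a e f) (m e) (new e) (m f) (new f))
            (cong₂ _+_ (cong₂ _+_ (independent e f) (null-below (a e f) (m f) (new≤act e) (isolated e f)))
                       (cong₂ _+_ (trans (flip e f) (null-below (a f e) (m e) (new≤act f) (isolated f e))) (new-apart e f)))
        ; covered = covered′
        }
        where
        expand : ∀ c p q r s → c * ((p + q) * (r + s)) ≡ (c * (p * r) + c * (q * r)) + (c * (p * s) + c * (q * s))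
        expand = solve-∀
        flip : ∀ e f → a e f * (m e * new f) ≡ a f e * (new f * m e)
        flip e f = cong₂ _*_ (a-sym e f) (*-comm (m e) (new f))
        mat≤ : ∀ e → m e + new e ≤ 1
        mat≤ e with zero-or-one (act≤1 e)
        ... | inj₁ z rewrite n≤0⇒n≡0 (subst (new e ≤_) z (new≤act e)) | +-identityʳ (m e) = mat≤1 e
        ... | inj₂ o rewrite trans (sym (*-identityˡ (m e))) (trans (cong (_* m e) (sym o)) (apart e)) =
          subst (new e ≤_) o (new≤act e)
        apart′ : ∀ e → left e * (m e + new e) ≡ 0
        apart′ e with survive e
        ... | inj₁ z rewrite z = refl
        ... | inj₂ (z , _) = trans (cong (left e *_) (trans (cong (m e +_) z) (+-identityʳ (m e))))
                (n≤0⇒n≡0 (≤-trans (*-monoˡ-≤ (m e) (left≤act e)) (≤-reflexive (apart e))))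
        isolated′ : ∀ e f → a e f * (left e * (m f + new f)) ≡ 0
        isolated′ e f with survive e
        ... | inj₁ z rewrite z = *-zeroʳ (a e f)
        ... | inj₂ (_ , z) = trans (dist (a e f) (left e) (m f) (new f))
                (cong₂ _+_ (null-below (a e f) (m f) (left≤act e) (isolated e f))
                  (trans (cong (left e *_) (vanish new new-rev e z f)) (*-zeroʳ (left e))))
          where
          dist : ∀ c l p q → c * (l * (p + q)) ≡ c * (l * p) + l * (c * q)
          dist = solve-∀
        covered′ : ∀ e → left e ≡ 0 → 1 ≤ m e + new e + nb e (λ e → m e + new e)
        covered′ e l rewrite nb-+ e m new with zero-or-one (act≤1 e)
        ... | inj₁ z = ≤-trans (covered e z) (+-mono-≤ (m≤m+n (m e) (new e)) (m≤m+n (nb e m) (nb e new)))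
        ... | inj₂ o with δ-cases (new e) 0 | δ-cases (nb e new) 0
        ...   | inj₂ (q , _) | _ = ≤-trans (n≢0⇒n>0 q) (≤-trans (m≤n+m (new e) (m e)) (m≤m+n _ _))
        ...   | inj₁ _ | inj₂ (q , _) = ≤-trans (n≢0⇒n>0 q) (≤-trans (m≤n+m (nb e new) (nb e m)) (m≤n+m (nb e m + nb e new) (m e + new e)))
        ...   | inj₁ (_ , d) | inj₁ (_ , d′) = ⊥-elim (1+n≢0 (trans (sym (cong₂ _*_ o (cong₂ _*_ d d′))) l))

      phase-decrease : 64 * ∑ es left ≤ 63 * ∑ es A
      phase-decrease = phase-progress A act≤1 deg<
        (claw new new-rev (λ e → ≤-trans (new≤act e) (act≤1 e)) (added-independent A act≤1 deg<))

    acts mats : ℕ → E → ℕ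
    acts zero    = λ _ → 1
    acts (suc i) = survivors K k r B col (acts i)
    mats zero    = λ _ → 0
    mats (suc i) = λ e → mats i e + added K k r B col (acts i) e

    phases-runs : ∀ i → runs (loop i (λ _ → phaseP K k r B)) (state col (λ _ → 1) (λ _ → 0) (λ _ → 0) (λ _ → 0) (λ _ → 0) (λ _ → 0) (λ _ → 0))
                ≡ state col (acts i) (mats i) (λ _ → 0) (λ _ → 0) (λ _ → 0) (λ _ → 0) (λ _ → 0)
    phases-runs zero    = refl
    phases-runs (suc i) = trans (runs-++ (loop i _) (phaseP K k r B) _)
      (trans (cong (runs (phaseP K k r B)) (phases-runs i)) (phaseP-runs K k r B col (acts i) (mats i)))

    invariant : ∀ i → (∀ e → acts i (rev e) ≡ acts i e) × (∀ e → mats i (rev e) ≡ mats i e) × Matching (acts i) (mats i)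
    invariant zero = (λ _ → refl) , (λ _ → refl) , record
      { act≤1 = λ _ → ≤-refl ; mat≤1 = λ _ → z≤n ; apart = λ _ → refl
      ; isolated = λ e f → *-zeroʳ (a e f) ; independent = λ e f → *-zeroʳ (a e f) ; covered = λ _ () }
    invariant (suc i) with invariant i
    ... | A-rev , m-rev , M = left-rev (acts i) (mats i) A-rev m-rev M , mat-rev (acts i) (mats i) A-rev m-rev M
                            , phase-matching (acts i) (mats i) A-rev m-rev M

    -- A phase leaves at most 63/64 of the active edges, so 63 phases halve them.
    acts-decay : ∀ q → 2 ^ q * ∑ es (acts (q * 63)) ≤ ∑ es (λ _ → 1)
    acts-decay = decay 63 (λ i → ∑ es (acts i)) (λ i → let A-rev , m-rev , M = invariant i in
      phase-decrease (acts i) (mats i) A-rev m-rev M)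

-- Sums over lists and ports

∑-++ : (xs ys : List 𝒜) (h : 𝒜 → ℕ) → ∑ (xs ++ ys) h ≡ ∑ xs h + ∑ ys h
∑-++ []       ys h = refl
∑-++ (x ∷ xs) ys h = trans (cong (h x +_) (∑-++ xs ys h)) (sym (+-assoc (h x) (∑ xs h) (∑ ys h)))

∑-map : (f : 𝒜 → ℬ) (xs : List 𝒜) (h : ℬ → ℕ) → ∑ (map f xs) h ≡ ∑ xs (λ x → h (f x))
∑-map f []       h = refl
∑-map f (x ∷ xs) h = cong (h (f x) +_) (∑-map f xs h)

∑-concatMap : (f : 𝒜 → List ℬ) (xs : List 𝒜) (h : ℬ → ℕ) → ∑ (concatMap f xs) h ≡ ∑ xs (λ x → ∑ (f x) h)
∑-concatMap f []       h = refl
∑-concatMap f (x ∷ xs) h = trans (∑-++ (f x) (concatMap f xs) h) (cong (∑ (f x) h +_) (∑-concatMap f xs h))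

∑-filter-< : (f g : 𝒜 → ℕ) (xs : List 𝒜) (h : 𝒜 → ℕ) →
             ∑ (filter (λ x → f x <? g x) xs) h ≡ ∑ xs (λ x → lt (f x) (g x) * h x)
∑-filter-< f g []       h = refl
∑-filter-< f g (x ∷ xs) h with f x <ᵇ g x | <ᵇ⇒< (f x) (g x) | <⇒<ᵇ {f x} {g x}
... | true  | p | _ rewrite <⇒lt (p _) | *-identityˡ (h x) = cong (h x +_) (∑-filter-< f g xs h)
... | false | _ | p rewrite ≤⇒lt (≮⇒≥ p) = ∑-filter-< f g xs h

∑-∈ : {x : 𝒜} {xs : List 𝒜} → x ∈ xs → (h : 𝒜 → ℕ) → h x ≤ ∑ xs h
∑-∈ (here refl) h = m≤m+n _ _
∑-∈ (there p)   h = ≤-trans (∑-∈ p h) (m≤n+m _ _)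

∑-tabulate-0 : ∀ {n} (f : Fin n → 𝒜) (h : 𝒜 → ℕ) → (∀ y → h (f y) ≡ 0) → ∑ (tabulate f) h ≡ 0
∑-tabulate-0 {n = zero}  f h p = refl
∑-tabulate-0 {n = suc n} f h p = cong₂ _+_ (p zero) (∑-tabulate-0 (λ i → f (suc i)) h (λ i → p (suc i)))

∑-tabulate-single : ∀ {n} (f : Fin n → 𝒜) (h : 𝒜 → ℕ) (x : Fin n) →
                    (∀ y → y ≢ x → h (f y) ≡ 0) → ∑ (tabulate f) h ≡ h (f x)
∑-tabulate-single f h zero    p =
  trans (cong (h (f zero) +_) (∑-tabulate-0 (λ i → f (suc i)) h (λ i → p (suc i) (λ ())))) (+-identityʳ _)
∑-tabulate-single f h (suc x) p =
  cong₂ _+_ (p zero (λ ())) (∑-tabulate-single (λ i → f (suc i)) h x (λ y q → p (suc y) (λ { refl → q refl })))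

∑-allFin-single : ∀ {n} (h : Fin n → ℕ) (x : Fin n) → (∀ y → y ≢ x → h y ≡ 0) → ∑ (allFin n) h ≡ h x
∑-allFin-single = ∑-tabulate-single id

∑-≤-length : (xs : List 𝒜) (h : 𝒜 → ℕ) → (∀ x → h x ≤ 1) → ∑ xs h ≤ length xs
∑-≤-length []       h p = z≤n
∑-≤-length (x ∷ xs) h p = +-mono-≤ (p x) (∑-≤-length xs h p)

ι : ∀ {n} → Fin n → Fin n → ℕ
ι u v = δ (toℕ u) (toℕ v)

ι-refl : ∀ {n} (u : Fin n) → ι u u ≡ 1
ι-refl u = δ-refl (toℕ u)

ι-sym : ∀ {n} (u v : Fin n) → ι u v ≡ ι v u
ι-sym u v = δ-sym (toℕ u) (toℕ v)

ι-≢ : ∀ {n} {u v : Fin n} → u ≢ v → ι u v ≡ 0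
ι-≢ {u = u} {v} p = δ-≢ (toℕ u) (toℕ v) (λ q → p (toℕ-injective q))

skip : ∀ {d} → Fin d → (Fin d → ℕ) → ℕ
skip {d} i F = ∑ (allFin d) (λ i′ → (1 ∸ ι i i′) * F i′)

-- The line graph

module LineGraph {n : ℕ} (G : Graph n) where
  open Graph G

  Dart : Set
  Dart = Σ (Fin n) (λ v → Fin (deg v))

  tl hd : Dart → Fin n
  tl = proj₁
  hd d = nbr (proj₁ d) (proj₂ d)

  rv : Dart → Dart
  rv d = hd d , rev (proj₁ d) (proj₂ d)

  hd-rv : ∀ d → hd (rv d) ≡ tl d
  hd-rv d = rev-ok (proj₁ d) (proj₂ d)

  dart-ext : ∀ d d′ → tl d ≡ tl d′ → hd d ≡ hd d′ → d ≡ d′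
  dart-ext (v , i) (.v , i′) refl q = cong (v ,_) (nbr-inj v q)

  hd≢tl : ∀ d → hd d ≢ tl d
  hd≢tl d = loopless (proj₁ d) (proj₂ d)

  ds es : List Dart
  ds = darts G
  es = edges G

  ∑-darts : ∀ h → ∑ ds h ≡ ∑ (allFin n) (λ v → ∑ (allFin (deg v)) (λ i → h (v , i)))
  ∑-darts h = trans (∑-concatMap (λ v → map (λ i → v , i) (allFin (deg v))) (allFin n) h)
                    (∑-cong (allFin n) (λ v → ∑-map (λ i → v , i) (allFin (deg v)) h))

  ∑-darts-single : ∀ h d → (∀ d′ → d′ ≢ d → h d′ ≡ 0) → ∑ ds h ≡ h d
  ∑-darts-single h (v , i) p = trans (∑-darts h)
    (trans (∑-allFin-single _ v (λ u u≢v → ∑-0 (allFin (deg u)) (λ i′ → p (u , i′) (λ { refl → u≢v refl }))))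
           (∑-allFin-single _ i (λ i′ q → p (v , i′) (λ { refl → q refl }))))

  κ : Dart → Dart → ℕ
  κ d d′ = ι (tl d) (tl d′) * ι (hd d) (hd d′)

  κ-refl : ∀ d → κ d d ≡ 1
  κ-refl d rewrite ι-refl (tl d) | ι-refl (hd d) = refl

  κ-≢ : ∀ d d′ → d ≢ d′ → κ d d′ ≡ 0
  κ-≢ d d′ p with tl d ≟ᶠ tl d′ | hd d ≟ᶠ hd d′
  ... | yes q | yes r = ⊥-elim (p (dart-ext d d′ q r))
  ... | no  q | _     rewrite ι-≢ q = refl
  ... | yes _ | no  r rewrite ι-≢ r = *-zeroʳ (ι (tl d) (tl d′))

  ∑-κ : ∀ (h : Dart → ℕ) d → ∑ ds (λ d′ → κ d′ d * h d′) ≡ h d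
  ∑-κ h d = trans (∑-darts-single _ d (λ d′ p → cong (_* h d′) (κ-≢ d′ d p)))
                  (trans (cong (_* h d) (κ-refl d)) (*-identityˡ (h d)))

  κ-rv : ∀ d d′ → κ d′ (rv d) ≡ κ d (rv d′)
  κ-rv d d′ rewrite hd-rv d | hd-rv d′ =
    trans (*-comm (ι (tl d′) (hd d)) _) (cong₂ _*_ (ι-sym (hd d′) (tl d)) (ι-sym (tl d′) (hd d)))

  -- Reversal permutes the darts. Expanding `h (rv d)` against the indicator `κ` and exchanging the
  -- sums reduces this to the symmetry `κ-rv`.
  ∑-rv : ∀ h → ∑ ds (λ d → h (rv d)) ≡ ∑ ds h
  ∑-rv h = begin
    ∑ ds (λ d → h (rv d))                            ≡⟨ ∑-cong ds (λ d → sym (∑-κ h (rv d))) ⟩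
    ∑ ds (λ d → ∑ ds (λ d′ → κ d′ (rv d) * h d′))    ≡⟨ ∑-swap ds ds _ ⟩
    ∑ ds (λ d′ → ∑ ds (λ d → κ d′ (rv d) * h d′))    ≡⟨ ∑-cong ds (λ d′ → ∑-cong ds (λ d → cong (_* h d′) (κ-rv d d′))) ⟩
    ∑ ds (λ d′ → ∑ ds (λ d → κ d (rv d′) * h d′))    ≡⟨ ∑-cong ds (λ d′ → ∑-κ (λ _ → h d′) (rv d′)) ⟩
    ∑ ds h                                           ∎
    where open ≡-Reasoning

  ∑-edges : ∀ h → ∑ es h ≡ ∑ ds (λ d → lt (toℕ (tl d)) (toℕ (hd d)) * h d)
  ∑-edges h = ∑-filter-< (λ d → toℕ (tl d)) (λ d → toℕ (hd d)) ds h

  -- Exactly one of the two orientations of an edge is listed in `es`, since its end points differ.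
  ∑-fold : ∀ h → ∑ es (λ f → h f + h (rv f)) ≡ ∑ ds h
  ∑-fold h = begin
    ∑ es (λ f → h f + h (rv f))                      ≡⟨ ∑-edges _ ⟩
    ∑ ds (λ d → up d * (h d + h (rv d)))             ≡⟨ ∑-cong ds (λ d → *-distribˡ-+ (up d) (h d) (h (rv d))) ⟩
    ∑ ds (λ d → up d * h d + up d * h (rv d))        ≡⟨ ∑-+ ds _ _ ⟩
    ∑ ds (λ d → up d * h d) + ∑ ds (λ d → up d * h (rv d))
      ≡⟨ cong (∑ ds (λ d → up d * h d) +_) (trans (∑-cong ds (λ d → cong (λ z → lt (toℕ z) (toℕ (hd d)) * h (rv d)) (sym (hd-rv d)))) (∑-rv (λ d → down d * h d))) ⟩
    ∑ ds (λ d → up d * h d) + ∑ ds (λ d → down d * h d) ≡⟨ sym (∑-+ ds _ _) ⟩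
    ∑ ds (λ d → up d * h d + down d * h d)           ≡⟨ ∑-cong ds (λ d → trans (sym (*-distribʳ-+ (h d) (up d) (down d))) (trans (cong (_* h d) (one d)) (*-identityˡ (h d)))) ⟩
    ∑ ds h                                           ∎
    where
    open ≡-Reasoning
    up down : Dart → ℕ
    up d = lt (toℕ (tl d)) (toℕ (hd d))
    down d = lt (toℕ (hd d)) (toℕ (tl d))
    one : ∀ d → up d + down d ≡ 1
    one d = trans (cong (_+ (up d + down d)) (sym (ι-≢ (λ q → hd≢tl d (sym q))))) (δ-trichotomy (toℕ (tl d)) (toℕ (hd d)))

  -- Adjacency is defined for all darts but depends only on the underlying edges. Distinct edges
  -- share at most one vertex, so `touch` is then 0 or 1; for equal edges `same` makes the product
  -- vanish.
  same touch a : Dart → Dart → ℕ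
  same e f = ι (tl e) (tl f) * ι (hd e) (hd f) + ι (tl e) (hd f) * ι (hd e) (tl f)
  touch e f = (ι (tl e) (tl f) + ι (tl e) (hd f)) + (ι (hd e) (tl f) + ι (hd e) (hd f))
  a e f = (1 ∸ same e f) * touch e f

  a-sym : ∀ e f → a e f ≡ a f e
  a-sym e f rewrite ι-sym (tl f) (tl e) | ι-sym (hd f) (hd e) | ι-sym (tl f) (hd e) | ι-sym (hd f) (tl e) =
    cong₂ (λ x y → (1 ∸ x) * y) (cong (ι (tl e) (tl f) * ι (hd e) (hd f) +_) (*-comm (ι (tl e) (hd f)) (ι (hd e) (tl f))))
      (e₁ (ι (tl e) (tl f)) (ι (tl e) (hd f)) (ι (hd e) (tl f)) (ι (hd e) (hd f)))
    where
    e₁ : ∀ p q r s → (p + q) + (r + s) ≡ (p + r) + (q + s)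
    e₁ = solve-∀

  a-rev : ∀ e f → a (rv e) f ≡ a e f
  a-rev e f rewrite hd-rv e =
    cong₂ (λ x y → (1 ∸ x) * y) (e₁ (ι (hd e) (tl f)) (ι (tl e) (hd f)) (ι (hd e) (hd f)) (ι (tl e) (tl f)))
      (+-comm (ι (hd e) (tl f) + ι (hd e) (hd f)) _)
    where
    e₁ : ∀ p q r s → p * q + r * s ≡ s * r + q * p
    e₁ = solve-∀

  same-rv : ∀ e f → same e (rv f) ≡ same e f
  same-rv e f rewrite hd-rv f = +-comm (ι (tl e) (hd f) * ι (hd e) (tl f)) _

  open Conflicts Dart es a a-sym using (nb; Proper)

  Invariant : (Dart → ℕ) → Set
  Invariant F = ∀ e → F (rv e) ≡ F e

  local : Dart → (Dart → ℕ) → ℕ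
  local e F = skip (proj₂ e) (λ i → F (tl e , i)) + skip (proj₂ (rv e)) (λ j → F (hd e , j))

  star : ∀ x F → Invariant F → ∑ es (λ f → (ι x (tl f) + ι x (hd f)) * F f) ≡ ∑ (allFin (deg x)) (λ i → F (x , i))
  star x F inv = begin
    ∑ es (λ f → (ι x (tl f) + ι x (hd f)) * F f)
      ≡⟨ ∑-cong es (λ f → trans (*-distribʳ-+ (F f) (ι x (tl f)) (ι x (hd f))) (cong (λ z → ι x (tl f) * F f + ι x (hd f) * z) (sym (inv f)))) ⟩
    ∑ es (λ f → ι x (tl f) * F f + ι x (hd f) * F (rv f))
      ≡⟨ ∑-fold (λ f → ι x (tl f) * F f) ⟩
    ∑ ds (λ f → ι x (tl f) * F f)
      ≡⟨ ∑-darts _ ⟩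
    ∑ (allFin n) (λ v → ∑ (allFin (deg v)) (λ i → ι x v * F (v , i)))
      ≡⟨ ∑-cong (allFin n) (λ v → ∑-*ˡ (allFin (deg v)) (ι x v) _) ⟩
    ∑ (allFin n) (λ v → ι x v * ∑ (allFin (deg v)) (λ i → F (v , i)))
      ≡⟨ ∑-allFin-single _ x (λ v p → cong (_* ∑ (allFin (deg v)) (λ i → F (v , i))) (ι-≢ (≢-sym p))) ⟩
    ι x x * ∑ (allFin (deg x)) (λ i → F (x , i))
      ≡⟨ trans (cong (_* ∑ (allFin (deg x)) (λ i → F (x , i))) (ι-refl x)) (*-identityˡ _) ⟩
    ∑ (allFin (deg x)) (λ i → F (x , i)) ∎
    where open ≡-Reasoning

  ι-nbr : ∀ v i i′ → ι (nbr v i) (nbr v i′) ≡ ι i i′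
  ι-nbr v i i′ with i ≟ᶠ i′
  ... | yes refl = trans (ι-refl (nbr v i)) (sym (ι-refl i))
  ... | no  p    = trans (ι-≢ (λ q → p (nbr-inj v q))) (sym (ι-≢ p))

  same-tl : ∀ e i → same e (tl e , i) ≡ ι (proj₂ e) i
  same-tl e@(v , i₀) i rewrite ι-refl v | ι-≢ (hd≢tl e) | *-zeroʳ (ι v (nbr v i)) | +-identityʳ (ι (nbr v i₀) (nbr v i)) =
    trans (+-identityʳ _) (ι-nbr v i₀ i)

  same-hd : ∀ e j → same e (hd e , j) ≡ ι (proj₂ (rv e)) j
  same-hd e j rewrite ι-refl (hd e) | ι-≢ {u = tl e} {hd e} (≢-sym (hd≢tl e)) =
    trans (*-identityʳ _) (trans (cong (λ z → ι z (nbr (hd e) j)) (sym (hd-rv e))) (ι-nbr (hd e) (proj₂ (rv e)) j))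

  -- The sum splits at the two end points, and the edge itself is skipped at each. One end holds one
  -- half of `local`, and a single message brings the other half.
  nb-local : ∀ e F → Invariant F → nb e F ≡ local e F
  nb-local e F inv = begin
    ∑ es (λ f → a e f * F f)                         ≡⟨ ∑-cong es (λ f → dist (1 ∸ same e f) (ι (tl e) (tl f) + ι (tl e) (hd f)) (ι (hd e) (tl f) + ι (hd e) (hd f)) (F f)) ⟩
    ∑ es (λ f → (ι (tl e) (tl f) + ι (tl e) (hd f)) * F′ f + (ι (hd e) (tl f) + ι (hd e) (hd f)) * F′ f) ≡⟨ ∑-+ es _ _ ⟩
    ∑ es (λ f → (ι (tl e) (tl f) + ι (tl e) (hd f)) * F′ f) + ∑ es (λ f → (ι (hd e) (tl f) + ι (hd e) (hd f)) * F′ f)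
      ≡⟨ cong₂ _+_ (star (tl e) F′ inv′) (star (hd e) F′ inv′) ⟩
    ∑ (allFin (deg (tl e))) (λ i → F′ (tl e , i)) + ∑ (allFin (deg (hd e))) (λ j → F′ (hd e , j))
      ≡⟨ cong₂ _+_ (∑-cong (allFin (deg (tl e))) (λ i → cong (λ z → (1 ∸ z) * F (tl e , i)) (same-tl e i)))
                   (∑-cong (allFin (deg (hd e))) (λ j → cong (λ z → (1 ∸ z) * F (hd e , j)) (same-hd e j))) ⟩
    local e F ∎
    where
    open ≡-Reasoning
    F′ : Dart → ℕ
    F′ f = (1 ∸ same e f) * F f
    inv′ : Invariant F′
    inv′ f = cong₂ (λ x y → (1 ∸ x) * y) (same-rv e f) (inv f)
    dist : ∀ c p q F → c * (p + q) * F ≡ p * (c * F) + q * (c * F)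
    dist = solve-∀

  skip≤ : ∀ {d} (i : Fin d) F → skip i F ≤ ∑ (allFin d) F
  skip≤ {d} i F = ∑-mono (allFin d) (λ i′ → ≤-trans (*-monoˡ-≤ (F i′) (m∸n≤m 1 (ι i i′))) (≤-reflexive (*-identityˡ (F i′))))

  degree-bound : ∀ e → nb e (λ _ → 1) ≤ deg (tl e) + deg (hd e)
  degree-bound e = ≤-trans (≤-reflexive (nb-local e (λ _ → 1) (λ _ → refl)))
    (+-mono-≤ (≤-trans (skip≤ (proj₂ e) (λ _ → 1)) (count (deg (tl e))))
              (≤-trans (skip≤ (proj₂ (rv e)) (λ _ → 1)) (count (deg (hd e)))))
    where
    count : ∀ d → ∑ (allFin d) (λ _ → 1) ≤ d
    count d = ≤-trans (∑-≤-length (allFin d) _ (λ _ → ≤-refl)) (≤-reflexive (length-tabulate id))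

  deg≤maxDeg : ∀ v → deg v ≤ maxDeg G
  deg≤maxDeg v = go (∈-allFin v)
    where
    go : ∀ {xs} → v ∈ xs → deg v ≤ foldr (λ v m → deg v ⊔ m) 0 xs
    go (here refl)          = m≤m⊔n (deg v) _
    go (there {x = x} p)    = ≤-trans (go p) (m≤n⊔m (deg x) _)

  -- `nb` sums over listed orientations only; by invariance the sum over all darts is twice as
  -- large, hence also 0.
  vanish : ∀ s → Invariant s → ∀ e → nb e s ≡ 0 → ∀ f → a e f * s f ≡ 0
  vanish s inv e z f = n≤0⇒n≡0 (begin
    F f                           ≡⟨ sym (∑-κ F f) ⟩
    ∑ ds (λ d → κ d f * F d)      ≤⟨ ∑-mono ds (λ d → ≤-trans (*-monoˡ-≤ (F d) (*-mono-≤ (δ≤1 (toℕ (tl d)) _) (δ≤1 (toℕ (hd d)) _))) (≤-reflexive (*-identityˡ (F d)))) ⟩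
    ∑ ds F                        ≡⟨ sym (∑-fold F) ⟩
    ∑ es (λ d → F d + F (rv d))   ≡⟨ ∑-cong es (λ d → cong (F d +_) (F-inv d)) ⟩
    ∑ es (λ d → F d + F d)        ≡⟨ ∑-+ es F F ⟩
    ∑ es F + ∑ es F               ≡⟨ cong₂ _+_ z z ⟩
    0                             ∎)
    where
    open ≤-Reasoning
    F : Dart → ℕ
    F f = a e f * s f
    F-inv : Invariant F
    F-inv d = cong₂ _*_ (trans (a-sym e (rv d)) (trans (a-rev d e) (a-sym d e))) (inv d)

  -- Any other member at `v` would be adjacent to the first one found and contribute to its `nb`,
  -- which is 0.
  one-per-vertex : ∀ s → Invariant s → (∀ e → s e ≤ 1) → (∀ e → s e * nb e s ≡ 0) →
                   ∀ v → ∑ (allFin (deg v)) (λ i → s (v , i)) ≤ 1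
  one-per-vertex s inv s≤1 indep v with any? (λ i → s (v , i) ≟ 1)
  ... | no  none = ≤-trans (≤-reflexive (∑-0 (allFin (deg v)) zeros)) z≤n
    where
    zeros : ∀ i → s (v , i) ≡ 0
    zeros i with s (v , i) in eq | s≤1 (v , i)
    ... | 0 | _ = refl
    ... | 1 | _ = ⊥-elim (none (i , eq))
    ... | suc (suc _) | s≤s ()
  ... | yes (i , s≡1) = ≤-trans (≤-reflexive (∑-allFin-single _ i others)) (s≤1 (v , i))
    where
    none : nb (v , i) s ≡ 0
    none = trans (sym (*-identityˡ _)) (trans (cong (_* nb (v , i) s) (sym s≡1)) (indep (v , i)))
    others : ∀ i′ → i′ ≢ i → s (v , i′) ≡ 0
    others i′ p = n≤0⇒n≡0 (begin
      s (v , i′)                            ≡⟨ sym (*-identityˡ _) ⟩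
      (1 ∸ 0) * s (v , i′)                  ≡⟨ cong (λ z → (1 ∸ z) * s (v , i′)) (sym (ι-≢ (≢-sym p))) ⟩
      (1 ∸ ι i i′) * s (v , i′)             ≤⟨ ∑-∈ (∈-allFin i′) (λ i′ → (1 ∸ ι i i′) * s (v , i′)) ⟩
      skip i (λ i′ → s (v , i′))            ≤⟨ m≤m+n _ _ ⟩
      local (v , i) s                       ≡⟨ trans (sym (nb-local (v , i) s inv)) none ⟩
      0                                     ∎)
      where open ≤-Reasoning

  claw : ∀ s → Invariant s → (∀ e → s e ≤ 1) → (∀ e → s e * nb e s ≡ 0) → ∀ e → s e + nb e s ≤ 2
  claw s inv s≤1 indep e with s e in eq | s≤1 e
  ... | suc (suc _) | s≤s ()
  ... | 1 | _ rewrite trans (sym (*-identityˡ _)) (trans (cong (_* nb e s) (sym eq)) (indep e)) = s≤s z≤n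
  ... | 0 | _ = ≤-trans (≤-reflexive (nb-local e s inv))
    (+-mono-≤ (≤-trans (skip≤ (proj₂ e) _) (one-per-vertex s inv s≤1 indep (tl e)))
              (≤-trans (skip≤ (proj₂ (rv e)) _) (one-per-vertex s inv s≤1 indep (hd e))))

  module _ (ident : Fin n → ℕ) (ident-inj : Injective _≡_ _≡_ ident) where

    idSum : Dart → ℕ
    idSum d = ident (tl d) + ident (hd d)

    idSum-rv : Invariant idSum
    idSum-rv d rewrite hd-rv d = +-comm (ident (hd d)) (ident (tl d))

    -- Adjacent edges share an end point. Equal sums then give equal identifiers at the other ends,
    -- so the edges coincide, and an edge is not adjacent to itself.
    idSum-proper : Proper idSum
    idSum-proper e = ∑-0 es clash
      where
      clash : ∀ f → a e f * δ (idSum e) (idSum f) ≡ 0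
      clash f with δ-cases (idSum e) (idSum f)
      ... | inj₂ (_ , d) rewrite d = *-zeroʳ (a e f)
      ... | inj₁ (q , d) = cong (_* δ (idSum e) (idSum f)) apart
        where
        coincide : 1 ≤ same e f → a e f ≡ 0
        coincide p rewrite m≤n⇒m∸n≡0 p = refl
        straight : tl e ≡ tl f → hd e ≡ hd f → a e f ≡ 0
        straight r s = coincide (≤-trans (≤-reflexive (sym (cong₂ _*_ (trans (cong (ι (tl e)) (sym r)) (ι-refl (tl e))) (trans (cong (ι (hd e)) (sym s)) (ι-refl (hd e)))))) (m≤m+n _ _))
        crossed : tl e ≡ hd f → hd e ≡ tl f → a e f ≡ 0
        crossed r s = coincide (≤-trans (≤-reflexive (sym (cong₂ _*_ (trans (cong (ι (tl e)) (sym r)) (ι-refl (tl e))) (trans (cong (ι (hd e)) (sym s)) (ι-refl (hd e)))))) (m≤n+m _ _))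
        apart : a e f ≡ 0
        apart with tl e ≟ᶠ tl f
        ... | yes r = straight r (ident-inj (+-cancelˡ-≡ (ident (tl e)) _ _ (trans q (cong (λ z → ident z + ident (hd f)) (sym r)))))
        ... | no tt with hd e ≟ᶠ hd f
        ...   | yes r = straight (ident-inj (+-cancelʳ-≡ (ident (hd e)) _ _ (trans q (cong (λ z → ident (tl f) + ident z) (sym r))))) r
        ...   | no hh with tl e ≟ᶠ hd f
        ...     | yes r = crossed r (ident-inj (+-cancelˡ-≡ (ident (tl e)) _ _ (trans q (trans (+-comm (ident (tl f)) _) (cong (λ z → ident z + ident (tl f)) (sym r))))))
        ...     | no th with hd e ≟ᶠ tl f
        ...       | yes r = crossed (ident-inj (+-cancelʳ-≡ (ident (hd e)) _ _ (trans q (trans (+-comm (ident (tl f)) _) (cong (λ z → ident (hd f) + ident z) (sym r)))))) r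
        ...       | no ht rewrite ι-≢ tt | ι-≢ hh | ι-≢ th | ι-≢ ht = refl

-- The LOCAL algorithm and its output

first : ∀ {d} → (Fin d → ℕ) → Maybe (Fin d)
first {zero}  f = nothing
first {suc d} f with f zero
... | suc _ = just zero
... | zero  = mapMaybe suc (first (λ i → f (suc i)))

first-cong : ∀ {d} {f g : Fin d → ℕ} → (∀ i → f i ≡ g i) → first f ≡ first g
first-cong {zero}  p = refl
first-cong {suc d} {f} {g} p rewrite p zero with g zero
... | suc _ = refl
... | zero  = cong (mapMaybe suc) (first-cong (λ i → p (suc i)))

first-sound : ∀ {d} (f : Fin d → ℕ) i → first f ≡ just i → f i ≢ 0
first-sound {suc d} f i eq with f zero in z
first-sound {suc d} f .zero refl | suc _ = λ q → 1+n≢0 (trans (sym z) q)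
... | zero with first (λ i → f (suc i)) in r
first-sound {suc d} f .(suc j) refl | zero | just j = first-sound (λ i → f (suc i)) j r

first-complete : ∀ {d} (f : Fin d → ℕ) i → f i ≢ 0 → Σ (Fin d) λ j → first f ≡ just j
first-complete {suc d} f i p with f zero in z
... | suc _ = zero , refl
first-complete {suc d} f zero    p | zero = ⊥-elim (p z)
first-complete {suc d} f (suc i) p | zero with first-complete (λ i → f (suc i)) i p
... | j , q rewrite q = suc j , refl

∑-positive : {A : Set} (xs : List A) (h : A → ℕ) → ∑ xs h ≢ 0 → Σ A λ x → h x ≢ 0
∑-positive []       h p = ⊥-elim (p refl)
∑-positive (x ∷ xs) h p with h x in eq
... | suc _ = x , λ q → 1+n≢0 (trans (sym eq) q)
... | zero  = ∑-positive xs h p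

length-filter-≥ : {A : Set} {P : A → Set} (P? : Decidable P) (h : A → ℕ) → (∀ x → ¬ P x → 1 ≤ h x) →
                  ∀ xs → length xs ≤ length (filter P? xs) + ∑ xs h
length-filter-≥ P? h p []       = z≤n
length-filter-≥ P? h p (x ∷ xs) with P? x
... | yes _ = s≤s (≤-trans (length-filter-≥ P? h p xs) (+-monoʳ-≤ _ (m≤n+m (∑ xs h) (h x))))
... | no ¬q = ≤-trans (s≤s (length-filter-≥ P? h p xs)) (≤-trans (≤-reflexive (sym (+-suc _ (∑ xs h))))
                (+-monoʳ-≤ _ (+-monoˡ-≤ (∑ xs h) (p x ¬q))))

-- The instruction nothing lets the two ends of an edge add up their colours.

Message : Set
Message = Σ ℕ λ d → (Fin d → Reg) × Fin d

perform : ∀ {d} → List (Maybe Step) → (Fin d → Reg) → (Fin d → Message) → Fin d → Reg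
perform []             A msg i = A i
perform (nothing ∷ ss) A msg i = record (A i) { col = col (A i) + col (proj₁ (proj₂ (msg i)) (proj₂ (proj₂ (msg i)))) }
perform (just s ∷ ss)  A msg i = update s (A i) (λ q →
  skip i (λ i′ → q (A i′)) + skip (proj₂ (proj₂ (msg i))) (λ j′ → q (proj₁ (proj₂ (msg i)) j′)))

next : List (Maybe Step) → List (Maybe Step)
next []       = []
next (s ∷ ss) = ss

-- A node keeps one register per port, so every edge has a copy at each end. A message carries all
-- registers of the sender together with the port of the shared edge, which the receiver must skip.
algorithm : (ℕ → ℕ → List (Maybe Step)) → (ℕ → ℕ) → LocalAlg
algorithm prog mat₀ = record
  { State  = λ d → List (Maybe Step) × (Fin d → Reg)
  ; Msg    = Message
  ; rounds = λ n L → length (prog n L)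
  ; init   = λ n L id d → prog n L , λ _ → reg id 1 (mat₀ L) 0 0 0 0 0
  ; send   = λ {d} S i → d , proj₂ S , i
  ; recv   = λ S msg → next (proj₁ S) , perform (proj₁ S) (proj₂ S) msg
  ; out    = λ S → first (λ i → mat (proj₂ S i))
  }

-- Agreement of the LOCAL run with the global semantics

module Simulation (prog : ℕ → ℕ → List (Maybe Step)) (mat₀ : ℕ → ℕ) {n : ℕ} (G : Graph n) (ident : Fin n → ℕ) (L : ℕ) where
  open Graph G
  open LineGraph G
  open Conflicts Dart es a a-sym
  open Semantics Dart es a a-sym
  open Algorithm Dart es a a-sym rv a-rev

  private
    S = stateAt (algorithm prog mat₀) G ident L

  Holds : ℕ → List (Maybe Step) → (Dart → Reg) → Set
  Holds t ss X = ∀ v → proj₁ (S t v) ≡ ss × (∀ i → proj₂ (S t v) i ≡ X (v , i))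

  -- The two `skip` sums of `perform` form the right-hand side of `nb-local`; this is where
  -- invariance of `X` is needed. `ext` turns agreement of the sums into agreement of the registers.
  simulate-step : ∀ t s ss X → (∀ e → X (rv e) ≡ X e) → Holds t (just s ∷ ss) X → Holds (suc t) ss (exec s X)
  simulate-step t s ss X inv H v = cong next (proj₁ (H v)) , λ i →
    trans (cong (λ l → perform l (proj₂ (S t v)) (λ i → deg (nbr v i) , proj₂ (S t (nbr v i)) , rev v i) i) (proj₁ (H v)))
      (trans (cong (λ d → update s d _) (proj₂ (H v) i)) (ext s (X (v , i)) (λ q →
        trans (cong₂ _+_ (∑-cong (allFin (deg v)) (λ i′ → cong (λ z → (1 ∸ ι i i′) * q z) (proj₂ (H v) i′)))
                         (∑-cong (allFin (deg (nbr v i))) (λ j′ → cong (λ z → (1 ∸ ι (rev v i) j′) * q z) (proj₂ (H (nbr v i)) j′))))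
              (sym (nb-local (v , i) (λ e → q (X e)) (λ e → cong q (inv e)))))))

  simulate : ∀ ss t X → (∀ e → X (rv e) ≡ X e) → Holds t (map just ss) X → Holds (length (map {B = Maybe Step} just ss) + t) [] (runs ss X)
  simulate []       t X inv H = H
  simulate (s ∷ ss) t X inv H = subst (λ u → Holds u [] (runs ss (exec s X))) (+-suc (length (map {B = Maybe Step} just ss)) t)
    (simulate ss (suc t) (exec s X) (exec-rev s X inv) (simulate-step t s (map just ss) X inv H))

  simulate-program : ∀ ss → prog n L ≡ nothing ∷ map just ss → (ident-inj : Injective _≡_ _≡_ ident) →
    ∀ v → output (algorithm prog mat₀) G ident L v
        ≡ first (λ i → mat (runs ss (λ e → reg (idSum ident ident-inj e) 1 (mat₀ L) 0 0 0 0 0) (v , i)))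
  simulate-program ss eq inj v = trans
    (cong (λ t → first (λ i → mat (proj₂ (S t v) i))) (trans (cong length eq) (+-comm 1 _)))
    (first-cong (λ i → cong mat (proj₂ (simulate ss 1 _ (λ e → cong (λ z → reg z 1 (mat₀ L) 0 0 0 0 0) (idSum-rv ident inj e)) begun v) i)))
    where
    -- The opening round adds the identifiers of both ends, so from time 1 on the colours are
    -- `idSum` and the two copies agree.
    begun : Holds 1 (map just ss) (λ e → reg (idSum ident inj e) 1 (mat₀ L) 0 0 0 0 0)
    begun v = cong next eq , λ i → cong (λ l → perform l (λ _ → reg (ident v) 1 (mat₀ L) 0 0 0 0 0)
      (λ i → deg (nbr v i) , (λ _ → reg (ident (nbr v i)) 1 (mat₀ L) 0 0 0 0 0) , rev v i) i) eq

  module _ (m act : Dart → ℕ)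
           (output≡ : ∀ v → output (algorithm prog mat₀) G ident L v ≡ first (λ i → m (v , i)))
           (m-rv : Invariant m) (unique : ∀ v i i′ → m (v , i) ≢ 0 → m (v , i′) ≢ 0 → i ≡ i′)
           (cover : ∀ e → act e ≡ 0 → (Σ _ λ i → m (tl e , i) ≢ 0) ⊎ (Σ _ λ j → m (hd e , j) ≢ 0)) where

    -- The shared edge is marked at the neighbour too, so the neighbour outputs some marked port,
    -- and uniqueness says it is this one.
    consistent : ConsistentMatching (algorithm prog mat₀) G ident L
    consistent v i eq = trans (output≡ (nbr v i)) (trans found (cong just (unique (nbr v i) _ _ (first-sound _ _ found) back)))
      where
      here≢0 : m (v , i) ≢ 0
      here≢0 = first-sound (λ i → m (v , i)) i (trans (sym (output≡ v)) eq)
      back : m (rv (v , i)) ≢ 0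
      back q = here≢0 (trans (sym (m-rv (v , i))) q)
      found : first (λ j → m (nbr v i , j)) ≡ just _
      found = proj₂ (first-complete (λ j → m (nbr v i , j)) (rev v i) back)

    matched-true : ∀ v i → m (v , i) ≢ 0 → T (matched (algorithm prog mat₀) G ident L v)
    matched-true v i p with first-complete (λ i → m (v , i)) i p
    ... | j , q rewrite output≡ v | q = _

    few-uncovered : length es ≤ length (coveredEdges (algorithm prog mat₀) G ident L) + ∑ es act
    few-uncovered = length-filter-≥ _ act missed es
      where
      missed : ∀ e → ¬ T (matched (algorithm prog mat₀) G ident L (tl e) ∨ matched (algorithm prog mat₀) G ident L (hd e)) → 1 ≤ act e
      missed e p with act e in eq
      ... | suc _ = s≤s z≤n
      ... | zero with cover e eq
      ...   | inj₁ (i , q) = ⊥-elim (p (Equivalence.from T-∨ (inj₁ (matched-true (tl e) i q))))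
      ...   | inj₂ (j , q) = ⊥-elim (p (Equivalence.from (T-∨ {matched (algorithm prog mat₀) G ident L (tl e)}) (inj₂ (matched-true (hd e) j q))))

  matching-unique : ∀ {act m} → Matching act m → ∀ v i i′ → m (v , i) ≢ 0 → m (v , i′) ≢ 0 → i ≡ i′
  matching-unique {act} {m} M v i i′ p q with i ≟ᶠ i′
  ... | yes r = r
  ... | no  r = ⊥-elim (pos (m*n≡0⇒m≡0∨n≡0 (a (v , i) (v , i′)) (Matching.independent M (v , i) (v , i′))))
    where
    a≢0 : a (v , i) (v , i′) ≢ 0
    a≢0 rewrite same-tl (v , i) i′ | ι-≢ r | ι-refl v = λ ()
    pos : ¬ (a (v , i) (v , i′) ≡ 0 ⊎ m (v , i) * m (v , i′) ≡ 0)
    pos (inj₁ z) = a≢0 z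
    pos (inj₂ z) with m*n≡0⇒m≡0∨n≡0 (m (v , i)) z
    ... | inj₁ y = p y
    ... | inj₂ y = q y

  matching-cover : ∀ {act m} → Invariant m → Matching act m → ∀ e → act e ≡ 0 →
    (Σ _ λ i → m (tl e , i) ≢ 0) ⊎ (Σ _ λ j → m (hd e , j) ≢ 0)
  matching-cover {act} {m} inv M e z with m e ≟ 0
  ... | no  p = inj₁ (proj₂ e , p)
  ... | yes p with skip (proj₂ e) (λ i → m (tl e , i)) ≟ 0 | skip (proj₂ (rv e)) (λ j → m (hd e , j)) ≟ 0
  ...   | no q | _ = let i , r = ∑-positive (allFin _) _ q in inj₁ (i , λ y → r (trans (cong ((1 ∸ ι (proj₂ e) i) *_) y) (*-zeroʳ (1 ∸ ι (proj₂ e) i))))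
  ...   | yes _ | no q = let j , r = ∑-positive (allFin _) _ q in inj₂ (j , λ y → r (trans (cong ((1 ∸ ι (proj₂ (rv e)) j) *_) y) (*-zeroʳ (1 ∸ ι (proj₂ (rv e)) j))))
  ...   | yes q | yes r = ⊥-elim (<⇒≱ (Matching.covered M e z)
            (≤-reflexive (cong₂ _+_ p (trans (nb-local e m inv) (cong₂ _+_ q r)))))

-- Number of rounds

size≤ : ∀ μ b j → μ * suc b ≤ 2 ^ j → size μ b ≤ 2 ^ (1 + 2 * j)
size≤ μ b j p = begin
  m * (m + m)             ≡⟨ e₁ m ⟩
  2 * (m * m)             ≤⟨ *-monoʳ-≤ 2 (*-mono-≤ p p) ⟩
  2 * (2 ^ j * 2 ^ j)     ≡⟨ cong (2 *_) (sym (^-distribˡ-+-* 2 j j)) ⟩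
  2 ^ (1 + (j + j))       ≡⟨ cong (λ z → 2 ^ (1 + (j + z))) (sym (+-identityʳ j)) ⟩
  2 ^ (1 + 2 * j)         ∎
  where
  open ≤-Reasoning
  m = μ * suc b
  e₁ : ∀ m → m * (m + m) ≡ 2 * (m * m)
  e₁ = solve-∀

bits≤ : ∀ μ b j → μ * suc b ≤ 2 ^ j → bits μ b ≤ 1 + 2 * j
bits≤ μ b j p rewrite bits≡ μ b = ⌈log₂⌉-≤ (size≤ μ b j p)

module _ (Λ k : ℕ) where

  private
    -- A power of two above 2 k + 32, the additive constant of one colour reduction.
    κ = 2 ^ (5 + k)

    κ≥ : 2 * k + 32 ≤ κ
    κ≥ = begin
      2 * k + 32           ≤⟨ m≤m+n _ (30 * k) ⟩
      2 * k + 32 + 30 * k  ≡⟨ e₁ k ⟩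
      32 * suc k           ≤⟨ *-monoʳ-≤ 32 (1+n≤2^n k) ⟩
      32 * 2 ^ k           ≡⟨ sym (^-distribˡ-+-* 2 5 k) ⟩
      2 ^ (5 + k)          ∎
      where
      open ≤-Reasoning
      e₁ : ∀ k → 2 * k + 32 + 30 * k ≡ 32 * suc k
      e₁ = solve-∀

  finalBits : ℕ
  finalBits = 2 * κ + 4 * Λ

  finalBits≤ : finalBits + 1 ≤ 2 ^ (7 + k) * suc Λ
  finalBits≤ = begin
    2 * κ + 4 * Λ + 1    ≤⟨ +-mono-≤ (+-monoʳ-≤ (2 * κ) (*-monoʳ-≤ 4 (m≤n*m Λ κ {{m^n≢0 2 (5 + k)}}))) (m^n>0 2 (5 + k)) ⟩
    2 * κ + 4 * (κ * Λ) + κ ≤⟨ m≤m+n _ κ ⟩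
    2 * κ + 4 * (κ * Λ) + κ + κ ≡⟨ e₁ κ Λ ⟩
    4 * κ * suc Λ        ≡⟨ cong (_* suc Λ) (sym (^-distribˡ-+-* 2 2 (5 + k))) ⟩
    2 ^ (7 + k) * suc Λ  ∎
    where
    open ≤-Reasoning
    e₁ : ∀ κ Λ → 2 * κ + 4 * (κ * Λ) + κ + κ ≡ 4 * κ * suc Λ
    e₁ = solve-∀

  -- A reduction leaves about 2 (Λ + log b) bits. The bound on log b contains another Λ, the crude
  -- logarithm of the part of `b` linear in Λ; hence 4 Λ.
  linialBits-step : ∀ x b → 1 ≤ x → b ≤ κ * x + 4 * Λ + κ → bits (2 ^ Λ) b ≤ κ * ⌈log₂ x ⌉ + 4 * Λ + κ
  linialBits-step x b x≥1 b≤ = begin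
    bits (2 ^ Λ) b                           ≤⟨ bits≤ (2 ^ Λ) b (Λ + (X + ((7 + k) + Λ))) fits ⟩
    1 + 2 * (Λ + (X + ((7 + k) + Λ)))        ≤⟨ m≤m+n _ 17 ⟩
    1 + 2 * (Λ + (X + ((7 + k) + Λ))) + 17   ≡⟨ e₁ Λ X k ⟩
    2 * X + 4 * Λ + (2 * k + 32)             ≤⟨ +-mono-≤ (+-monoˡ-≤ (4 * Λ) (*-monoˡ-≤ X (≤-trans 2≤32 (≤-trans (m≤n+m 32 (2 * k)) κ≥)))) κ≥ ⟩
    κ * X + 4 * Λ + κ                        ∎
    where
    open ≤-Reasoning
    X = ⌈log₂ x ⌉
    2≤32 : 2 ≤ 32
    2≤32 = s≤s (s≤s z≤n)
    e₁ : ∀ Λ X k → 1 + 2 * (Λ + (X + ((7 + k) + Λ))) + 17 ≡ 2 * X + 4 * Λ + (2 * k + 32)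
    e₁ = solve-∀
    e₂ : ∀ κ Λ x → suc (κ * x + (4 * Λ + κ) * x) + (x ∸ 1) ≡ suc (x ∸ 1) + (2 * κ + 4 * Λ) * x
    e₂ κ Λ x = arith κ Λ x (x ∸ 1)
      where
      arith : ∀ κ Λ x y → suc (κ * x + (4 * Λ + κ) * x) + y ≡ suc y + (2 * κ + 4 * Λ) * x
      arith = solve-∀
    fits : 2 ^ Λ * suc b ≤ 2 ^ (Λ + (X + ((7 + k) + Λ)))
    fits = begin
      2 ^ Λ * suc b                              ≤⟨ *-monoʳ-≤ (2 ^ Λ) (begin
        suc b                                      ≤⟨ s≤s b≤ ⟩
        suc (κ * x + 4 * Λ + κ)                    ≡⟨ cong suc (+-assoc (κ * x) (4 * Λ) κ) ⟩
        suc (κ * x + (4 * Λ + κ))                  ≤⟨ s≤s (+-monoʳ-≤ (κ * x) (m≤m*n (4 * Λ + κ) x {{>-nonZero x≥1}})) ⟩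
        suc (κ * x + (4 * Λ + κ) * x)              ≤⟨ m≤m+n _ (x ∸ 1) ⟩
        suc (κ * x + (4 * Λ + κ) * x) + (x ∸ 1)    ≡⟨ e₂ κ Λ x ⟩
        suc (x ∸ 1) + (2 * κ + 4 * Λ) * x          ≡⟨ cong (_+ (2 * κ + 4 * Λ) * x) (m+[n∸m]≡n x≥1) ⟩
        x + (2 * κ + 4 * Λ) * x                    ≡⟨ e₃ (2 * κ + 4 * Λ) x ⟩
        x * (2 * κ + 4 * Λ + 1)                    ≤⟨ *-mono-≤ (n≤2^⌈log₂n⌉ x) (≤-trans finalBits≤ (*-monoʳ-≤ (2 ^ (7 + k)) (1+n≤2^n Λ))) ⟩
        2 ^ X * (2 ^ (7 + k) * 2 ^ Λ)              ∎) ⟩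
      2 ^ Λ * (2 ^ X * (2 ^ (7 + k) * 2 ^ Λ))    ≡⟨ cong (λ z → 2 ^ Λ * (2 ^ X * z)) (sym (^-distribˡ-+-* 2 (7 + k) Λ)) ⟩
      2 ^ Λ * (2 ^ X * 2 ^ ((7 + k) + Λ))        ≡⟨ cong (2 ^ Λ *_) (sym (^-distribˡ-+-* 2 X ((7 + k) + Λ))) ⟩
      2 ^ Λ * 2 ^ (X + ((7 + k) + Λ))            ≡⟨ sym (^-distribˡ-+-* 2 Λ (X + ((7 + k) + Λ))) ⟩
      2 ^ (Λ + (X + ((7 + k) + Λ)))              ∎
      where
      e₃ : ∀ c x → x + c * x ≡ x * (c + 1)
      e₃ = solve-∀

  -- While `x` runs through the iterated logarithms that define `log*`, the bits stay below κ x + 4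
  -- Λ + κ. At x ≤ 1 this is at most `finalBits`.
  linialBits-bound : ∀ f x b → x ≤ f → b ≤ κ * x + 4 * Λ + κ → linialBits (2 ^ Λ) (logStarAux f x) b ≤ finalBits
  linialBits-bound zero    x b x≤f b≤ rewrite n≤0⇒n≡0 x≤f = begin
    b                      ≤⟨ b≤ ⟩
    κ * 0 + 4 * Λ + κ      ≡⟨ cong (λ z → z + 4 * Λ + κ) (*-zeroʳ κ) ⟩
    4 * Λ + κ              ≤⟨ m≤n+m _ κ ⟩
    κ + (4 * Λ + κ)        ≡⟨ e₁ κ Λ ⟩
    finalBits              ∎
    where
    open ≤-Reasoning
    e₁ : ∀ κ Λ → κ + (4 * Λ + κ) ≡ 2 * κ + 4 * Λ
    e₁ = solve-∀
  linialBits-bound (suc f) x b x≤f b≤ with x ≤ᵇ 1 | ≤ᵇ⇒≤ x 1 | ≤⇒≤ᵇ {x} {1}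
  ... | true  | x≤1 | _ = begin
    b                      ≤⟨ b≤ ⟩
    κ * x + 4 * Λ + κ      ≤⟨ +-monoˡ-≤ κ (+-monoˡ-≤ (4 * Λ) (*-monoʳ-≤ κ (x≤1 _))) ⟩
    κ * 1 + 4 * Λ + κ      ≡⟨ e₁ κ Λ ⟩
    finalBits              ∎
    where
    open ≤-Reasoning
    e₁ : ∀ κ Λ → κ * 1 + 4 * Λ + κ ≡ 2 * κ + 4 * Λ
    e₁ = solve-∀
  ... | false | _ | x≰1 = linialBits-bound f ⌈log₂ x ⌉ (bits (2 ^ Λ) b)
          (≤-trans (shrink x x≥1) (∸-monoˡ-≤ 1 x≤f)) (linialBits-step x b x≥1 b≤)
    where
    x≥1 : 1 ≤ x
    x≥1 = <⇒≤ (≰⇒> x≰1)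
    shrink : ∀ x → 1 ≤ x → ⌈log₂ x ⌉ ≤ x ∸ 1
    shrink (suc x) _ = ⌈log₂⌉-≤ (1+n≤2^n x)

  -- The initial O(k log n) bits are generously bounded by κ n + κ, so that `x` can start at `n` and
  -- follow exactly the iterates counted by `log*`.
  linialBits-log* : ∀ n → linialBits (2 ^ Λ) (log* n) (suc (⌈log₂ n ⌉ * k)) ≤ finalBits
  linialBits-log* n = linialBits-bound n n _ ≤-refl (begin
    suc (⌈log₂ n ⌉ * k)      ≤⟨ s≤s (*-mono-≤ {⌈log₂ n ⌉} {n} (⌈log₂⌉-≤ (≤-trans (n≤1+n n) (1+n≤2^n n))) k≤κ) ⟩
    1 + n * κ                ≤⟨ +-mono-≤ (m^n>0 2 (5 + k)) (≤-trans (≤-reflexive (*-comm n κ)) (m≤m+n (κ * n) (4 * Λ))) ⟩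
    κ + (κ * n + 4 * Λ)      ≡⟨ +-comm κ _ ⟩
    κ * n + 4 * Λ + κ        ∎)
    where
    open ≤-Reasoning
    k≤κ : k ≤ κ
    k≤κ = ≤-trans (m≤m+n k (1 * k)) (≤-trans (m≤m+n (2 * k) 32) κ≥)

-- Fourth roots and program lengths

abstract
  -- The fourth root rounded up, but at least 1. The value grows by at most one per step, so
  -- comparing with the previous value suffices.
  root : ℕ → ℕ
  root zero    = 1
  root (suc y) = if suc y ≤ᵇ root y ^ 4 then root y else suc (root y)

  root-positive : ∀ y → 1 ≤ root y
  root-positive zero    = ≤-refl
  root-positive (suc y) with suc y ≤ᵇ root y ^ 4
  ... | true  = root-positive y
  ... | false = s≤s z≤n

  root-lower : ∀ y → y ≤ root y ^ 4
  root-lower zero    = z≤n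
  root-lower (suc y) with suc y ≤ᵇ root y ^ 4 | ≤ᵇ⇒≤ (suc y) (root y ^ 4)
  ... | true  | p = p _
  ... | false | _ = ≤-trans (s≤s (root-lower y)) (^-monoˡ-< 4 (n<1+n (root y)))

  root-upper : ∀ y → root y ^ 4 ≤ 16 * suc y
  root-upper zero    = s≤s z≤n
  root-upper (suc y) with suc y ≤ᵇ root y ^ 4 | ≤⇒≤ᵇ {suc y} {root y ^ 4}
  ... | true  | _ = ≤-trans (root-upper y) (*-monoʳ-≤ 16 (n≤1+n (suc y)))
  ... | false | p = begin
    suc (root y) ^ 4       ≤⟨ ^-monoˡ-≤ 4 (+-monoˡ-≤ (root y) (root-positive y)) ⟩
    (root y + root y) ^ 4  ≡⟨ e₁ (root y) ⟩
    16 * root y ^ 4        ≤⟨ *-monoʳ-≤ 16 (≤-trans (<⇒≤ (≰⇒> p)) (n≤1+n (suc y))) ⟩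
    16 * suc (suc y)       ∎
    where
    open ≤-Reasoning
    e₁ : ∀ r → (r + r) * ((r + r) * ((r + r) * ((r + r) * 1))) ≡ 16 * (r * (r * (r * (r * 1))))
    e₁ = solve-∀

  passes : ℕ
  passes = 4

  passes≡ : passes ≡ 4
  passes≡ = refl

length-loop : ∀ n f m → (∀ i → length (f i) ≡ m) → length (loop n f) ≡ n * m
length-loop zero    f m p = refl
length-loop (suc n) f m p = trans (length-++ (loop n f)) (trans (cong₂ _+_ (length-loop n f m p) (p n)) (+-comm (n * m) m))

length-linialP : ∀ μ r b → length (linialP μ r b) ≡ r
length-linialP μ zero    b = refl
length-linialP μ (suc r) b = cong suc (length-linialP μ r (bits μ b))

module _ (K k r B : ℕ) where

  private
    P = size (2 * k) (bits (2 * k) B)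

  length-phaseP : length (phaseP K k r B) ≡ suc (K * suc (r * (P + 3) + k ^ r) + 3)
  length-phaseP = cong suc (trans (length-++ (loop K (levelP K k r B)))
    (cong (_+ 3) (length-loop K (levelP K k r B) _ level-length)))
    where
    pass-length : ∀ j → length (passP K k r B j) ≡ P + 3
    pass-length j = trans (cong (λ z → suc (suc z)) (trans (length-++ (loop P _)) (cong (_+ 1) (trans (length-loop P _ 1 (λ _ → refl)) (*-identityʳ P)))))
      (e₁ P)
      where
      e₁ : ∀ P → suc (suc (P + 1)) ≡ P + 3
      e₁ = solve-∀
    level-length : ∀ j → length (levelP K k r B j) ≡ suc (r * (P + 3) + k ^ r)
    level-length j = cong suc (trans (length-++ (loop r _)) (cong₂ _+_ (length-loop r _ _ (λ _ → pass-length j))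
      (trans (length-loop (k ^ r) _ 1 (λ _ → refl)) (*-identityʳ (k ^ r)))))

-- The colours at the end of a pass number O(q⁴), since log (q · poly q) = O(q).
size-bound : ∀ k q N B → 1 ≤ q → N ≤ q ^ 4 → suc B ≤ 2 ^ k * N →
             size (2 * q) (bits (2 * q) B) ≤ 8 * ((2 * k + 14) * (2 * k + 14)) * q ^ 4
size-bound k q N B q≥1 N≤ B≤ = begin
  size (2 * q) b                           ≡⟨ e₁ q (suc b) ⟩
  8 * ((suc b * suc b) * (q * q))          ≤⟨ *-monoʳ-≤ 8 (*-monoˡ-≤ (q * q) (*-mono-≤ b< b<)) ⟩
  8 * ((D * q) * (D * q) * (q * q))        ≡⟨ e₂ D q ⟩
  8 * (D * D) * q ^ 4                      ∎
  where
  open ≤-Reasoning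
  b = bits (2 * q) B
  D = 2 * k + 14
  e₁ : ∀ q s → (2 * q * s) * (2 * q * s + 2 * q * s) ≡ 8 * ((s * s) * (q * q))
  e₁ = solve-∀
  e₂ : ∀ D q → 8 * ((D * q) * (D * q) * (q * q)) ≡ 8 * (D * D) * (q * (q * (q * (q * 1))))
  e₂ = solve-∀
  q≤ : q ≤ 2 ^ q
  q≤ = ≤-trans (n≤1+n q) (1+n≤2^n q)
  fits : 2 * q * suc B ≤ 2 ^ (1 + q + (k + q * 4))
  fits = begin
    2 * q * suc B                            ≤⟨ *-mono-≤ (*-monoʳ-≤ 2 q≤) (≤-trans B≤ (*-monoʳ-≤ (2 ^ k) (≤-trans N≤ (^-monoˡ-≤ 4 q≤)))) ⟩
    2 * 2 ^ q * (2 ^ k * (2 ^ q) ^ 4)        ≡⟨ cong (λ z → 2 * 2 ^ q * (2 ^ k * z)) (^-*-assoc 2 q 4) ⟩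
    2 ^ (1 + q) * (2 ^ k * 2 ^ (q * 4))      ≡⟨ cong (2 ^ (1 + q) *_) (sym (^-distribˡ-+-* 2 k (q * 4))) ⟩
    2 ^ (1 + q) * 2 ^ (k + q * 4)            ≡⟨ sym (^-distribˡ-+-* 2 (1 + q) (k + q * 4)) ⟩
    2 ^ (1 + q + (k + q * 4))                ∎
  b< : suc b ≤ D * q
  b< = begin
    suc b                                    ≤⟨ s≤s (bits≤ (2 * q) B _ fits) ⟩
    suc (1 + 2 * (1 + q + (k + q * 4)))      ≡⟨ e₃ k q ⟩
    (2 * k + 4) + 10 * q                     ≤⟨ +-monoˡ-≤ (10 * q) (m≤m*n (2 * k + 4) q {{>-nonZero q≥1}}) ⟩
    (2 * k + 4) * q + 10 * q                 ≡⟨ e₄ k q ⟩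
    (2 * k + 14) * q                         ∎
    where
    e₃ : ∀ k q → suc (1 + 2 * (1 + q + (k + q * 4))) ≡ (2 * k + 4) + 10 * q
    e₃ = solve-∀
    e₄ : ∀ k q → (2 * k + 4) * q + 10 * q ≡ (2 * k + 14) * q
    e₄ = solve-∀

-- From the number of phases to ε

ceilDivSuc-≥ : ∀ x k → x ≤ ceilDivSuc x k * suc k
ceilDivSuc-≥ x k = +-cancelʳ-≤ k x _ (begin
  x + k                                       ≡⟨ m≡m%n+[m/n]*n (x + k) (suc k) ⟩
  (x + k) % suc k + (x + k) / suc k * suc k   ≤⟨ +-monoˡ-≤ _ (≤-pred (m%n<n (x + k) (suc k))) ⟩
  k + (x + k) / suc k * suc k                 ≡⟨ +-comm k _ ⟩
  (x + k) / suc k * suc k + k                 ∎)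
  where open ≤-Reasoning

module _ where
  open import Data.Integer using (+_; -[1+_]; +≤+)
  import Data.Integer as ℤ
  import Data.Integer.Properties as ℤₚ
  open import Data.Rational using (mkℚ; 1ℚ; toℚᵘ; *<*) renaming (_≤_ to _≤ℚ_; _/_ to _/ℚ_; _*_ to _*ℚ_; _+_ to _+ℚ_; _-_ to _-ℚ_; -_ to -ℚ_)
  import Data.Rational.Properties as ℚₚ
  open import Data.Rational.Unnormalised using (mkℚᵘ; *≤*)
  import Data.Rational.Unnormalised as ℚᵘ
  import Data.Rational.Unnormalised.Properties as ℚᵘₚ

  -- For ε = (p + 1)/(q + 1), `logInv` satisfies q + 1 ≤ 2 ^ R (p + 1), so `left` is at most ε ·
  -- `total`. The inequality is cleared of denominators in ℕ and brought back through unnormalised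
  -- rationals.
  ε-maximal : ∀ ε → 0ℚ <ℚ ε → ∀ total cov left → total ≤ cov + left → 2 ^ logInv ε * left ≤ total →
    (1ℚ -ℚ ε) *ℚ (+ total /ℚ 1) ≤ℚ (+ cov /ℚ 1)
  ε-maximal (mkℚ (+ zero) _ _) (*<* (ℤ.+<+ ()))
  ε-maximal (mkℚ -[1+ _ ] _ _) (*<* ())
  ε-maximal ε@(mkℚ (+ suc p) q _) _ total cov left total≤ left≤ = begin
    (1ℚ -ℚ ε) *ℚ t                     ≡⟨ ℚₚ.*-distribʳ-+ t 1ℚ (-ℚ ε) ⟩
    1ℚ *ℚ t +ℚ (-ℚ ε) *ℚ t             ≡⟨ cong₂ _+ℚ_ (ℚₚ.*-identityˡ t) (sym (ℚₚ.neg-distribˡ-* ε t)) ⟩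
    t +ℚ (-ℚ (ε *ℚ t))                 ≤⟨ ℚₚ.+-monoˡ-≤ (-ℚ (ε *ℚ t)) total≤ℚ ⟩
    (c +ℚ ε *ℚ t) +ℚ (-ℚ (ε *ℚ t))     ≡⟨ ℚₚ.+-assoc c (ε *ℚ t) (-ℚ (ε *ℚ t)) ⟩
    c +ℚ (ε *ℚ t +ℚ (-ℚ (ε *ℚ t)))     ≡⟨ cong (c +ℚ_) (ℚₚ.+-inverseʳ (ε *ℚ t)) ⟩
    c +ℚ 0ℚ                            ≡⟨ ℚₚ.+-identityʳ c ⟩
    c                                  ∎
    where
    open ℚₚ.≤-Reasoning
    t = + total /ℚ 1
    c = + cov /ℚ 1
    R = logInv ε
    q≤ : suc q ≤ 2 ^ R * suc p
    q≤ = ≤-trans (ceilDivSuc-≥ (suc q) p) (*-monoˡ-≤ (suc p) (n≤2^⌈log₂n⌉ (ceilDivSuc (suc q) p)))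
    cross : total * suc q ≤ cov * suc q + suc p * total
    cross = ≤-trans (*-monoˡ-≤ (suc q) total≤) (≤-trans (≤-reflexive (*-distribʳ-+ (suc q) cov left))
      (+-monoʳ-≤ (cov * suc q) (≤-trans (*-monoʳ-≤ left q≤) (≤-trans (≤-reflexive (e₁ left (2 ^ R) (suc p))) (*-monoʳ-≤ (suc p) left≤)))))
      where
      e₁ : ∀ l r p → l * (r * p) ≡ p * (r * l)
      e₁ = solve-∀
    unnormalised : mkℚᵘ (+ total) 0 ℚᵘ.≤ mkℚᵘ (+ cov) 0 ℚᵘ.+ mkℚᵘ (+ suc p) q ℚᵘ.* mkℚᵘ (+ total) 0
    unnormalised = *≤* (subst₂ ℤ._≤_ lhs rhs (+≤+ cross))
      where
      lhs : + (total * suc q) ≡ + total ℤ.* (+ (suc (q * 1 + 0)))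
      lhs = trans (cong (λ z → + (total * suc z)) (sym (trans (+-identityʳ (q * 1)) (*-identityʳ q)))) (ℤₚ.pos-* total _)
      rhs : + (cov * suc q + suc p * total) ≡ (+ cov ℤ.* + (suc (q * 1)) ℤ.+ (+ suc p ℤ.* + total) ℤ.* (+ 1)) ℤ.* (+ 1)
      rhs = sym (trans (ℤₚ.*-identityʳ _) (trans (cong₂ ℤ._+_
        (trans (cong (λ z → + cov ℤ.* + suc z) (*-identityʳ q)) (sym (ℤₚ.pos-* cov (suc q))))
        (trans (ℤₚ.*-identityʳ _) (sym (ℤₚ.pos-* (suc p) total)))) (sym (ℤₚ.pos-+ (cov * suc q) (suc p * total)))))
    toℚᵘ-nat : ∀ n → toℚᵘ (+ n /ℚ 1) ℚᵘ.≃ mkℚᵘ (+ n) 0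
    toℚᵘ-nat n = ℚₚ.toℚᵘ-fromℚᵘ (mkℚᵘ (+ n) 0)
    total≤ℚ : t ≤ℚ c +ℚ ε *ℚ t
    total≤ℚ = ℚₚ.toℚᵘ-cancel-≤ (ℚᵘₚ.≤-respˡ-≃ (ℚᵘₚ.≃-sym (toℚᵘ-nat total)) (ℚᵘₚ.≤-respʳ-≃ (ℚᵘₚ.≃-sym homo) unnormalised))
      where
      homo : toℚᵘ (c +ℚ ε *ℚ t) ℚᵘ.≃ mkℚᵘ (+ cov) 0 ℚᵘ.+ mkℚᵘ (+ suc p) q ℚᵘ.* mkℚᵘ (+ total) 0
      homo = ℚᵘₚ.≃-trans (ℚₚ.toℚᵘ-homo-+ c (ε *ℚ t)) (ℚᵘₚ.+-cong (toℚᵘ-nat cov)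
        (ℚᵘₚ.≃-trans (ℚₚ.toℚᵘ-homo-* ε t) (ℚᵘₚ.*-congˡ {mkℚᵘ (+ suc p) q} (toℚᵘ-nat total))))

abstract
  rootFactor : ℕ
  rootFactor = 16 * (1 + 6 * 2 ^ passes)

  rootFactor-≥ : ∀ K → 1 ≤ K → 16 * suc (6 * 2 ^ passes * K) ≤ rootFactor * K
  rootFactor-≥ K K≥1 = ≤-trans (*-monoʳ-≤ 16 (+-monoˡ-≤ (6 * 2 ^ passes * K) K≥1)) (≤-reflexive (sym (*-assoc 16 (1 + 6 * 2 ^ passes) K)))

-- Parameters and the round bound

module Parameters (k ℓ n : ℕ) where

  -- With 2 ^ ℓ ≥ Δ, 2 ^ Λ exceeds the degree 2 Δ of the line graph, and 2 ^ K = 8 · 2 ^ Λ leaves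
  -- room for the 8 in `start`. `q` is the least value allowed by `k-large`. A sum of two
  -- identifiers below n ^ k needs the extra bit in `b₀`.
  Λ K q b₀ B : ℕ
  Λ = 2 + ℓ
  K = 3 + Λ
  q = root (6 * 2 ^ passes * K)
  b₀ = suc (⌈log₂ n ⌉ * k)
  B = linialBits (2 ^ Λ) (log* n) b₀

  mainP : ℕ → List Step
  mainP i = linialP (2 ^ Λ) (log* n) b₀ ++ loop i (λ _ → phaseP K q passes B)

  q-large : 6 * 2 ^ passes * K ≤ q ^ passes
  q-large = subst (λ r → 6 * 2 ^ passes * K ≤ q ^ r) (sym passes≡) (root-lower (6 * 2 ^ passes * K))

  q≥1 : 1 ≤ q
  q≥1 = root-positive _

  q⁴≤ : q ^ 4 ≤ rootFactor * K
  q⁴≤ = ≤-trans (root-upper (6 * 2 ^ passes * K)) (rootFactor-≥ K (s≤s z≤n))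

  K≤q⁴ : K ≤ q ^ 4
  K≤q⁴ = ≤-trans (m≤n*m K (6 * 2 ^ passes) {{m*n≢0 6 (2 ^ passes) {{_}} {{m^n≢0 2 passes}}}}) (root-lower _)

phase-arithmetic : ∀ K P Q c d → 1 ≤ K → 1 ≤ Q → P ≤ c * Q → Q ≤ d * K →
                   suc (K * suc (4 * (P + 3) + Q) + 3) ≤ (4 + (4 * c + 14) * d) * (K * K)
phase-arithmetic K P Q c d K≥1 Q≥1 P≤ Q≤ = begin
  suc (K * suc (4 * (P + 3) + Q) + 3)       ≡⟨ e₁ K P Q ⟩
  4 * 1 + K * (4 * P + 13 * 1 + Q)          ≤⟨ +-mono-≤ (*-monoʳ-≤ 4 (*-mono-≤ K≥1 K≥1)) (*-monoʳ-≤ K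
                                                (+-monoˡ-≤ Q (+-mono-≤ (*-monoʳ-≤ 4 P≤) (*-monoʳ-≤ 13 Q≥1)))) ⟩
  4 * (K * K) + K * (4 * (c * Q) + 13 * Q + Q) ≡⟨ cong (λ z → 4 * (K * K) + K * z) (e₂ c Q) ⟩
  4 * (K * K) + K * ((4 * c + 14) * Q)      ≤⟨ +-monoʳ-≤ (4 * (K * K)) (*-monoʳ-≤ K (*-monoʳ-≤ (4 * c + 14) Q≤)) ⟩
  4 * (K * K) + K * ((4 * c + 14) * (d * K)) ≡⟨ e₃ K (4 * c + 14) d ⟩
  (4 + (4 * c + 14) * d) * (K * K)          ∎
  where
  open ≤-Reasoning
  e₁ : ∀ K P Q → suc (K * suc (4 * (P + 3) + Q) + 3) ≡ 4 * 1 + K * (4 * P + 13 * 1 + Q)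
  e₁ = solve-∀
  e₂ : ∀ c Q → 4 * (c * Q) + 13 * Q + Q ≡ (4 * c + 14) * Q
  e₂ = solve-∀
  e₃ : ∀ K c d → 4 * (K * K) + K * (c * (d * K)) ≡ (4 + c * d) * (K * K)
  e₃ = solve-∀

-- Not a number of colours but the factor D with b + 1 ≤ D q in `size-bound`, taken at 7 + k as
-- `finalBits≤` requires.
colours : ℕ → ℕ
colours k = 2 * (7 + k) + 14

phaseConstant : ℕ → ℕ
phaseConstant k = 4 + (4 * (8 * (colours k * colours k)) + 14) * rootFactor

length-phase≤ : ∀ k ℓ n → let open Parameters k ℓ n in length (phaseP K q passes B) ≤ phaseConstant k * (K * K)
length-phase≤ k ℓ n = begin
  length (phaseP K q passes B)                      ≡⟨ length-phaseP K q passes B ⟩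
  suc (K * suc (passes * (P + 3) + q ^ passes) + 3) ≡⟨ cong (λ r → suc (K * suc (r * (P + 3) + q ^ r) + 3)) passes≡ ⟩
  suc (K * suc (4 * (P + 3) + q ^ 4) + 3)           ≤⟨ phase-arithmetic K P (q ^ 4) (8 * (colours k * colours k)) rootFactor (s≤s z≤n) (≤-trans (s≤s z≤n) K≤q⁴)
                                                         (size-bound (7 + k) q K B q≥1 K≤q⁴ B<) q⁴≤ ⟩
  phaseConstant k * (K * K)                         ∎
  where
  open ≤-Reasoning
  open Parameters k ℓ n
  P = size (2 * q) (bits (2 * q) B)
  B< : suc B ≤ 2 ^ (7 + k) * K
  B< = ≤-trans (s≤s (linialBits-log* Λ k n)) (≤-trans (≤-reflexive (+-comm 1 (finalBits Λ k)))
         (≤-trans (finalBits≤ Λ k) (*-monoʳ-≤ (2 ^ (7 + k)) (+-monoˡ-≤ Λ (s≤s {n = 2} z≤n)))))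

roundConstant : ℕ → ℕ → ℕ
roundConstant c k = 1 + 63 * (phaseConstant k * (36 * ((c * c) * (c * c))))

-- K = 5 + ℓ ≤ 6 ℓ ≤ 6 c² lg gives the factor 36 c⁴ for the two factors K of a phase. The opening
-- round is absorbed because lg² R ≥ 1.
length-main≤ : ∀ c k ℓ n R lg → 1 ≤ ℓ → ℓ ≤ c * c * lg → 1 ≤ lg → 1 ≤ R →
  suc (length (Parameters.mainP k ℓ n (R * 63))) ≤ roundConstant c k * (lg * lg * R + log* n)
length-main≤ c k ℓ n R lg ℓ≥1 ℓ≤ lg≥1 R≥1 = begin
  suc (length (mainP (R * 63)))                         ≡⟨ cong suc (trans (length-++ (linialP (2 ^ Λ) (log* n) b₀)) (cong₂ _+_ (length-linialP (2 ^ Λ) (log* n) b₀) (length-loop (R * 63) _ _ (λ _ → refl)))) ⟩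
  suc (log* n + R * 63 * length (phaseP K q passes B)) ≤⟨ s≤s (+-monoʳ-≤ (log* n) (*-monoʳ-≤ (R * 63) (≤-trans (length-phase≤ k ℓ n) (*-monoʳ-≤ F K²≤)))) ⟩
  suc (log* n + R * 63 * (F * (36 * (D * D * (lg * lg))))) ≡⟨ cong (λ z → suc (log* n + z)) (e₁ R 63 F 36 (D * D) (lg * lg)) ⟩
  1 + (log* n + H * (lg * lg * R))               ≤⟨ +-monoˡ-≤ _ (*-mono-≤ (*-mono-≤ lg≥1 lg≥1) R≥1) ⟩
  lg * lg * R + (log* n + H * (lg * lg * R))     ≤⟨ m≤m+n _ (H * log* n) ⟩
  lg * lg * R + (log* n + H * (lg * lg * R)) + H * log* n ≡⟨ e₂ H (lg * lg * R) (log* n) ⟩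
  (1 + H) * (lg * lg * R + log* n)               ∎
  where
  open ≤-Reasoning
  open Parameters k ℓ n
  F = phaseConstant k
  D = c * c
  H = 63 * (F * (36 * (D * D)))
  e₁ : ∀ R s F t D l → R * s * (F * (t * (D * l))) ≡ s * (F * (t * D)) * (l * R)
  e₁ = solve-∀
  e₂ : ∀ H x y → x + (y + H * x) + H * y ≡ (1 + H) * (x + y)
  e₂ = solve-∀
  e₃ : ∀ D l → 6 * (D * l) * (6 * (D * l)) ≡ 36 * (D * D * (l * l))
  e₃ = solve-∀
  K≤ : K ≤ 6 * (D * lg)
  K≤ = ≤-trans (+-monoˡ-≤ ℓ (*-monoʳ-≤ 5 ℓ≥1)) (≤-trans (≤-reflexive (+-comm (5 * ℓ) ℓ)) (*-monoʳ-≤ 6 ℓ≤))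
  K²≤ : K * K ≤ 36 * (D * D * (lg * lg))
  K²≤ = ≤-trans (*-mono-≤ K≤ K≤) (≤-reflexive (e₃ D lg))

-- For ℓ = 0 the maximum degree is at most 1, and every edge is matched from the start.
program : ℕ → ℕ → ℕ → ℕ → List (Maybe Step)
program k n zero    R       = []
program k n (suc ℓ) zero    = []
program k n (suc ℓ) (suc R) = nothing ∷ map just (Parameters.mainP k (suc ℓ) n (suc R * 63))

isZero : ℕ → ℕ
isZero zero    = 1
isZero (suc _) = 0

∑-length : {A : Set} (xs : List A) → ∑ xs (λ _ → 1) ≡ length xs
∑-length []       = refl
∑-length (x ∷ xs) = cong suc (∑-length xs)

solver : ℕ → ℕ → ℚ → LocalAlg
solver c k ε = algorithm (λ n L → program k n (c * L) (logInv ε)) (λ L → isZero (c * L))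

-- Correctness and the final bound

module Correctness (c k : ℕ) (ε : ℚ) (ε>0 : 0ℚ <ℚ ε) {n : ℕ} (G : Graph n) (ident : Fin n → ℕ)
                   (ident-inj : Injective _≡_ _≡_ ident) (ident< : ∀ v → ident v < n ^ k) (L : ℕ)
                   (lg≤ : ⌈log₂ maxDeg G ⌉ ≤ c * L) where
  open Graph G
  open LineGraph G
  open Conflicts Dart es a a-sym
  open Semantics Dart es a a-sym
  open Algorithm Dart es a a-sym rv a-rev
  open Simulation (λ n L → program k n (c * L) (logInv ε)) (λ L → isZero (c * L)) G ident L

  Correct : Set
  Correct = ConsistentMatching (solver c k ε) G ident L × εMaximal (solver c k ε) G ident L ε

  conclude : (m act : Dart → ℕ) →
    (∀ v → output (solver c k ε) G ident L v ≡ first (λ i → m (v , i))) →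
    Invariant m → (∀ v i i′ → m (v , i) ≢ 0 → m (v , i′) ≢ 0 → i ≡ i′) →
    (∀ e → act e ≡ 0 → (Σ _ λ i → m (tl e , i) ≢ 0) ⊎ (Σ _ λ j → m (hd e , j) ≢ 0)) →
    2 ^ logInv ε * ∑ es act ≤ ∑ es (λ _ → 1) → Correct
  conclude m act output≡ m-rv unique cover few =
    consistent m act output≡ m-rv unique cover ,
    ε-maximal ε ε>0 _ _ (∑ es act) (few-uncovered m act output≡ m-rv unique cover)
      (≤-trans few (≤-reflexive (∑-length es)))

  output-empty : program k n (c * L) (logInv ε) ≡ [] →
    ∀ v → output (solver c k ε) G ident L v ≡ first {deg v} (λ _ → isZero (c * L))
  output-empty eq v = cong (λ t → first (λ i → mat (proj₂ (stateAt (solver c k ε) G ident L t v) i))) (cong length eq)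

  maxDeg≤ : maxDeg G ≤ 2 ^ (c * L)
  maxDeg≤ = ≤-trans (n≤2^⌈log₂n⌉ (maxDeg G)) (^-monoʳ-≤ 2 lg≤)

  correct-matching : c * L ≡ 0 → Correct
  correct-matching eq = conclude (λ _ → 1) (λ _ → 0)
    (λ v → trans (output-empty (cong (λ z → program k n z (logInv ε)) eq) v) (cong (λ z → first {deg v} (λ _ → isZero z)) eq))
    (λ _ → refl) (λ v i i′ _ _ → unique (≤-trans (deg≤maxDeg v) (subst (λ z → maxDeg G ≤ 2 ^ z) eq maxDeg≤)) i i′)
    (λ e _ → inj₁ (proj₂ e , λ ()))
    (≤-trans (≤-reflexive (trans (cong (2 ^ logInv ε *_) (∑-0 es (λ _ → refl))) (*-zeroʳ (2 ^ logInv ε)))) z≤n)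
    where
    unique : ∀ {d} → d ≤ 1 → (i i′ : Fin d) → i ≡ i′
    unique {1} _ Fin.zero Fin.zero = refl
    unique {suc (suc _)} (s≤s ()) _ _

  -- `logInv ε ≡ 0` means ε ≥ 1, for which the empty matching suffices.
  correct-trivial : ∀ ℓ → c * L ≡ suc ℓ → logInv ε ≡ 0 → Correct
  correct-trivial ℓ eq eq′ = conclude (λ _ → 0) (λ _ → 1)
    (λ v → trans (output-empty (cong₂ (program k n) eq eq′) v) (cong (λ z → first {deg v} (λ _ → isZero z)) eq))
    (λ _ → refl) (λ _ _ _ p _ → ⊥-elim (p refl)) (λ _ ())
    (≤-reflexive (trans (cong (λ z → 2 ^ z * ∑ es (λ _ → 1)) eq′) (*-identityˡ _)))

  module _ (ℓ R : ℕ) (eqℓ : c * L ≡ suc ℓ) (eqR : logInv ε ≡ suc R) where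
    open Parameters k (suc ℓ) n

    private
      ids = idSum ident ident-inj

      col₀ : Dart → ℕ
      col₀ = linialCol (2 ^ Λ) (log* n) b₀ ids

    degree< : ∀ e → suc (nb e (λ _ → 1)) ≤ 2 ^ Λ
    degree< e = begin
      suc (nb e (λ _ → 1))              ≤⟨ s≤s (≤-trans (degree-bound e) (+-mono-≤ (deg≤ (tl e)) (deg≤ (hd e)))) ⟩
      1 + (P + P)                       ≤⟨ +-monoˡ-≤ (P + P) (≤-trans (m^n>0 2 (suc ℓ)) (m≤m+n P P)) ⟩
      (P + P) + (P + P)                 ≡⟨ e₁ P ⟩
      2 * (2 * P)                       ∎
      where
      open ≤-Reasoning
      P = 2 ^ suc ℓ
      deg≤ : ∀ v → deg v ≤ P
      deg≤ v = ≤-trans (deg≤maxDeg v) (subst (λ z → maxDeg G ≤ 2 ^ z) eqℓ maxDeg≤)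
      e₁ : ∀ P → (P + P) + (P + P) ≡ 2 * (2 * P)
      e₁ = solve-∀

    ids< : ∀ e → ids e < 2 ^ b₀
    ids< e = begin-strict
      ident (tl e) + ident (hd e)       <⟨ +-mono-< (ident< (tl e)) (ident< (hd e)) ⟩
      n ^ k + n ^ k                     ≡⟨ cong (n ^ k +_) (sym (+-identityʳ (n ^ k))) ⟩
      2 * n ^ k                         ≤⟨ *-monoʳ-≤ 2 (^-monoˡ-≤ k (n≤2^⌈log₂n⌉ n)) ⟩
      2 * (2 ^ ⌈log₂ n ⌉) ^ k           ≡⟨ cong (2 *_) (^-*-assoc 2 ⌈log₂ n ⌉ k) ⟩
      2 ^ b₀                            ∎
      where open ≤-Reasoning

    col-rev : ∀ e → col₀ (rv e) ≡ col₀ e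
    col-rev e = cong col (subst (λ X → X (rv e) ≡ X e) (linialP-runs (2 ^ Λ) (log* n) b₀ ids (λ _ → 1) (λ _ → 0))
      (runs-rev (linialP (2 ^ Λ) (log* n) b₀) _ (λ e → cong (λ z → reg z 1 0 0 0 0 0 0) (idSum-rv ident ident-inj e)) e))

    private
      instance
        q≢0 : NonZero q
        q≢0 = >-nonZero q≥1

      proper-colouring : (∀ e → col₀ e < 2 ^ B) × Proper col₀
      proper-colouring = linial-proper Λ degree< (log* n) b₀ ids ids< (idSum-proper ident ident-inj)

      degree-scaled : ∀ e → 8 * suc (nb e (λ _ → 1)) ≤ 2 ^ K
      degree-scaled e = ≤-trans (*-monoʳ-≤ 8 (degree< e)) (≤-reflexive (sym (^-distribˡ-+-* 2 3 Λ)))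

    open Phases vanish claw K q passes B col₀ col-rev (proj₁ proper-colouring) (proj₂ proper-colouring) q-large degree-scaled

    program≡ : ∀ i → i ≡ suc R * 63 → program k n (c * L) (logInv ε) ≡ nothing ∷ map just (mainP i)
    program≡ i i≡ = trans (cong₂ (program k n) eqℓ eqR) (cong (λ z → nothing ∷ map just (mainP z)) (sym i≡))

    mainP-runs : ∀ i → runs (mainP i) (λ e → reg (ids e) 1 0 0 0 0 0 0)
               ≡ state col₀ (acts i) (mats i) (λ _ → 0) (λ _ → 0) (λ _ → 0) (λ _ → 0) (λ _ → 0)
    mainP-runs i = trans (runs-++ (linialP (2 ^ Λ) (log* n) b₀) (loop i (λ _ → phaseP K q passes B)) (λ e → reg (ids e) 1 0 0 0 0 0 0))
      (trans (cong (runs (loop i (λ _ → phaseP K q passes B))) (linialP-runs (2 ^ Λ) (log* n) b₀ ids (λ _ → 1) (λ _ → 0))) (phases-runs i))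

    few : ∀ z i → z ≡ suc R → i ≡ suc R * 63 → 2 ^ z * ∑ es (acts i) ≤ ∑ es (λ _ → 1)
    few z i z≡ i≡ = subst₂ (λ z y → 2 ^ z * ∑ es (acts y) ≤ ∑ es (λ _ → 1)) (sym z≡) (sym i≡) (acts-decay (suc R))

    output-main : ∀ i → i ≡ suc R * 63 → ∀ v → output (solver c k ε) G ident L v ≡ first (λ j → mats i (v , j))
    output-main i i≡ v = trans (simulate-program (mainP i) (program≡ i i≡) ident-inj v) (first-cong (λ j →
      trans (cong (λ z → mat (runs (mainP i) (λ e → reg (ids e) 1 (isZero z) 0 0 0 0 0) (v , j))) eqℓ)
            (cong (λ X → mat (X (v , j))) (mainP-runs i))))

    correct-main : ∀ i → i ≡ suc R * 63 → Correct
    correct-main i i≡ = conclude (mats i) (acts i) (output-main i i≡) mats-rev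
      (matching-unique {acts i} {mats i} matching) (matching-cover {acts i} {mats i} mats-rev matching) (few (logInv ε) i eqR i≡)
      where
      mats-rev : Invariant (mats i)
      mats-rev = proj₁ (proj₂ (invariant i))
      matching : Matching (acts i) (mats i)
      matching = proj₂ (proj₂ (invariant i))

  correct : Correct
  correct = cases (c * L) (logInv ε) refl refl
    where
    cases : ∀ ℓ R → c * L ≡ ℓ → logInv ε ≡ R → Correct
    cases zero    R       eq eq′ = correct-matching eq
    cases (suc ℓ) zero    eq eq′ = correct-trivial ℓ eq eq′
    cases (suc ℓ) (suc R) eq eq′ = correct-main ℓ R eq eq′ (suc R * 63) refl

solver-rounds : ∀ c k ε n L lg → L ≤ c * lg →
  LocalAlg.rounds (solver c k ε) n L ≤ roundConstant c k * (lg * lg * logInv ε + log* n)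
solver-rounds c k ε n L lg L≤ = cases (c * L) (logInv ε) refl refl
  where
  cases : ∀ ℓ R → c * L ≡ ℓ → logInv ε ≡ R →
    length (program k n ℓ R) ≤ roundConstant c k * (lg * lg * R + log* n)
  cases zero    R       eq eq′ = z≤n
  cases (suc ℓ) zero    eq eq′ = z≤n
  cases (suc ℓ) (suc R) eq eq′ = ≤-trans (≤-reflexive (cong suc (length-map just (Parameters.mainP k (suc ℓ) n (suc R * 63)))))
    (length-main≤ c k (suc ℓ) n (suc R) lg (s≤s z≤n) ℓ≤ lg≥1 (s≤s z≤n))
    where
    ℓ≤ : suc ℓ ≤ c * c * lg
    ℓ≤ = ≤-trans (≤-reflexive (sym eq)) (≤-trans (*-monoʳ-≤ c L≤) (≤-reflexive (sym (*-assoc c c lg))))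
    -- If `lg` were 0, L ≤ c · lg would make c · L zero, contrary to this case.
    lg≥1 : 1 ≤ lg
    lg≥1 = n≢0⇒n>0 (λ z → 1+n≢0 (n≤0⇒n≡0 (≤-trans ℓ≤ (≤-reflexive (trans (cong (c * c *_) z) (*-zeroʳ (c * c)))))))

theorem1p4 : (c k : ℕ) →
    Σ ℕ λ C →
    (ε : ℚ) → 0ℚ <ℚ ε →
    Σ LocalAlg λ A →
    (n : ℕ) (G : Graph n) (ident : Fin n → ℕ) →
    Injective _≡_ _≡_ ident →
    ((v : Fin n) → ident v < n ^ k) →
    (L : ℕ) →
    ⌈log₂ maxDeg G ⌉ ≤ c * L →
    L ≤ c * ⌈log₂ maxDeg G ⌉ →
    ConsistentMatching A G ident L
    × εMaximal A G ident L ε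
    × LocalAlg.rounds A n L
    ≤ C * (⌈log₂ maxDeg G ⌉ * ⌈log₂ maxDeg G ⌉ * logInv ε + log* n)
theorem1p4 c k = roundConstant c k , λ ε ε>0 → solver c k ε , λ n G ident inj ident< L lg≤ L≤ →
  let matching , maximal = Correctness.correct c k ε ε>0 G ident inj ident< L lg≤
  in matching , maximal , solver-rounds c k ε n L ⌈log₂ maxDeg G ⌉ L≤
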